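{- Let $\mathcal{F}:\mathcal{C}\to\Omega$ be a quasi-Fitting invariant. Then for any $n\in\mathbb{Z}$, the following map $\mathcal{F}^{\langle n\rangle}:\mathcal{C}\to\Omega$ is well-defined and, moreover, $\mathcal{F}^{\langle n\rangle}$ is again a quasi-Fitting invariant. (1) Suppose $n\ge0$. For each $M\in\mathcal{C}$, take an exact sequence \[ 0\to N\to P_1\to\dots\to P_n\to M\to0 \] in $\mathcal{C}$ with $P_1,\dots,P_n\in\mathcal{P}$ and define \[ \mathcal{F}^{\langle n\rangle}(M)=\left(\prod_{i=1}^n\mathcal{F}(P_i)^{(-1)^i}\right)\mathcal{F}(N). \] (2) Suppose $n<0$. For each $M\in\mathcal{C}$, take an exact sequence \[ 0\to M\to P_{ -n}\to\dots\to P_1\to N\to0 \] in $\mathcal{C}$ with $P_1,\dots,P_{ -n}\in\mathcal{P}$ and define \[ \mathcal{F}^{\langle n\rangle}(M)=\left(\prod_{i=1}^{ -n}\mathcal{F}(P_i)^{(-1)^i}\right)\mathcal{F}(N). \]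
   Context: $R$ is a (not necessarily commutative) left and right noetherian ring with unity, and $S$ is an Ore set of $R$ consisting of non-zero-divisors: $1\in S$; $S$ is closed under multiplication; for $f\in S$, $a\in R$ one has $fR\cap aS\ne\emptyset$ and $Rf\cap Sa\ne\emptyset$. Put $E^i_R(M)=\mathrm{Ext}^i_R(M,R)$ and $\mathrm{pd}^\star_R(M)=\sup\{i\in\mathbb Z\mid E^i_R(M)\ne0\}$. It is assumed that there is an integer $d(R)$ with $\mathrm{pd}^\star_R(M)\le d(R)$ for every finitely generated left or right $R$-module $M$. $\mathcal M$ is the category of finitely generated $S$-torsion left $R$-modules ($S$-torsion: every element is annihilated by an element of $S$), $\mathcal C=\{M\in\mathcal M\mid\mathrm{pd}^\star_R(M)\le1\}$, $\mathcal P=\{P\in\mathcal M\mid\mathrm{pd}_R(P)\le1\}\subset\mathcal C$. A sequence is "exact in $\mathcal C$" if it is an exact sequence of $R$-modules which, when split into short exact sequences, has all terms (including the intermediate images) in $\mathcal C$. A quasi-Fitting invariant is a map $\mathcal F$ assigning to each object of $\mathcal C$ an element of a commutative monoid $\Omega$ such that: (i) $\mathcal F(P)\in\Omega^\times$ for $P\in\mathcal P$; (ii) if $0\to M'\to M\to P\to0$ is exact in $\mathcal C$ with $P\in\mathcal P$, then $\mathcal F(M)=\mathcal F(P)\mathcal F(M')$; (iii) if $0\to P\to M\to M'\to0$ is exact in $\mathcal C$ with $P\in\mathcal P$, then $\mathcal F(M)=\mathcal F(P)\mathcal F(M')$. "Well-defined" means that such an exact sequence exists for each $M$ and that the value does not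 depend on its choice. -}

module Defs where

open import Level using (Level; _⊔_) renaming (suc to lsuc)
open import Algebra.Bundles using (Ring; CommutativeMonoid)
open import Algebra.Definitions using (Invertible)
import Algebra.Definitions.RawMonoid as RawMonoidDefs
import Algebra.Construct.Flip.Op as Flip
open import Algebra.Module.Bundles using (LeftModule)
import Algebra.Module.Construct.TensorUnit as TensorUnit
import Algebra.Module.Morphism.Construct.Composition as Composition
import Algebra.Module.Morphism.Structures as Morphisms
import Algebra.Module.Properties.LeftModule as LeftModuleProperties
open import Data.Fin.Base using (Fin; zero; suc; toℕ; opposite)
open import Data.Integer.Base as ℤ using (ℤ; -[1+_]; 1ℤ; -1ℤ; ∣_∣)
open import Data.Nat.Base as ℕ using (ℕ; zero; suc)
open import Data.Product.Base using (Σ; Σ-syntax; ∃-syntax; _×_; _,_; proj₁; proj₂)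
open import Data.Vec.Functional using (Vector)
open import Function.Base using (_∘_)
open import Function.Definitions using (Injective; Surjective)
open import Relation.Binary.Definitions using (_Respects_)

-- One universe level ℓ serves for the ring, all modules over it and all
-- subsets, so that kernels, quotients, duals and free modules stay in it.

module _ {ℓ : Level} where

  -- Left modules over R ᵒᵖ are the right R-modules.
  infix 10 _ᵒᵖ
  _ᵒᵖ : Ring ℓ ℓ → Ring ℓ ℓ
  R ᵒᵖ = Flip.ring R

module _ {ℓ : Level} (R : Ring ℓ ℓ) where

  Mod : Set (lsuc ℓ)
  Mod = LeftModule R ℓ ℓ

  regular : Mod
  regular = TensorUnit.leftModule {R = R}

module _ {ℓ : Level} {R : Ring ℓ ℓ} where

  private
    module R = Ring R

  open LeftModule using () renaming (Carrierᴹ to ∣_∣ᴹ)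

  record Hom (M N : Mod R) : Set ℓ where
    private
      module M = LeftModule M
      module N = LeftModule N
    open Morphisms.LeftModuleMorphisms M.rawLeftModule N.rawLeftModule
    field
      ⟦_⟧   : ∣ M ∣ᴹ → ∣ N ∣ᴹ
      isHom : IsLeftModuleHomomorphism ⟦_⟧
    open IsLeftModuleHomomorphism isHom public
      using (⟦⟧-cong; +ᴹ-homo; *ₗ-homo; 0ᴹ-homo; -ᴹ-homo)

  open Hom public using (⟦_⟧)

  module _ (M N : Mod R) where
    private
      module M = LeftModule M
      module N = LeftModule N
      module NP = LeftModuleProperties N

    mkHom : (f : ∣ M ∣ᴹ → ∣ N ∣ᴹ) →
            (∀ {x y} → x M.≈ᴹ y → f x N.≈ᴹ f y) →
            (∀ x y → f (x M.+ᴹ y) N.≈ᴹ (f x N.+ᴹ f y)) →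
            (∀ r x → f (r M.*ₗ x) N.≈ᴹ (r N.*ₗ f x)) →
            Hom M N
    mkHom f f-cong f-+ f-* = record
      { ⟦_⟧   = f
      ; isHom = record
        { +ᴹ-isGroupHomomorphism = record
          { isMonoidHomomorphism = record
            { isMagmaHomomorphism = record
              { isRelHomomorphism = record { cong = f-cong }
              ; homo = f-+
              }
            ; ε-homo = f-0
            }
          ; ⁻¹-homo = λ x → NP.inverseˡ-uniqueᴹ (f (M.-ᴹ x)) (f x)
              (N.≈ᴹ-trans (N.≈ᴹ-sym (f-+ (M.-ᴹ x) x))
                (N.≈ᴹ-trans (f-cong (M.-ᴹ‿inverseˡ x)) f-0))
          }
        ; *ₗ-homo = f-*
        }
      }
      where
      f-0 : f M.0ᴹ N.≈ᴹ N.0ᴹ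
      f-0 = N.≈ᴹ-trans (f-cong (M.≈ᴹ-sym (M.*ₗ-zeroˡ M.0ᴹ)))
              (N.≈ᴹ-trans (f-* R.0# M.0ᴹ) (N.*ₗ-zeroˡ (f M.0ᴹ)))

  infixr 9 _∘ʰ_
  _∘ʰ_ : {L M N : Mod R} → Hom M N → Hom L M → Hom L N
  _∘ʰ_ {L} {M} {N} g f = record
    { ⟦_⟧   = ⟦ g ⟧ ∘ ⟦ f ⟧
    ; isHom = Composition.isLeftModuleHomomorphism
                {M₁ = LeftModule.rawLeftModule L}
                {M₂ = LeftModule.rawLeftModule M}
                {M₃ = LeftModule.rawLeftModule N}
                (LeftModule.≈ᴹ-trans N) (Hom.isHom f) (Hom.isHom g)
    }

  IsZero : Mod R → Set ℓ
  IsZero M = ∀ x → x ≈ᴹ 0ᴹ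
    where open LeftModule M

  IsInjective : {M N : Mod R} → Hom M N → Set ℓ
  IsInjective {M} {N} f = Injective (LeftModule._≈ᴹ_ M) (LeftModule._≈ᴹ_ N) ⟦ f ⟧

  IsSurjective : {M N : Mod R} → Hom M N → Set ℓ
  IsSurjective {M} {N} f = Surjective (LeftModule._≈ᴹ_ M) (LeftModule._≈ᴹ_ N) ⟦ f ⟧

  IsExact : {L M N : Mod R} → Hom L M → Hom M N → Set ℓ
  IsExact {L} {M} {N} f g =
      (∀ x → ⟦ g ⟧ (⟦ f ⟧ x) N.≈ᴹ N.0ᴹ)
    × (∀ y → ⟦ g ⟧ y N.≈ᴹ N.0ᴹ → ∃[ x ] ⟦ f ⟧ x M.≈ᴹ y)
    where
    module M = LeftModule M
    module N = LeftModule N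

  record Submodule (M : Mod R) : Set (lsuc ℓ) where
    open LeftModule M
    field
      Member : Carrierᴹ → Set ℓ
      resp   : Member Respects _≈ᴹ_
      0ᴹ∈    : Member 0ᴹ
      +ᴹ∈    : ∀ {x y} → Member x → Member y → Member (x +ᴹ y)
      *ₗ∈    : ∀ r {x} → Member x → Member (r *ₗ x)

    -ᴹ∈ : ∀ {x} → Member x → Member (-ᴹ x)
    -ᴹ∈ {x} x∈ = resp (inverseˡ-uniqueᴹ _ x -1x+x≈0) (*ₗ∈ (R.- R.1#) x∈)
      where
      open LeftModuleProperties M using (inverseˡ-uniqueᴹ)
      -1x+x≈0 : (((R.- R.1#) *ₗ x) +ᴹ x) ≈ᴹ 0ᴹ
      -1x+x≈0 =
        ≈ᴹ-trans (+ᴹ-congˡ (≈ᴹ-sym (*ₗ-identityˡ x)))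
          (≈ᴹ-trans (≈ᴹ-sym (*ₗ-distribʳ x (R.- R.1#) R.1#))
            (≈ᴹ-trans (*ₗ-congʳ (R.-‿inverseˡ R.1#)) (*ₗ-zeroˡ x)))

  toModule : {M : Mod R} → Submodule M → Mod R
  toModule {M} N = record
    { Carrierᴹ = Σ Carrierᴹ Member
    ; _≈ᴹ_ = λ x y → proj₁ x ≈ᴹ proj₁ y
    ; _+ᴹ_ = λ (x , x∈) (y , y∈) → x +ᴹ y , +ᴹ∈ x∈ y∈
    ; _*ₗ_ = λ r (x , x∈) → r *ₗ x , *ₗ∈ r x∈
    ; 0ᴹ = 0ᴹ , 0ᴹ∈
    ; -ᴹ_ = λ (x , x∈) → -ᴹ x , -ᴹ∈ x∈
    ; isLeftModule = record
      { isLeftSemimodule = record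
        { +ᴹ-isCommutativeMonoid = record
          { isMonoid = record
            { isSemigroup = record
              { isMagma = record
                { isEquivalence = record
                  { refl = ≈ᴹ-refl ; sym = ≈ᴹ-sym ; trans = ≈ᴹ-trans }
                ; ∙-cong = +ᴹ-cong
                }
              ; assoc = λ x y z → +ᴹ-assoc (proj₁ x) (proj₁ y) (proj₁ z)
              }
            ; identity = (λ x → +ᴹ-identityˡ (proj₁ x)) , (λ x → +ᴹ-identityʳ (proj₁ x))
            }
          ; comm = λ x y → +ᴹ-comm (proj₁ x) (proj₁ y)
          }
        ; isPreleftSemimodule = record
          { *ₗ-cong = *ₗ-cong
          ; *ₗ-zeroˡ = λ x → *ₗ-zeroˡ (proj₁ x)
          ; *ₗ-distribʳ = λ x → *ₗ-distribʳ (proj₁ x)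
          ; *ₗ-identityˡ = λ x → *ₗ-identityˡ (proj₁ x)
          ; *ₗ-assoc = λ r s x → *ₗ-assoc r s (proj₁ x)
          ; *ₗ-zeroʳ = *ₗ-zeroʳ
          ; *ₗ-distribˡ = λ r x y → *ₗ-distribˡ r (proj₁ x) (proj₁ y)
          }
        }
      ; -ᴹ‿cong = -ᴹ‿cong
      ; -ᴹ‿inverse = (λ x → -ᴹ‿inverseˡ (proj₁ x)) , (λ x → -ᴹ‿inverseʳ (proj₁ x))
      }
    }
    where
    open LeftModule M
    open Submodule N

  inclusion : {M : Mod R} (N : Submodule M) → Hom (toModule N) M
  inclusion {M} N = mkHom (toModule N) M proj₁
    (λ eq → eq) (λ _ _ → ≈ᴹ-refl) (λ _ _ → ≈ᴹ-refl)
    where open LeftModule M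

  zeroSubmodule : (M : Mod R) → Submodule M
  zeroSubmodule M = record
    { Member = λ x → x ≈ᴹ 0ᴹ
    ; resp = λ x≈y x≈0 → ≈ᴹ-trans (≈ᴹ-sym x≈y) x≈0
    ; 0ᴹ∈ = ≈ᴹ-refl
    ; +ᴹ∈ = λ p q → ≈ᴹ-trans (+ᴹ-cong p q) (+ᴹ-identityˡ 0ᴹ)
    ; *ₗ∈ = λ r p → ≈ᴹ-trans (*ₗ-congˡ p) (*ₗ-zeroʳ r)
    }
    where open LeftModule M

  preimage : {M N : Mod R} → Hom M N → Submodule N → Submodule M
  preimage {M} {N} f K = record
    { Member = λ x → Member (⟦ f ⟧ x)
    ; resp = λ x≈y → resp (⟦⟧-cong x≈y)
    ; 0ᴹ∈ = resp (≈ᴹ-sym 0ᴹ-homo) 0ᴹ∈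
    ; +ᴹ∈ = λ p q → resp (≈ᴹ-sym (+ᴹ-homo _ _)) (+ᴹ∈ p q)
    ; *ₗ∈ = λ r p → resp (≈ᴹ-sym (*ₗ-homo r _)) (*ₗ∈ r p)
    }
    where
    open LeftModule N using (≈ᴹ-sym)
    open Submodule K
    open Hom f using (⟦⟧-cong; +ᴹ-homo; *ₗ-homo; 0ᴹ-homo)

  kernel : {M N : Mod R} → Hom M N → Submodule M
  kernel {N = N} f = preimage f (zeroSubmodule N)

  image : {M N : Mod R} → Hom M N → Submodule N
  image {M} {N} f = record
    { Member = λ y → ∃[ x ] ⟦ f ⟧ x ≈ᴹ y
    ; resp = λ y≈z (x , fx≈y) → x , ≈ᴹ-trans fx≈y y≈z
    ; 0ᴹ∈ = M.0ᴹ , 0ᴹ-homo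
    ; +ᴹ∈ = λ (x , p) (y , q) → x M.+ᴹ y , ≈ᴹ-trans (+ᴹ-homo x y) (+ᴹ-cong p q)
    ; *ₗ∈ = λ r (x , p) → r M.*ₗ x , ≈ᴹ-trans (*ₗ-homo r x) (*ₗ-congˡ p)
    }
    where
    module M = LeftModule M
    open LeftModule N
    open Hom f using (+ᴹ-homo; *ₗ-homo; 0ᴹ-homo)

  infixl 7 _/_
  _/_ : (M : Mod R) → Submodule M → Mod R
  M / N = record
    { Carrierᴹ = Carrierᴹ
    ; _≈ᴹ_ = λ x y → Member (x +ᴹ -ᴹ y)
    ; _+ᴹ_ = _+ᴹ_
    ; _*ₗ_ = _*ₗ_
    ; 0ᴹ = 0ᴹ
    ; -ᴹ_ = -ᴹ_
    ; isLeftModule = record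
      { isLeftSemimodule = record
        { +ᴹ-isCommutativeMonoid = record
          { isMonoid = record
            { isSemigroup = record
              { isMagma = record
                { isEquivalence = record
                  { refl = emb ≈ᴹ-refl
                  ; sym = λ {x} {y} p → resp (flip-minus x y) (-ᴹ∈ p)
                  ; trans = λ {x} {y} {z} p q → resp (telescope x y z) (+ᴹ∈ p q)
                  }
                ; ∙-cong = λ {x} {y} {u} {v} p q → resp (interchange x y u v) (+ᴹ∈ p q)
                }
              ; assoc = λ x y z → emb (+ᴹ-assoc x y z)
              }
            ; identity = (λ x → emb (+ᴹ-identityˡ x)) , (λ x → emb (+ᴹ-identityʳ x))
            }
          ; comm = λ x y → emb (+ᴹ-comm x y)
          }
        ; isPreleftSemimodule = record
          { *ₗ-cong = λ {r} {s} {x} {y} r≈s p →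
              resp (≈ᴹ-trans (scale r x y)
                     (+ᴹ-congˡ (-ᴹ‿cong (*ₗ-congʳ r≈s))))
                   (*ₗ∈ r p)
          ; *ₗ-zeroˡ = λ x → emb (*ₗ-zeroˡ x)
          ; *ₗ-distribʳ = λ x r s → emb (*ₗ-distribʳ x r s)
          ; *ₗ-identityˡ = λ x → emb (*ₗ-identityˡ x)
          ; *ₗ-assoc = λ r s x → emb (*ₗ-assoc r s x)
          ; *ₗ-zeroʳ = λ r → emb (*ₗ-zeroʳ r)
          ; *ₗ-distribˡ = λ r x y → emb (*ₗ-distribˡ r x y)
          }
        }
      ; -ᴹ‿cong = λ {x} {y} p → resp (⁻¹-anti x y) (-ᴹ∈ p)
      ; -ᴹ‿inverse = (λ x → emb (-ᴹ‿inverseˡ x)) , (λ x → emb (-ᴹ‿inverseʳ x))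
      }
    }
    where
    open LeftModule M
    open Submodule N
    open import Algebra.Properties.AbelianGroup +ᴹ-abelianGroup
      using (⁻¹-∙-comm; ⁻¹-involutive; inverseˡ-unique)
    open import Algebra.Properties.CommutativeSemigroup
      (CommutativeMonoid.commutativeSemigroup +ᴹ-commutativeMonoid)
      using () renaming (interchange to +-interchange)
    open import Relation.Binary.Reasoning.Setoid ≈ᴹ-setoid

    emb : ∀ {x y} → x ≈ᴹ y → Member (x +ᴹ -ᴹ y)
    emb {x} {y} x≈y = resp (≈ᴹ-sym (≈ᴹ-trans (+ᴹ-congʳ x≈y) (-ᴹ‿inverseʳ y))) 0ᴹ∈

    ⁻¹-anti : ∀ x y → (-ᴹ (x +ᴹ -ᴹ y)) ≈ᴹ (-ᴹ x +ᴹ -ᴹ (-ᴹ y))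
    ⁻¹-anti x y = ≈ᴹ-sym (⁻¹-∙-comm x (-ᴹ y))

    flip-minus : ∀ x y → (-ᴹ (x +ᴹ -ᴹ y)) ≈ᴹ (y +ᴹ -ᴹ x)
    flip-minus x y = begin
      -ᴹ (x +ᴹ -ᴹ y)          ≈⟨ ⁻¹-anti x y ⟩
      -ᴹ x +ᴹ -ᴹ (-ᴹ y)       ≈⟨ +ᴹ-congˡ (⁻¹-involutive y) ⟩
      -ᴹ x +ᴹ y               ≈⟨ +ᴹ-comm (-ᴹ x) y ⟩
      y +ᴹ -ᴹ x               ∎

    telescope : ∀ x y z → ((x +ᴹ -ᴹ y) +ᴹ (y +ᴹ -ᴹ z)) ≈ᴹ (x +ᴹ -ᴹ z)
    telescope x y z = begin
      (x +ᴹ -ᴹ y) +ᴹ (y +ᴹ -ᴹ z)   ≈⟨ +ᴹ-assoc x (-ᴹ y) (y +ᴹ -ᴹ z) ⟩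
      x +ᴹ (-ᴹ y +ᴹ (y +ᴹ -ᴹ z))   ≈⟨ +ᴹ-congˡ (+ᴹ-assoc (-ᴹ y) y (-ᴹ z)) ⟨
      x +ᴹ ((-ᴹ y +ᴹ y) +ᴹ -ᴹ z)   ≈⟨ +ᴹ-congˡ (+ᴹ-congʳ (-ᴹ‿inverseˡ y)) ⟩
      x +ᴹ (0ᴹ +ᴹ -ᴹ z)            ≈⟨ +ᴹ-congˡ (+ᴹ-identityˡ (-ᴹ z)) ⟩
      x +ᴹ -ᴹ z                    ∎

    interchange : ∀ x y u v →
      ((x +ᴹ -ᴹ y) +ᴹ (u +ᴹ -ᴹ v)) ≈ᴹ ((x +ᴹ u) +ᴹ -ᴹ (y +ᴹ v))
    interchange x y u v = begin
      (x +ᴹ -ᴹ y) +ᴹ (u +ᴹ -ᴹ v)   ≈⟨ +-interchange x (-ᴹ y) u (-ᴹ v) ⟩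
      (x +ᴹ u) +ᴹ (-ᴹ y +ᴹ -ᴹ v)   ≈⟨ +ᴹ-congˡ (⁻¹-∙-comm y v) ⟩
      (x +ᴹ u) +ᴹ -ᴹ (y +ᴹ v)      ∎

    scale : ∀ r x y → (r *ₗ (x +ᴹ -ᴹ y)) ≈ᴹ ((r *ₗ x) +ᴹ -ᴹ (r *ₗ y))
    scale r x y = begin
      r *ₗ (x +ᴹ -ᴹ y)               ≈⟨ *ₗ-distribˡ r x (-ᴹ y) ⟩
      (r *ₗ x) +ᴹ (r *ₗ (-ᴹ y))      ≈⟨ +ᴹ-congˡ (inverseˡ-unique _ _ (begin
        (r *ₗ (-ᴹ y)) +ᴹ (r *ₗ y)      ≈⟨ *ₗ-distribˡ r (-ᴹ y) y ⟨
        r *ₗ (-ᴹ y +ᴹ y)               ≈⟨ *ₗ-congˡ (-ᴹ‿inverseˡ y) ⟩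
        r *ₗ 0ᴹ                        ≈⟨ *ₗ-zeroʳ r ⟩
        0ᴹ                             ∎)) ⟩
      (r *ₗ x) +ᴹ -ᴹ (r *ₗ y)        ∎

  FinitelyGenerated : Mod R → Set ℓ
  FinitelyGenerated M =
    ∃[ n ] Σ[ g ∈ Vector Carrierᴹ n ] ∀ x →
      Σ[ c ∈ Vector R.Carrier n ] x ≈ᴹ sum (λ i → c i *ₗ g i)
    where
    open LeftModule M
    open RawMonoidDefs +ᴹ-rawMonoid using (sum)

  IsProjective : Mod R → Set (lsuc ℓ)
  IsProjective P = (B C : Mod R) (g : Hom B C) → IsSurjective g → (f : Hom P C) →
    Σ[ h ∈ Hom P B ] ∀ x → LeftModule._≈ᴹ_ C (⟦ g ⟧ (⟦ h ⟧ x)) (⟦ f ⟧ x)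

  record ProjectiveResolution (M : Mod R) : Set (lsuc ℓ) where
    field
      P          : ℕ → Mod R
      projective : ∀ i → IsProjective (P i)
      d          : ∀ i → Hom (P (suc i)) (P i)
      ε          : Hom (P 0) M
      surjective : IsSurjective ε
      exact₀     : IsExact (d 0) ε
      exact      : ∀ i → IsExact (d (suc i)) (d i)

  pd_≤_ : Mod R → ℕ → Set (lsuc ℓ)
  pd M ≤ n = Σ[ 𝐏 ∈ ProjectiveResolution M ]
    ∀ i → n ℕ.< i → IsZero (ProjectiveResolution.P 𝐏 i)

  -- The free module on a type X: terms in the module operations modulo
  -- the least congruence that makes them a module.

  data Term (X : Set ℓ) : Set ℓ where
    gen  : X → Term X
    zero : Term X
    _⊕_  : Term X → Term X → Term X
    ⊖_   : Term X → Term X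
    _⊙_  : R.Carrier → Term X → Term X

  infix 4 _∼_
  data _∼_ {X : Set ℓ} : Term X → Term X → Set ℓ where
    ∼-refl      : ∀ {a} → a ∼ a
    ∼-sym       : ∀ {a b} → a ∼ b → b ∼ a
    ∼-trans     : ∀ {a b c} → a ∼ b → b ∼ c → a ∼ c
    ⊕-cong      : ∀ {a b c e} → a ∼ b → c ∼ e → (a ⊕ c) ∼ (b ⊕ e)
    ⊖-cong      : ∀ {a b} → a ∼ b → (⊖ a) ∼ (⊖ b)
    ⊙-cong      : ∀ {r s a b} → r R.≈ s → a ∼ b → (r ⊙ a) ∼ (s ⊙ b)
    ⊕-assoc     : ∀ a b c → ((a ⊕ b) ⊕ c) ∼ (a ⊕ (b ⊕ c))
    ⊕-comm      : ∀ a b → (a ⊕ b) ∼ (b ⊕ a)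
    ⊕-identityˡ : ∀ a → (zero ⊕ a) ∼ a
    ⊖-inverseˡ  : ∀ a → ((⊖ a) ⊕ a) ∼ zero
    ⊙-distribʳ  : ∀ a r s → ((r R.+ s) ⊙ a) ∼ ((r ⊙ a) ⊕ (s ⊙ a))
    ⊙-distribˡ  : ∀ r a b → (r ⊙ (a ⊕ b)) ∼ ((r ⊙ a) ⊕ (r ⊙ b))
    ⊙-identityˡ : ∀ a → (R.1# ⊙ a) ∼ a
    ⊙-assoc     : ∀ r s a → ((r R.* s) ⊙ a) ∼ (r ⊙ (s ⊙ a))
    ⊙-zeroˡ     : ∀ a → (R.0# ⊙ a) ∼ zero
    ⊙-zeroʳ     : ∀ r → (r ⊙ zero) ∼ zero

  Free : Set ℓ → Mod R
  Free X = record
    { Carrierᴹ = Term X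
    ; _≈ᴹ_ = _∼_
    ; _+ᴹ_ = _⊕_
    ; _*ₗ_ = _⊙_
    ; 0ᴹ = zero
    ; -ᴹ_ = ⊖_
    ; isLeftModule = record
      { isLeftSemimodule = record
        { +ᴹ-isCommutativeMonoid = record
          { isMonoid = record
            { isSemigroup = record
              { isMagma = record
                { isEquivalence = record
                  { refl = ∼-refl ; sym = ∼-sym ; trans = ∼-trans }
                ; ∙-cong = ⊕-cong
                }
              ; assoc = ⊕-assoc
              }
            ; identity = ⊕-identityˡ , λ a → ∼-trans (⊕-comm a zero) (⊕-identityˡ a)
            }
          ; comm = ⊕-comm
          }
        ; isPreleftSemimodule = record
          { *ₗ-cong = ⊙-cong
          ; *ₗ-zeroˡ = ⊙-zeroˡ
          ; *ₗ-distribʳ = ⊙-distribʳ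
          ; *ₗ-identityˡ = ⊙-identityˡ
          ; *ₗ-assoc = ⊙-assoc
          ; *ₗ-zeroʳ = ⊙-zeroʳ
          ; *ₗ-distribˡ = ⊙-distribˡ
          }
        }
      ; -ᴹ‿cong = ⊖-cong
      ; -ᴹ‿inverse = ⊖-inverseˡ , λ a → ∼-trans (⊕-comm a (⊖ a)) (⊖-inverseˡ a)
      }
    }

  module _ {X : Set ℓ} (M : Mod R) (φ : X → ∣ M ∣ᴹ) where
    open LeftModule M

    eval : Term X → Carrierᴹ
    eval (gen x) = φ x
    eval zero    = 0ᴹ
    eval (a ⊕ b) = eval a +ᴹ eval b
    eval (⊖ a)   = -ᴹ eval a
    eval (r ⊙ a) = r *ₗ eval a

    eval-cong : ∀ {a b} → a ∼ b → eval a ≈ᴹ eval b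
    eval-cong ∼-refl              = ≈ᴹ-refl
    eval-cong (∼-sym p)           = ≈ᴹ-sym (eval-cong p)
    eval-cong (∼-trans p q)       = ≈ᴹ-trans (eval-cong p) (eval-cong q)
    eval-cong (⊕-cong p q)        = +ᴹ-cong (eval-cong p) (eval-cong q)
    eval-cong (⊖-cong p)          = -ᴹ‿cong (eval-cong p)
    eval-cong (⊙-cong r p)        = *ₗ-cong r (eval-cong p)
    eval-cong (⊕-assoc a b c)     = +ᴹ-assoc (eval a) (eval b) (eval c)
    eval-cong (⊕-comm a b)        = +ᴹ-comm (eval a) (eval b)
    eval-cong (⊕-identityˡ a)     = +ᴹ-identityˡ (eval a)
    eval-cong (⊖-inverseˡ a)      = -ᴹ‿inverseˡ (eval a)
    eval-cong (⊙-distribʳ a r s)  = *ₗ-distribʳ (eval a) r s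
    eval-cong (⊙-distribˡ r a b)  = *ₗ-distribˡ r (eval a) (eval b)
    eval-cong (⊙-identityˡ a)     = *ₗ-identityˡ (eval a)
    eval-cong (⊙-assoc r s a)     = *ₗ-assoc r s (eval a)
    eval-cong (⊙-zeroˡ a)         = *ₗ-zeroˡ (eval a)
    eval-cong (⊙-zeroʳ r)         = *ₗ-zeroʳ r

    fromFree : Hom (Free X) M
    fromFree = mkHom (Free X) M eval eval-cong
      (λ _ _ → ≈ᴹ-refl) (λ _ _ → ≈ᴹ-refl)

  Free-projective : (X : Set ℓ) → IsProjective (Free X)
  Free-projective X B C g g-surj f = h , agree
    where
    module B = LeftModule B
    module C = LeftModule C
    module f = Hom f
    module g = Hom g
    h : Hom (Free X) B
    h = fromFree B (λ x → proj₁ (g-surj (⟦ f ⟧ (gen x))))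
    agree : ∀ a → ⟦ g ⟧ (⟦ h ⟧ a) C.≈ᴹ ⟦ f ⟧ a
    agree (gen x) = proj₂ (g-surj (⟦ f ⟧ (gen x))) B.≈ᴹ-refl
    agree zero    = C.≈ᴹ-trans g.0ᴹ-homo (C.≈ᴹ-sym f.0ᴹ-homo)
    agree (a ⊕ b) = C.≈ᴹ-trans (g.+ᴹ-homo _ _)
      (C.≈ᴹ-trans (C.+ᴹ-cong (agree a) (agree b)) (C.≈ᴹ-sym (f.+ᴹ-homo a b)))
    agree (⊖ a)   = C.≈ᴹ-trans (g.-ᴹ-homo _)
      (C.≈ᴹ-trans (C.-ᴹ‿cong (agree a)) (C.≈ᴹ-sym (f.-ᴹ-homo a)))
    agree (r ⊙ a) = C.≈ᴹ-trans (g.*ₗ-homo r _)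
      (C.≈ᴹ-trans (C.*ₗ-congˡ (agree a)) (C.≈ᴹ-sym (f.*ₗ-homo r a)))

  cover : (M : Mod R) → Hom (Free ∣ M ∣ᴹ) M
  cover M = fromFree M (λ x → x)

  cover-surjective : (M : Mod R) → IsSurjective (cover M)
  cover-surjective M x = gen x , eval-cong M (λ y → y)

  syzygy : Mod R → ℕ → Mod R
  syzygy M zero    = M
  syzygy M (suc i) = toModule (kernel (cover (syzygy M i)))

  freeResolution : (M : Mod R) → ProjectiveResolution M
  freeResolution M = record
    { P          = F
    ; projective = λ i → Free-projective ∣ Z i ∣ᴹ
    ; d          = δ
    ; ε          = cover M
    ; surjective = cover-surjective M
    ; exact₀     = exactAt 0
    ; exact      = λ i → proj₁ (exactAt (suc i)) , proj₂ (exactAt (suc i))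
    }
    where
    Z F : ℕ → Mod R
    Z = syzygy M
    F i = Free ∣ Z i ∣ᴹ
    δ : ∀ i → Hom (F (suc i)) (F i)
    δ i = inclusion (kernel (cover (Z i))) ∘ʰ cover (Z (suc i))
    exactAt : ∀ i → IsExact (δ i) (cover (Z i))
    exactAt i = (λ x → proj₂ (⟦ cover (Z (suc i)) ⟧ x))
              , (λ y y∈ → gen (y , y∈) , LeftModule.≈ᴹ-refl (F i))

  -- Hom_R(M, R) with (f · r)(x) = f(x) r.
  Dual : Mod R → Mod (R ᵒᵖ)
  Dual M = record
    { Carrierᴹ = Hom M (regular R)
    ; _≈ᴹ_ = λ f g → ∀ x → ⟦ f ⟧ x R.≈ ⟦ g ⟧ x
    ; _+ᴹ_ = λ f g → mkHom M (regular R) (λ x → ⟦ f ⟧ x R.+ ⟦ g ⟧ x)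
        (λ p → R.+-cong (Hom.⟦⟧-cong f p) (Hom.⟦⟧-cong g p))
        (λ x y → R.trans (R.+-cong (Hom.+ᴹ-homo f x y) (Hom.+ᴹ-homo g x y))
                         (interchange _ _ _ _))
        (λ r x → R.trans (R.+-cong (Hom.*ₗ-homo f r x) (Hom.*ₗ-homo g r x))
                         (R.sym (R.distribˡ r _ _)))
    ; _*ₗ_ = λ r f → mkHom M (regular R) (λ x → ⟦ f ⟧ x R.* r)
        (λ p → R.*-congʳ (Hom.⟦⟧-cong f p))
        (λ x y → R.trans (R.*-congʳ (Hom.+ᴹ-homo f x y)) (R.distribʳ r _ _))
        (λ s x → R.trans (R.*-congʳ (Hom.*ₗ-homo f s x)) (R.*-assoc s _ r))
    ; 0ᴹ = mkHom M (regular R) (λ _ → R.0#) (λ _ → R.refl)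
        (λ _ _ → R.sym (R.+-identityˡ R.0#)) (λ r _ → R.sym (R.zeroʳ r))
    ; -ᴹ_ = λ f → mkHom M (regular R) (λ x → R.- ⟦ f ⟧ x)
        (λ p → R.-‿cong (Hom.⟦⟧-cong f p))
        (λ x y → R.trans (R.-‿cong (Hom.+ᴹ-homo f x y)) (R.sym (-‿+-comm _ _)))
        (λ r x → R.trans (R.-‿cong (Hom.*ₗ-homo f r x)) (-‿distribʳ-* r _))
    ; isLeftModule = record
      { isLeftSemimodule = record
        { +ᴹ-isCommutativeMonoid = record
          { isMonoid = record
            { isSemigroup = record
              { isMagma = record
                { isEquivalence = record
                  { refl = λ _ → R.refl
                  ; sym = λ p x → R.sym (p x)
                  ; trans = λ p q x → R.trans (p x) (q x)
                  }
                ; ∙-cong = λ p q x → R.+-cong (p x) (q x)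
                }
              ; assoc = λ _ _ _ _ → R.+-assoc _ _ _
              }
            ; identity = (λ _ _ → R.+-identityˡ _) , (λ _ _ → R.+-identityʳ _)
            }
          ; comm = λ _ _ _ → R.+-comm _ _
          }
        ; isPreleftSemimodule = record
          { *ₗ-cong = λ r≈s p x → R.*-cong (p x) r≈s
          ; *ₗ-zeroˡ = λ _ _ → R.zeroʳ _
          ; *ₗ-distribʳ = λ _ r s _ → R.distribˡ _ r s
          ; *ₗ-identityˡ = λ _ _ → R.*-identityʳ _
          ; *ₗ-assoc = λ r s _ _ → R.sym (R.*-assoc _ s r)
          ; *ₗ-zeroʳ = λ r _ → R.zeroˡ r
          ; *ₗ-distribˡ = λ r _ _ _ → R.distribʳ r _ _
          }
        }
      ; -ᴹ‿cong = λ p x → R.-‿cong (p x)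
      ; -ᴹ‿inverse = (λ _ _ → R.-‿inverseˡ _) , (λ _ _ → R.-‿inverseʳ _)
      }
    }
    where
    open import Algebra.Properties.Ring R using (-‿+-comm; -‿distribʳ-*)
    open import Algebra.Properties.CommutativeSemigroup
      (CommutativeMonoid.commutativeSemigroup R.+-commutativeMonoid)
      using (interchange)

module _ {ℓ : Level} {R : Ring ℓ ℓ} where

  dualMap : {M N : Mod R} → Hom M N → Hom (Dual N) (Dual M)
  dualMap {M} {N} f = mkHom (Dual N) (Dual M) (λ g → g ∘ʰ f)
    (λ p x → p (⟦ f ⟧ x)) (λ _ _ _ → Ring.refl R) (λ _ _ _ → Ring.refl R)

  module _ {M : Mod R} (𝐏 : ProjectiveResolution M) where
    open ProjectiveResolution 𝐏

    cocycles : ∀ i → Submodule (Dual (P i))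
    cocycles i = kernel (dualMap (d i))

    coboundaries : ∀ i → Submodule (Dual (P i))
    coboundaries zero    = zeroSubmodule (Dual (P zero))
    coboundaries (suc i) = image (dualMap (d i))

    cohomology : ℕ → Mod (R ᵒᵖ)
    cohomology i =
      toModule (cocycles i) / preimage (inclusion (cocycles i)) (coboundaries i)

  -- E i M = Ext^i_R(M, R).
  E : ℕ → Mod R → Mod (R ᵒᵖ)
  E i M = cohomology (freeResolution M) i

  -- sup { i | E i M ≠ 0 } ≤ d; the negative indices contribute nothing.
  pd⋆_≤_ : Mod R → ℤ → Set ℓ
  pd⋆ M ≤ d = ∀ i → d ℤ.< ℤ.+ i → IsZero (E i M)

module _ {ℓ : Level} (R : Ring ℓ ℓ) where
  open Ring R

  -- Every left ideal is finitely generated.  Generators are data, so this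
  -- is the classical notion: unless R is zero it decides every proposition
  -- P in Set ℓ, through the ideal of those x with x ≈ 0# or P.
  LeftNoetherian : Set (lsuc ℓ)
  LeftNoetherian = (I : Submodule (regular R)) → FinitelyGenerated (toModule I)

  record OreSet : Set (lsuc ℓ) where
    infix 4 _∈S
    field
      _∈S           : Carrier → Set ℓ
      resp          : _∈S Respects _≈_
      1∈S           : 1# ∈S
      *∈S           : ∀ {f g} → f ∈S → g ∈S → (f * g) ∈S
      nonZeroDivˡ   : ∀ {f} → f ∈S → ∀ a → f * a ≈ 0# → a ≈ 0#
      nonZeroDivʳ   : ∀ {f} → f ∈S → ∀ a → a * f ≈ 0# → a ≈ 0#
      oreʳ          : ∀ {f} → f ∈S → ∀ a → ∃[ r ] ∃[ s ] (s ∈S) × (f * r ≈ a * s)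
      oreˡ          : ∀ {f} → f ∈S → ∀ a → ∃[ r ] ∃[ s ] (s ∈S) × (r * f ≈ s * a)

module _ {ℓ : Level} {R : Ring ℓ ℓ} (S : OreSet R) where
  open OreSet S using (_∈S)

  Torsion : Mod R → Set ℓ
  Torsion M = ∀ x → ∃[ s ] (s ∈S) × (s *ₗ x) ≈ᴹ 0ᴹ
    where open LeftModule M

  record Is𝒞 (M : Mod R) : Set ℓ where
    field
      finitelyGenerated : FinitelyGenerated M
      torsion           : Torsion M
      pd⋆≤1             : pd⋆ M ≤ 1ℤ

  𝒞 : Set (lsuc ℓ)
  𝒞 = Σ (Mod R) Is𝒞

  -- 𝒫 as a class of objects of 𝒞, using that pd ≤ 1 implies pd⋆ ≤ 1.
  Is𝒫 : 𝒞 → Set (lsuc ℓ)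
  Is𝒫 (M , _) = pd M ≤ 1

  -- Composable maps A → X 0 → ⋯ → X (n - 1) → B.
  Maps : ∀ n → 𝒞 → Vector 𝒞 n → 𝒞 → Set ℓ
  Maps zero    A X B = Hom (proj₁ A) (proj₁ B)
  Maps (suc n) A X B = Hom (proj₁ A) (proj₁ (X zero)) × Maps n (X zero) (X ∘ suc) B

  -- W → A → X 0 → ⋯ → X (n - 1) → B → 0 is exact, and the images of the
  -- maps A → X 0 → ⋯ → X (n - 1) lie in 𝒞.
  ExactFrom : ∀ {n} {W A : 𝒞} {X : Vector 𝒞 n} {B : 𝒞} →
              Hom (proj₁ W) (proj₁ A) → Maps n A X B → Set ℓ
  ExactFrom {zero}  w f        = IsExact w f × IsSurjective f
  ExactFrom {suc n} {A = A} {X} {B} w (f , fs) =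
    IsExact w f × Is𝒞 (toModule (image f)) × ExactFrom {n} {A} {X zero} {X ∘ suc} {B} f fs

  -- 0 → A → X 0 → ⋯ → X (n - 1) → B → 0 is exact in 𝒞.  The images of the
  -- first and the last map are isomorphic to A and B, so only the images
  -- of the remaining maps need to be required to lie in 𝒞.
  IsExactIn𝒞 : ∀ {n} {A : 𝒞} {X : Vector 𝒞 n} {B : 𝒞} → Maps n A X B → Set ℓ
  IsExactIn𝒞 {zero}  f = IsInjective f × IsSurjective f
  IsExactIn𝒞 {suc n} {A} {X} {B} (f , fs) =
    IsInjective f × ExactFrom {n} {A} {X zero} {X ∘ suc} {B} f fs

  ExactSequence : ∀ n → 𝒞 → Vector 𝒞 n → 𝒞 → Set ℓ
  ExactSequence n A X B = Σ[ f ∈ Maps n A X B ] IsExactIn𝒞 {n} {A} {X} {B} f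

  ShortExactSequence : 𝒞 → 𝒞 → 𝒞 → Set ℓ
  ShortExactSequence A M B = ExactSequence 1 A (λ _ → M) B

  -- P i stands for P_{i+1}; for negative n the P_i occur in the sequence
  -- in descending order.
  ShiftSequence : (n : ℤ) (N : 𝒞) (P : Vector 𝒞 ∣ n ∣) (M : 𝒞) → Set ℓ
  ShiftSequence (ℤ.+ n)  N P M = ExactSequence n N P M
  ShiftSequence -[1+ n ] N P M = ExactSequence (suc n) M (P ∘ opposite) N

  record Shift (n : ℤ) (M : 𝒞) : Set (lsuc ℓ) where
    field
      N        : 𝒞
      P        : Vector 𝒞 ∣ n ∣
      P∈𝒫      : ∀ i → Is𝒫 (P i)
      sequence : ShiftSequence n N P M

  module _ {a b : Level} (Ω : CommutativeMonoid a b) where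
    open CommutativeMonoid Ω
    open RawMonoidDefs rawMonoid using () renaming (sum to ∏; _×_ to power)

    Ω× : Set (a ⊔ b)
    Ω× = Σ Carrier (Invertible _≈_ ε _∙_)

    infixr 8 _^ᶻ_
    _^ᶻ_ : Ω× → ℤ → Carrier
    (u , _)       ^ᶻ (ℤ.+ k)  = power k u
    (_ , u⁻¹ , _) ^ᶻ -[1+ k ] = power (suc k) u⁻¹

    record IsQuasiFitting (𝓕 : 𝒞 → Carrier) : Set (lsuc ℓ ⊔ a ⊔ b) where
      field
        unit     : ∀ P → Is𝒫 P → Invertible _≈_ ε _∙_ (𝓕 P)
        quotient : ∀ M′ M P → Is𝒫 P → ShortExactSequence M′ M P → 𝓕 M ≈ 𝓕 P ∙ 𝓕 M′
        sub      : ∀ P M M′ → Is𝒫 P → ShortExactSequence P M M′ → 𝓕 M ≈ 𝓕 P ∙ 𝓕 M′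

    -- The value of 𝓕^⟨n⟩ at M computed from a given sequence.
    shiftValue : {𝓕 : 𝒞 → Carrier} → IsQuasiFitting 𝓕 →
                 ∀ {n M} → Shift n M → Carrier
    shiftValue {𝓕} qf s =
      ∏ (λ i → (𝓕 (P i) , unit (P i) (P∈𝒫 i)) ^ᶻ (-1ℤ ℤ.^ suc (toℕ i))) ∙ 𝓕 N
      where
      open IsQuasiFitting qf
      open Shift s

{-# OPTIONS --safe #-}

-- Shifting by 1 along 0 → N → P → M → 0 is independent of the choice by a
-- pullback argument, and the shift is quasi-Fitting because 𝒫 is closed
-- under extensions and under kernels of surjections; shifting by −1 is the
-- same argument in the opposite exact structure, and the general shift
-- iterates these.  What has to be known about 𝒞 is:
--
-- * Every M in 𝒞 is a quotient of some P in 𝒫, namely of a cokernel of a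
--   diagonal matrix over S.
-- * Every M in 𝒞 embeds into some P in 𝒫 with cokernel in 𝒞.  Let F be a
--   resolution of M by finitely generated free modules.  The cocycles in
--   F₁* are generated by the coordinates of a map z : F₁ → G, and by the Ore
--   condition σz = yd for a diagonal matrix σ over S and some y : F₀ → G.
--   The dual of the complex … → F₂ → F₁ → G ⊕ F₀ → G is exact in degrees
--   ≥ 2 and torsion in degree 1.  As the Ext-groups of right modules vanish
--   in large degrees, dualising back shows that the complex is exact in
--   positive degrees.  Hence M → G/σG, induced by y, is injective, and its
--   cokernel, which the complex resolves, is in 𝒞.
-- * If P → P′ is an injection in 𝒫 whose cokernel C is in 𝒞, then C is in
--   𝒫: since Ext²(C, R) = 0, the second syzygy of C splits off.

module Submission where

open import Defs
open import Level using (Level; _⊔_) renaming (suc to lsuc)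
open import Algebra.Bundles using (Ring; CommutativeMonoid; AbelianGroup)
open import Algebra.Definitions using (Invertible)
import Algebra.Definitions.RawMonoid as RawMonoidDefs
open import Algebra.Module.Bundles using (LeftModule)
import Algebra.Module.Construct.DirectProduct as DirectProduct
import Algebra.Module.Construct.Zero as Zero
import Algebra.Properties.AbelianGroup as AbelianGroupProperties
import Algebra.Properties.CommutativeMonoid.Sum as Sum
import Algebra.Properties.CommutativeSemigroup as CommutativeSemigroupProperties
import Algebra.Properties.Ring as RingProperties
import Algebra.Solver.CommutativeMonoid.Normal as Normal
open import Data.Fin.Base using (Fin; zero; suc; toℕ; opposite; fromℕ; inject₁)
open import Data.Fin.Properties using (opposite-involutive; toℕ-inject₁; toℕ-fromℕ)
open import Data.Integer.Base as ℤ using (ℤ; 1ℤ; -1ℤ; -[1+_])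
import Data.Integer.Properties as ℤ
open import Data.Nat.Base using (ℕ; zero; suc; _+_; z≤n; s≤s)
open import Data.Nat.Properties using (+-suc; +-identityʳ; m≤m+n)
open import Data.Product.Base using (Σ; Σ-syntax; ∃-syntax; _×_; _,_; proj₁; proj₂)
open import Data.Sum.Base using (_⊎_; inj₁; inj₂)
open import Data.Unit.Polymorphic.Base using (tt)
open import Data.Vec.Base using (Vec; []; _∷_; lookup; map)
open import Data.Vec.Functional as Vector using (Vector)
open import Data.Vec.Properties using (lookup-map)
open import Function.Base using (_∘_)
open import Relation.Binary.PropositionalEquality as ≡ using (_≡_)
import Relation.Binary.Reasoning.Setoid as SetoidReasoning

-- `E` is computed from one very large free resolution, so Ext enters the argument only through
-- vanishing statements: `Ext0 n W` speaks of all presentations of `W` at once, and Schanuel's lemma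
-- shows that a single one decides it. The parts of the long exact sequence that are used become
-- extension problems for functionals, and no connecting homomorphism is formed. Localisation is
-- avoided in the same spirit: a fraction appears as a functional on a dense submodule, and the Ore
-- condition clears its denominator.
--
-- The two directions of the shift differ as module theory. `𝒞` is closed under kernels of
-- surjections, but cokernels of injections may have `pd⋆` equal to 2, so every cokernel that occurs
-- needs its own vanishing argument.
--
-- The alternating exponents come from the iteration. The term `P_i` is consumed by the `i`-th shift
-- by one, each of the `i - 1` earlier shifts inverts the value of the invariant on `𝒫`, and the
-- `i`-th shift contributes one more inverse.

-- Abelian groups

infixl 6 _:+_ _:-_
infix 8 :-_

data Expr (n : ℕ) : Set where
  var  : Fin n → Expr n
  :0   : Expr n
  _:+_ : Expr n → Expr n → Expr n
  :-_  : Expr n → Expr n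

_:-_ : ∀ {n} → Expr n → Expr n → Expr n
e :- f = e :+ :- f

x₀ : ∀ {n} → Expr (suc n)
x₀ = var zero
x₁ : ∀ {n} → Expr (suc (suc n))
x₁ = var (suc zero)
x₂ : ∀ {n} → Expr (suc (suc (suc n)))
x₂ = var (suc (suc zero))
x₃ : ∀ {n} → Expr (suc (suc (suc (suc n))))
x₃ = var (suc (suc (suc zero)))

module AbelianGroupSolver {c ℓ : Level} (G : AbelianGroup c ℓ) where
  open AbelianGroup G
  open Normal commutativeMonoid using (Normal; ⟦_⟧⇓; empty; singleton; _•_;
    empty-correct; singleton-correct; comp-correct)
  open AbelianGroupProperties G using (⁻¹-∙-comm; ε⁻¹≈ε; ∙-cancelʳ)
  open CommutativeSemigroupProperties (CommutativeMonoid.commutativeSemigroup commutativeMonoid)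
    using (interchange)
  open SetoidReasoning setoid

  value : ∀ {n} → Expr n → Vec Carrier n → Carrier
  value (var i)  ρ = lookup ρ i
  value :0       ρ = ε
  value (e :+ f) ρ = value e ρ ∙ value f ρ
  value (:- e)   ρ = value e ρ ⁻¹

  -- An expression is treated as a formal difference of two elements of the free commutative monoid.
  -- An identity of differences can be cross-added, after which both sides are normal forms and
  -- `refl` compares them.
  positive negative : ∀ {n} → Expr n → Normal n
  positive (var i)  = singleton i
  positive :0       = empty
  positive (e :+ f) = positive e • positive f
  positive (:- e)   = negative e
  negative (var i)  = empty
  negative :0       = empty
  negative (e :+ f) = negative e • negative f
  negative (:- e)   = positive e

  correct : ∀ {n} (e : Expr n) ρ → value e ρ ∙ ⟦ negative e ⟧⇓ ρ ≈ ⟦ positive e ⟧⇓ ρ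
  correct (var i) ρ = trans (∙-congˡ (empty-correct ρ))
    (trans (identityʳ _) (sym (singleton-correct i ρ)))
  correct :0 ρ = identityˡ _
  correct (e :+ f) ρ = begin
    (value e ρ ∙ value f ρ) ∙ ⟦ negative e • negative f ⟧⇓ ρ
      ≈⟨ ∙-congˡ (comp-correct (negative e) (negative f) ρ) ⟩
    (value e ρ ∙ value f ρ) ∙ (⟦ negative e ⟧⇓ ρ ∙ ⟦ negative f ⟧⇓ ρ)
      ≈⟨ interchange _ _ _ _ ⟩
    (value e ρ ∙ ⟦ negative e ⟧⇓ ρ) ∙ (value f ρ ∙ ⟦ negative f ⟧⇓ ρ)
      ≈⟨ ∙-cong (correct e ρ) (correct f ρ) ⟩
    ⟦ positive e ⟧⇓ ρ ∙ ⟦ positive f ⟧⇓ ρ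
      ≈⟨ comp-correct (positive e) (positive f) ρ ⟨
    ⟦ positive e • positive f ⟧⇓ ρ ∎
  correct (:- e) ρ = begin
    value e ρ ⁻¹ ∙ ⟦ positive e ⟧⇓ ρ                    ≈⟨ ∙-congˡ (correct e ρ) ⟨
    value e ρ ⁻¹ ∙ (value e ρ ∙ ⟦ negative e ⟧⇓ ρ)       ≈⟨ assoc _ _ _ ⟨
    (value e ρ ⁻¹ ∙ value e ρ) ∙ ⟦ negative e ⟧⇓ ρ       ≈⟨ ∙-congʳ (inverseˡ _) ⟩
    ε ∙ ⟦ negative e ⟧⇓ ρ                              ≈⟨ identityˡ _ ⟩
    ⟦ negative e ⟧⇓ ρ                                  ∎

  solve : ∀ {n} (ρ : Vec Carrier n) (e f : Expr n) →
          positive e • negative f ≡ positive f • negative e → value e ρ ≈ value f ρ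
  solve ρ e f eq = ∙-cancelʳ (⟦ negative e ⟧⇓ ρ ∙ ⟦ negative f ⟧⇓ ρ) _ _ (begin
    value e ρ ∙ (⟦ negative e ⟧⇓ ρ ∙ ⟦ negative f ⟧⇓ ρ)   ≈⟨ assoc _ _ _ ⟨
    (value e ρ ∙ ⟦ negative e ⟧⇓ ρ) ∙ ⟦ negative f ⟧⇓ ρ   ≈⟨ ∙-congʳ (correct e ρ) ⟩
    ⟦ positive e ⟧⇓ ρ ∙ ⟦ negative f ⟧⇓ ρ                ≈⟨ comp-correct (positive e) (negative f) ρ ⟨
    ⟦ positive e • negative f ⟧⇓ ρ                       ≡⟨ ≡.cong (λ v → ⟦ v ⟧⇓ ρ) eq ⟩
    ⟦ positive f • negative e ⟧⇓ ρ                       ≈⟨ comp-correct (positive f) (negative e) ρ ⟩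
    ⟦ positive f ⟧⇓ ρ ∙ ⟦ negative e ⟧⇓ ρ                ≈⟨ ∙-congʳ (correct f ρ) ⟨
    (value f ρ ∙ ⟦ negative f ⟧⇓ ρ) ∙ ⟦ negative e ⟧⇓ ρ   ≈⟨ assoc _ _ _ ⟩
    value f ρ ∙ (⟦ negative f ⟧⇓ ρ ∙ ⟦ negative e ⟧⇓ ρ)   ≈⟨ ∙-congˡ (comm _ _) ⟩
    value f ρ ∙ (⟦ negative e ⟧⇓ ρ ∙ ⟦ negative f ⟧⇓ ρ)   ∎)

-- Homomorphisms and short exact sequences

module _ {ℓ : Level} {R : Ring ℓ ℓ} where

  private
    variable
      A B C D M N X Y Z : Mod R

  module At (M : Mod R) where
    open LeftModule M public
    open AbelianGroupSolver +ᴹ-abelianGroup public using (solve) renaming (value to ⟪_⟫)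
    open AbelianGroupProperties +ᴹ-abelianGroup public using () renaming (x∙y⁻¹≈ε⇒x≈y to -≈0⇒≈)
    module ≈-Reasoning = SetoidReasoning ≈ᴹ-setoid

    infixl 6 _-ᴹ_
    _-ᴹ_ : Carrierᴹ → Carrierᴹ → Carrierᴹ
    x -ᴹ y = x +ᴹ -ᴹ y

    ≈⇒-≈0 : ∀ {x y} → x ≈ᴹ y → x -ᴹ y ≈ᴹ 0ᴹ
    ≈⇒-≈0 {y = y} x≈y = ≈ᴹ-trans (+ᴹ-congʳ x≈y) (-ᴹ‿inverseʳ y)

    *ₗ-‿comm : ∀ r x → (r *ₗ (-ᴹ x)) ≈ᴹ (-ᴹ (r *ₗ x))
    *ₗ-‿comm r x = AbelianGroupProperties.inverseˡ-unique +ᴹ-abelianGroup _ _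
      (≈ᴹ-trans (≈ᴹ-sym (*ₗ-distribˡ r (-ᴹ x) x))
        (≈ᴹ-trans (*ₗ-congˡ (-ᴹ‿inverseˡ x)) (*ₗ-zeroʳ r)))

  ∣_∣ : Mod R → Set ℓ
  ∣ M ∣ = LeftModule.Carrierᴹ M

  infix 4 _≋_
  _≋_ : Hom M N → Hom M N → Set ℓ
  _≋_ {N = N} f g = ∀ x → LeftModule._≈ᴹ_ N (⟦ f ⟧ x) (⟦ g ⟧ x)

  module _ (f : Hom M N) where
    private
      module M = At M
      module N = At N

    push : ∀ {n} (e : Expr n) ρ → ⟦ f ⟧ (M.⟪ e ⟫ ρ) N.≈ᴹ N.⟪ e ⟫ (map ⟦ f ⟧ ρ)
    push (var i)  ρ = N.≈ᴹ-reflexive (≡.sym (lookup-map i ⟦ f ⟧ ρ))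
    push :0       ρ = Hom.0ᴹ-homo f
    push (e :+ g) ρ = N.≈ᴹ-trans (Hom.+ᴹ-homo f _ _) (N.+ᴹ-cong (push e ρ) (push g ρ))
    push (:- e)   ρ = N.≈ᴹ-trans (Hom.-ᴹ-homo f _) (N.-ᴹ‿cong (push e ρ))

    injective-from-kernel : (∀ x → ⟦ f ⟧ x N.≈ᴹ N.0ᴹ → x M.≈ᴹ M.0ᴹ) → IsInjective f
    injective-from-kernel ker {x} {y} fx≈fy = M.-≈0⇒≈ x y (ker _
      (N.≈ᴹ-trans (push (x₀ :- x₁) (x ∷ y ∷ [])) (N.≈⇒-≈0 fx≈fy)))

  idʰ : Hom M M
  idʰ {M} = mkHom M M (λ x → x) (λ p → p) (λ _ _ → ≈ᴹ-refl) (λ _ _ → ≈ᴹ-refl)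
    where open LeftModule M

  0ʰ : Hom M N
  0ʰ {M} {N} = mkHom M N (λ _ → 0ᴹ) (λ _ → ≈ᴹ-refl)
    (λ _ _ → ≈ᴹ-sym (+ᴹ-identityˡ _)) (λ r _ → ≈ᴹ-sym (*ₗ-zeroʳ r))
    where open LeftModule N

  infixl 6 _+ʰ_ _-ʰ_
  _+ʰ_ : Hom M N → Hom M N → Hom M N
  _+ʰ_ {M} {N} f g = mkHom M N (λ x → ⟦ f ⟧ x +ᴹ ⟦ g ⟧ x)
    (λ p → +ᴹ-cong (Hom.⟦⟧-cong f p) (Hom.⟦⟧-cong g p))
    (λ x y → ≈ᴹ-trans (+ᴹ-cong (Hom.+ᴹ-homo f x y) (Hom.+ᴹ-homo g x y))
      (solve (⟦ f ⟧ x ∷ ⟦ f ⟧ y ∷ ⟦ g ⟧ x ∷ ⟦ g ⟧ y ∷ [])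
        ((x₀ :+ x₁) :+ (x₂ :+ x₃)) ((x₀ :+ x₂) :+ (x₁ :+ x₃)) ≡.refl))
    (λ r x → ≈ᴹ-trans (+ᴹ-cong (Hom.*ₗ-homo f r x) (Hom.*ₗ-homo g r x))
      (≈ᴹ-sym (*ₗ-distribˡ r _ _)))
    where open At N

  -ʰ_ : Hom M N → Hom M N
  -ʰ_ {M} {N} f = mkHom M N (λ x → -ᴹ ⟦ f ⟧ x)
    (λ p → -ᴹ‿cong (Hom.⟦⟧-cong f p))
    (λ x y → ≈ᴹ-trans (-ᴹ‿cong (Hom.+ᴹ-homo f x y))
      (solve (⟦ f ⟧ x ∷ ⟦ f ⟧ y ∷ []) (:- (x₀ :+ x₁)) (:- x₀ :+ :- x₁) ≡.refl))
    (λ r x → ≈ᴹ-trans (-ᴹ‿cong (Hom.*ₗ-homo f r x)) (≈ᴹ-sym (*ₗ-‿comm r _)))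
    where open At N

  _-ʰ_ : Hom M N → Hom M N → Hom M N
  f -ʰ g = f +ʰ (-ʰ g)

  𝟘 : Mod R
  𝟘 = Zero.leftModule

  infixr 7 _⊗_
  _⊗_ : Mod R → Mod R → Mod R
  _⊗_ = DirectProduct.leftModule

  fstʰ : Hom (M ⊗ N) M
  fstʰ {M} {N} = mkHom (M ⊗ N) M proj₁ proj₁ (λ _ _ → ≈ᴹ-refl) (λ _ _ → ≈ᴹ-refl)
    where open LeftModule M

  sndʰ : Hom (M ⊗ N) N
  sndʰ {M} {N} = mkHom (M ⊗ N) N proj₂ proj₂ (λ _ _ → ≈ᴹ-refl) (λ _ _ → ≈ᴹ-refl)
    where open LeftModule N

  ⟨_,_⟩ʰ : Hom X M → Hom X N → Hom X (M ⊗ N)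
  ⟨_,_⟩ʰ {X} {M} {N} f g = mkHom X (M ⊗ N) (λ x → ⟦ f ⟧ x , ⟦ g ⟧ x)
    (λ p → Hom.⟦⟧-cong f p , Hom.⟦⟧-cong g p)
    (λ x y → Hom.+ᴹ-homo f x y , Hom.+ᴹ-homo g x y)
    (λ r x → Hom.*ₗ-homo f r x , Hom.*ₗ-homo g r x)

  inlʰ : Hom M (M ⊗ N)
  inlʰ = ⟨ idʰ , 0ʰ ⟩ʰ

  inrʰ : Hom N (M ⊗ N)
  inrʰ = ⟨ 0ʰ , idʰ ⟩ʰ

  [_,_]ʰ : Hom M X → Hom N X → Hom (M ⊗ N) X
  [ f , g ]ʰ = f ∘ʰ fstʰ +ʰ g ∘ʰ sndʰ

  -- `Surjective` also asks that everything equal to the chosen preimage be sent to `y`. For a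
  -- homomorphism this is automatic, and the pointwise form is easier to supply.
  OnTo : Hom M N → Set ℓ
  OnTo {M} {N} f = ∀ y → ∃[ x ] LeftModule._≈ᴹ_ N (⟦ f ⟧ x) y

  onTo : (f : Hom M N) → IsSurjective f → OnTo f
  onTo {M} f s y = proj₁ (s y) , proj₂ (s y) (LeftModule.≈ᴹ-refl M)

  surjective : (f : Hom M N) → OnTo f → IsSurjective f
  surjective {N = N} f s y =
    proj₁ (s y) , λ z≈x → LeftModule.≈ᴹ-trans N (Hom.⟦⟧-cong f z≈x) (proj₂ (s y))

  ∘-onTo : (f : Hom M N) (g : Hom N X) → OnTo f → OnTo g → OnTo (g ∘ʰ f)
  ∘-onTo {X = X} f g s t y =
    let n , gn≈y = t y ; m , fm≈n = s n in
    m , LeftModule.≈ᴹ-trans X (Hom.⟦⟧-cong g fm≈n) gn≈y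

  record SES {A B C : Mod R} (i : Hom A B) (p : Hom B C) : Set ℓ where
    field
      injective : IsInjective i
      isExact   : IsExact i p
      onto      : OnTo p

    null : ∀ x → LeftModule._≈ᴹ_ C (⟦ p ⟧ (⟦ i ⟧ x)) (LeftModule.0ᴹ C)
    null = proj₁ isExact

    fill : ∀ y → LeftModule._≈ᴹ_ C (⟦ p ⟧ y) (LeftModule.0ᴹ C) →
           ∃[ x ] LeftModule._≈ᴹ_ B (⟦ i ⟧ x) y
    fill = proj₂ isExact

  injective⇒kernel : (f : Hom M N) → IsInjective f → ∀ {x} →
    LeftModule._≈ᴹ_ N (⟦ f ⟧ x) (LeftModule.0ᴹ N) → LeftModule._≈ᴹ_ M x (LeftModule.0ᴹ M)
  injective⇒kernel {N = N} f inj p = inj (LeftModule.≈ᴹ-trans N p (LeftModule.≈ᴹ-sym N (Hom.0ᴹ-homo f)))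

  -- Preimages under an injection are unique, so choosing them pointwise already gives a
  -- homomorphism.
  liftMono : (i : Hom A B) → IsInjective i → (h : Hom X B) →
             (∀ x → ∃[ a ] LeftModule._≈ᴹ_ B (⟦ i ⟧ a) (⟦ h ⟧ x)) →
             Σ[ g ∈ Hom X A ] i ∘ʰ g ≋ h
  liftMono {A} {B} {X} i inj h ex = mkHom X A (λ x → proj₁ (ex x))
      (λ {x} {y} x≈y → inj (≈ᴹ-trans (proj₂ (ex x))
        (≈ᴹ-trans (Hom.⟦⟧-cong h x≈y) (≈ᴹ-sym (proj₂ (ex y))))))
      (λ x y → inj (begin
        ⟦ i ⟧ (proj₁ (ex _))                        ≈⟨ proj₂ (ex _) ⟩
        ⟦ h ⟧ _                                     ≈⟨ Hom.+ᴹ-homo h x y ⟩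
        ⟦ h ⟧ x +ᴹ ⟦ h ⟧ y                          ≈⟨ +ᴹ-cong (proj₂ (ex x)) (proj₂ (ex y)) ⟨
        ⟦ i ⟧ (proj₁ (ex x)) +ᴹ ⟦ i ⟧ (proj₁ (ex y)) ≈⟨ Hom.+ᴹ-homo i _ _ ⟨
        ⟦ i ⟧ _                                     ∎))
      (λ r x → inj (begin
        ⟦ i ⟧ (proj₁ (ex _))         ≈⟨ proj₂ (ex _) ⟩
        ⟦ h ⟧ _                      ≈⟨ Hom.*ₗ-homo h r x ⟩
        r *ₗ ⟦ h ⟧ x                 ≈⟨ *ₗ-congˡ (proj₂ (ex x)) ⟨
        r *ₗ ⟦ i ⟧ (proj₁ (ex x))    ≈⟨ Hom.*ₗ-homo i r _ ⟨
        ⟦ i ⟧ _                      ∎))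
    , λ x → proj₂ (ex x)
    where
    open At B
    open ≈-Reasoning

  -- `OnTo` provides a set-theoretic section `s`. It need not respect equality or addition, but
  -- `h ∘ s` does, because `h` identifies any two elements with the same image under `e`.
  factorEpi : (e : Hom X Y) → OnTo e → (h : Hom X Z) →
              (∀ x → LeftModule._≈ᴹ_ Y (⟦ e ⟧ x) (LeftModule.0ᴹ Y) →
                     LeftModule._≈ᴹ_ Z (⟦ h ⟧ x) (LeftModule.0ᴹ Z)) →
              Σ[ g ∈ Hom Y Z ] g ∘ʰ e ≋ h
  factorEpi {X} {Y} {Z} e onto h ker = mkHom Y Z g
      (λ {x} {y} x≈y → agree _ _ (Y.≈ᴹ-trans (s-eq x) (Y.≈ᴹ-trans x≈y (Y.≈ᴹ-sym (s-eq y)))))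
      (λ x y → Z.≈ᴹ-trans (agree _ _ (Y.≈ᴹ-trans (s-eq _) (Y.≈ᴹ-sym
        (Y.≈ᴹ-trans (Hom.+ᴹ-homo e _ _) (Y.+ᴹ-cong (s-eq x) (s-eq y)))))) (Hom.+ᴹ-homo h _ _))
      (λ r x → Z.≈ᴹ-trans (agree _ _ (Y.≈ᴹ-trans (s-eq _) (Y.≈ᴹ-sym
        (Y.≈ᴹ-trans (Hom.*ₗ-homo e _ _) (Y.*ₗ-congˡ (s-eq x)))))) (Hom.*ₗ-homo h _ _))
    , λ x → agree _ _ (s-eq (⟦ e ⟧ x))
    where
    module X = At X
    module Y = At Y
    module Z = At Z
    s : Y.Carrierᴹ → X.Carrierᴹ
    s y = proj₁ (onto y)
    s-eq : ∀ y → ⟦ e ⟧ (s y) Y.≈ᴹ y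
    s-eq y = proj₂ (onto y)
    g : Y.Carrierᴹ → Z.Carrierᴹ
    g y = ⟦ h ⟧ (s y)
    agree : ∀ x x′ → ⟦ e ⟧ x Y.≈ᴹ ⟦ e ⟧ x′ → ⟦ h ⟧ x Z.≈ᴹ ⟦ h ⟧ x′
    agree x x′ ex≈ex′ = Z.-≈0⇒≈ _ _ (Z.≈ᴹ-trans
      (Z.≈ᴹ-sym (push h (x₀ :- x₁) (x ∷ x′ ∷ [])))
      (ker _ (Y.≈ᴹ-trans (push e (x₀ :- x₁) (x ∷ x′ ∷ [])) (Y.≈⇒-≈0 ex≈ex′))))

  preimageMap : (f : Hom M N) (K : Submodule N) → Hom (toModule (preimage f K)) (toModule K)
  preimageMap {N = N} f K = proj₁ (liftMono (inclusion K) (λ eq → eq) (f ∘ʰ inclusion (preimage f K))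
    (λ (x , fx∈) → (⟦ f ⟧ x , fx∈) , LeftModule.≈ᴹ-refl N))

  corestrict : (f : Hom M N) → Hom M (toModule (image f))
  corestrict {M} {N} f = mkHom M (toModule (image f)) (λ x → ⟦ f ⟧ x , x , LeftModule.≈ᴹ-refl N)
    (Hom.⟦⟧-cong f) (Hom.+ᴹ-homo f) (Hom.*ₗ-homo f)

  corestrict-onTo : (f : Hom M N) → OnTo (corestrict f)
  corestrict-onTo f (y , x , fx≈y) = x , fx≈y

  kernelSES : (p : Hom B C) → OnTo p → SES (inclusion (kernel p)) p
  kernelSES {B} p onto = record
    { injective = λ eq → eq
    ; isExact   = proj₂ , λ y py≈0 → (y , py≈0) , LeftModule.≈ᴹ-refl B
    ; onto      = onto
    }

  quotientMap : (N : Submodule M) → Hom M (M / N)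
  quotientMap {M} N = mkHom M (M / N) (λ x → x)
    (λ {x} {y} x≈y → resp (≈ᴹ-sym (≈⇒-≈0 x≈y)) 0ᴹ∈)
    (λ _ _ → LeftModule.≈ᴹ-refl (M / N)) (λ _ _ → LeftModule.≈ᴹ-refl (M / N))
    where
    open At M
    open Submodule N

  quotientMap-onTo : (N : Submodule M) → OnTo (quotientMap N)
  quotientMap-onTo {M} N y = y , LeftModule.≈ᴹ-refl (M / N)

  quotient-null : (N : Submodule M) → ∀ {x} → Submodule.Member N x →
                  LeftModule._≈ᴹ_ (M / N) x (LeftModule.0ᴹ M)
  quotient-null {M} N {x} x∈ = Submodule.resp N (solve (x ∷ []) x₀ (x₀ :- :0) ≡.refl) x∈
    where open At M

  quotient-null⁻¹ : (N : Submodule M) → ∀ {x} →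
                  LeftModule._≈ᴹ_ (M / N) x (LeftModule.0ᴹ M) → Submodule.Member N x
  quotient-null⁻¹ {M} N {x} x∈ = Submodule.resp N (solve (x ∷ []) (x₀ :- :0) x₀ ≡.refl) x∈
    where open At M

  cokernelSES : (i : Hom A B) → IsInjective i → SES i (quotientMap (image i))
  cokernelSES {A} {B} i inj = record
    { injective = inj
    ; isExact   = (λ x → quotient-null (image i) (x , LeftModule.≈ᴹ-refl B))
                , (λ y → quotient-null⁻¹ (image i))
    ; onto      = quotientMap-onTo (image i)
    }

  liftKernel : {i : Hom A B} {p : Hom B C} → SES i p → (h : Hom X B) → p ∘ʰ h ≋ 0ʰ →
               Σ[ g ∈ Hom X A ] i ∘ʰ g ≋ h
  liftKernel {i = i} s h ph≈0 = liftMono i injective h (λ x → fill _ (ph≈0 x))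
    where open SES s

  factorCokernel : {i : Hom A B} {p : Hom B C} → SES i p → (h : Hom B X) → h ∘ʰ i ≋ 0ʰ →
                   Σ[ g ∈ Hom C X ] g ∘ʰ p ≋ h
  factorCokernel {B = B} {X = X} {i = i} {p} s h hi≈0 = factorEpi p onto h λ x px≈0 →
      let a , ia≈x = fill x px≈0 in
      LeftModule.≈ᴹ-trans X (Hom.⟦⟧-cong h (LeftModule.≈ᴹ-sym B ia≈x)) (hi≈0 a)
    where
    open SES s

  -- The third isomorphism theorem for two successive surjections: the kernel of `p ∘ʰ q` is the
  -- preimage of `A` under `q`, hence an extension of `A` by `D`.
  module CompositeKernel {i : Hom A B} {p : Hom B C} (s : SES i p) {j : Hom D X} {q : Hom X B} (t : SES j q) where
    private
      module s = SES s
      module t = SES t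
      module B = LeftModule B
      module C = LeftModule C

    K : Mod R
    K = toModule (kernel (p ∘ʰ q))

    composite : SES (inclusion (kernel (p ∘ʰ q))) (p ∘ʰ q)
    composite = kernelSES (p ∘ʰ q) (∘-onTo q p t.onto s.onto)

    private
      j̄ = liftKernel composite j (λ x → C.≈ᴹ-trans (Hom.⟦⟧-cong p (t.null x)) (Hom.0ᴹ-homo p))
      q̄ = liftKernel {X = K} s (q ∘ʰ inclusion (kernel (p ∘ʰ q))) proj₂

    D→K : Hom D K
    D→K = proj₁ j̄

    K→A : Hom K A
    K→A = proj₁ q̄

    kernels : SES D→K K→A
    kernels = record
      { injective = t.injective
      ; isExact   = (λ x → injective⇒kernel i s.injective (B.≈ᴹ-trans (proj₂ q̄ (⟦ D→K ⟧ x)) (t.null x)))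
                  , λ (y , y∈) q̄≈0 → t.fill y (B.≈ᴹ-trans (B.≈ᴹ-sym (proj₂ q̄ (y , y∈)))
                      (B.≈ᴹ-trans (Hom.⟦⟧-cong i q̄≈0) (Hom.0ᴹ-homo i)))
      ; onto      = λ x →
          let y , qy≈ix = t.onto (⟦ i ⟧ x)
              y∈ = C.≈ᴹ-trans (Hom.⟦⟧-cong p qy≈ix) (s.null x)
          in (y , y∈) , s.injective (B.≈ᴹ-trans (proj₂ q̄ (y , y∈)) qy≈ix)
      }

-- Projective modules and vanishing of Ext

module _ {ℓ : Level} {R : Ring ℓ ℓ} where

  private
    variable
      A B C K K′ M P P′ Q W W′ X : Mod R

  liftProjective : IsProjective P → (g : Hom B C) → OnTo g → (f : Hom P C) →
                   Σ[ h ∈ Hom P B ] g ∘ʰ h ≋ f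
  liftProjective proj g onto f = proj _ _ g (surjective g onto) f

  retract-projective : IsProjective P → (s : Hom K P) (r : Hom P K) → r ∘ʰ s ≋ idʰ → IsProjective K
  retract-projective proj s r rs≋id B C g g-surj f =
    let h , gh≋fr = proj B C g g-surj (f ∘ʰ r) in
    h ∘ʰ s , λ x → LeftModule.≈ᴹ-trans C (gh≋fr (⟦ s ⟧ x)) (Hom.⟦⟧-cong f (rs≋id x))

  𝟘-projective : IsProjective (𝟘 {R = R})
  𝟘-projective B C g g-surj f = 0ʰ , λ _ →
    LeftModule.≈ᴹ-trans C (Hom.0ᴹ-homo g) (LeftModule.≈ᴹ-sym C (Hom.0ᴹ-homo f))

  ⊗-projective : IsProjective P → IsProjective Q → IsProjective (P ⊗ Q)
  ⊗-projective {P} {Q} p q B C g g-surj f =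
    let h , gh = p B C g g-surj (f ∘ʰ inlʰ)
        k , gk = q B C g g-surj (f ∘ʰ inrʰ) in
    [ h , k ]ʰ , λ (x , y) → begin
      ⟦ g ⟧ (⟦ h ⟧ x +ᴹ′ ⟦ k ⟧ y)                              ≈⟨ Hom.+ᴹ-homo g _ _ ⟩
      ⟦ g ⟧ (⟦ h ⟧ x) +ᴹ ⟦ g ⟧ (⟦ k ⟧ y)                       ≈⟨ +ᴹ-cong (gh x) (gk y) ⟩
      ⟦ f ⟧ (x , LeftModule.0ᴹ Q) +ᴹ ⟦ f ⟧ (LeftModule.0ᴹ P , y) ≈⟨ Hom.+ᴹ-homo f _ _ ⟨
      ⟦ f ⟧ _ ≈⟨ Hom.⟦⟧-cong f (LeftModule.+ᴹ-identityʳ P x , LeftModule.+ᴹ-identityˡ Q y) ⟩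
      ⟦ f ⟧ (x , y)                                            ∎
    where
    open At C
    open ≈-Reasoning
    open LeftModule B using () renaming (_+ᴹ_ to _+ᴹ′_)

  cover-onTo : (M : Mod R) → OnTo (cover M)
  cover-onTo M = onTo (cover M) (cover-surjective M)

  coverSES : (M : Mod R) → SES (inclusion (kernel (cover M))) (cover M)
  coverSES M = kernelSES (cover M) (cover-onTo M)

  -- A retract in the stable module category: `W′` is a direct summand of `W ⊗ F` with `F`
  -- projective. This relation passes to syzygies, and both projectivity and the vanishing of Ext
  -- descend along it, so isomorphisms in Schanuel's lemma can be dispensed with.
  record StableRetract (W′ W : Mod R) : Set (lsuc ℓ) where
    field
      α          : Hom W W′
      β          : Hom W′ W
      {F}        : Mod R
      projective : IsProjective F
      u          : Hom W′ F
      v          : Hom F W′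
      split      : idʰ ≋ α ∘ʰ β +ʰ v ∘ʰ u

  retract⇒stable : (α : Hom W W′) (β : Hom W′ W) → α ∘ʰ β ≋ idʰ → StableRetract W′ W
  retract⇒stable {W′ = W′} α β αβ≋id = record
    { α = α ; β = β ; projective = 𝟘-projective ; u = 0ʰ ; v = 0ʰ
    ; split = λ x → ≈ᴹ-sym (≈ᴹ-trans (+ᴹ-identityʳ _) (αβ≋id x)) }
    where open LeftModule W′

  stableRetract-projective : StableRetract K′ K → IsProjective K → IsProjective K′
  stableRetract-projective {K′} {K} sr proj = retract-projective (⊗-projective proj projective)
    ⟨ β , u ⟩ʰ [ α , v ]ʰ (λ x → LeftModule.≈ᴹ-sym K′ (split x))
    where open StableRetract sr

  -- Schanuel's lemma: kernels of projective covers of stable retracts are stable retracts.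
  module Syzygy
    {i′ : Hom K′ P′} {π′ : Hom P′ W′} (s′ : SES i′ π′) (P′-proj : IsProjective P′)
    {i : Hom K P} {π : Hom P W} (s : SES i π) (P-proj : IsProjective P)
    (sr : StableRetract W′ W)
    where
    open StableRetract sr
    private
      module s′ = SES s′
      module s = SES s
      module W = At W
      module W′ = At W′
      module P′ = At P′
      α̃  = liftProjective P-proj π′ s′.onto (α ∘ʰ π)
      β̃  = liftProjective P′-proj π s.onto (β ∘ʰ π′)
      ṽ  = liftProjective projective π′ s′.onto v

      -- The identity of `P′` and the composite of the chosen lifts both cover the identity of `W′`;
      -- their difference therefore lands in `K′` and supplies the homotopy.
      θ : Hom P′ P′
      θ = idʰ -ʰ (proj₁ α̃ ∘ʰ proj₁ β̃ +ʰ proj₁ ṽ ∘ʰ u ∘ʰ π′)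

      π′θ≋0 : π′ ∘ʰ θ ≋ 0ʰ
      π′θ≋0 x = begin
        ⟦ π′ ⟧ (⟦ θ ⟧ x)
          ≈⟨ push π′ (x₀ :- (x₁ :+ x₂))
              (x ∷ ⟦ proj₁ α̃ ⟧ (⟦ proj₁ β̃ ⟧ x) ∷ ⟦ proj₁ ṽ ⟧ (⟦ u ⟧ (⟦ π′ ⟧ x)) ∷ []) ⟩
        ⟦ π′ ⟧ x +ᴹ -ᴹ (⟦ π′ ⟧ (⟦ proj₁ α̃ ⟧ (⟦ proj₁ β̃ ⟧ x)) +ᴹ ⟦ π′ ⟧ (⟦ proj₁ ṽ ⟧ (⟦ u ⟧ (⟦ π′ ⟧ x))))
          ≈⟨ +ᴹ-cong (split (⟦ π′ ⟧ x)) (-ᴹ‿cong (+ᴹ-cong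
              (≈ᴹ-trans (proj₂ α̃ _) (Hom.⟦⟧-cong α (proj₂ β̃ x))) (proj₂ ṽ _))) ⟩
        (⟦ α ⟧ (⟦ β ⟧ (⟦ π′ ⟧ x)) +ᴹ ⟦ v ⟧ (⟦ u ⟧ (⟦ π′ ⟧ x))) +ᴹ -ᴹ _
          ≈⟨ -ᴹ‿inverseʳ _ ⟩
        0ᴹ ∎
        where
        open W′
        open ≈-Reasoning

      αᴷ = liftKernel s′ (proj₁ α̃ ∘ʰ i)
        (λ x → W′.≈ᴹ-trans (proj₂ α̃ _) (W′.≈ᴹ-trans (Hom.⟦⟧-cong α (s.null x)) (Hom.0ᴹ-homo α)))
      βᴷ = liftKernel s (proj₁ β̃ ∘ʰ i′)
        (λ x → W.≈ᴹ-trans (proj₂ β̃ _) (W.≈ᴹ-trans (Hom.⟦⟧-cong β (s′.null x)) (Hom.0ᴹ-homo β)))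
      θᴷ = liftKernel s′ θ π′θ≋0

    extension : Hom P′ P
    extension = proj₁ β̃

    stableRetract : StableRetract K′ K
    stableRetract = record
      { α = proj₁ αᴷ ; β = proj₁ βᴷ ; projective = P′-proj ; u = i′ ; v = proj₁ θᴷ
      ; split = λ x → s′.injective (P′.≈ᴹ-sym (begin
          ⟦ i′ ⟧ (_ +ᴹ′ _)                   ≈⟨ Hom.+ᴹ-homo i′ _ _ ⟩
          ⟦ i′ ⟧ _ +ᴹ ⟦ i′ ⟧ _
            ≈⟨ +ᴹ-cong (≈ᴹ-trans (proj₂ αᴷ _) (Hom.⟦⟧-cong (proj₁ α̃) (proj₂ βᴷ x))) (proj₂ θᴷ _) ⟩
          ⟦ αβ ⟧ x +ᴹ (⟦ i′ ⟧ x -ᴹ (⟦ αβ ⟧ x +ᴹ ⟦ vu ⟧ (⟦ π′ ⟧ (⟦ i′ ⟧ x))))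
            ≈⟨ +ᴹ-congˡ (+ᴹ-congˡ (-ᴹ‿cong (+ᴹ-congˡ (≈ᴹ-trans
                 (Hom.⟦⟧-cong vu (s′.null x)) (Hom.0ᴹ-homo vu))))) ⟩
          ⟦ αβ ⟧ x +ᴹ (⟦ i′ ⟧ x -ᴹ (⟦ αβ ⟧ x +ᴹ 0ᴹ))
            ≈⟨ solve (⟦ αβ ⟧ x ∷ ⟦ i′ ⟧ x ∷ []) (x₀ :+ (x₁ :- (x₀ :+ :0))) x₁ ≡.refl ⟩
          ⟦ i′ ⟧ x                           ∎))
      }
      where
      open P′
      open ≈-Reasoning
      open LeftModule K′ using () renaming (_+ᴹ_ to _+ᴹ′_)
      αβ : Hom K′ P′
      αβ = proj₁ α̃ ∘ʰ proj₁ β̃ ∘ʰ i′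
      vu : Hom W′ P′
      vu = proj₁ ṽ ∘ʰ u

    β-extension : i ∘ʰ proj₁ βᴷ ≋ extension ∘ʰ i′
    β-extension = proj₂ βᴷ

  Extends : Hom K P → Set ℓ
  Extends {K} {P} i = (f : Hom K (regular R)) → Σ[ g ∈ Hom P (regular R) ] g ∘ʰ i ≋ f

  -- Ext^{n+1}(W, R) = 0.
  Ext0 : ℕ → Mod R → Set (lsuc ℓ)
  Ext0 zero    W = ∀ {K B} {i : Hom K B} {p : Hom B W} → SES i p → Extends i
  Ext0 (suc n) W = ∀ {K P} {i : Hom K P} {π : Hom P W} → IsProjective P → SES i π → Ext0 n K

  module _ {i : Hom K P} {π : Hom P W} (P-proj : IsProjective P) (s : SES i π) where

    -- Any extension of `W` by `C` is a pushout of the given presentation: lifting `π` through `ρ`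
    -- makes `B` a quotient of `P ⊗ C` by a copy of `K`. A functional on `C` glues with an extension
    -- to `P` of its pullback to `K`.
    extends⇒Ext0 : Extends i → Ext0 0 W
    extends⇒Ext0 ext {C} {B} {j} {ρ} t f =
      let g , gi≋fα = ext (f ∘ʰ proj₁ αᴷ)
          h , hr≋ = factorEpi r r-onto [ g , f ]ʰ (vanish g gi≋fα) in
      h , λ c → begin
        ⟦ h ⟧ (⟦ j ⟧ c)
          ≈⟨ Hom.⟦⟧-cong h (B.≈ᴹ-trans (B.+ᴹ-congʳ (Hom.0ᴹ-homo (proj₁ α̃))) (B.+ᴹ-identityˡ _)) ⟨
        ⟦ h ⟧ (⟦ r ⟧ (P.0ᴹ , c))       ≈⟨ hr≋ (P.0ᴹ , c) ⟩
        ⟦ g ⟧ P.0ᴹ +ᴹ ⟦ f ⟧ c          ≈⟨ +ᴹ-congʳ (Hom.0ᴹ-homo g) ⟩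
        0ᴹ +ᴹ ⟦ f ⟧ c                  ≈⟨ +ᴹ-identityˡ _ ⟩
        ⟦ f ⟧ c                        ∎
      where
      module s = SES s
      module t = SES t
      module B = At B
      module P = At P
      module W = At W
      module C = At C
      open At (regular R)
      open ≈-Reasoning
      α̃  = liftProjective P-proj ρ t.onto π
      αᴷ = liftKernel t (proj₁ α̃ ∘ʰ i) (λ x → W.≈ᴹ-trans (proj₂ α̃ _) (s.null x))
      r : Hom (P ⊗ C) B
      r = [ proj₁ α̃ , j ]ʰ
      r-onto : OnTo r
      r-onto b =
        let p , πp≈ρb = s.onto (⟦ ρ ⟧ b)
            c , jc≈ = t.fill (b B.-ᴹ ⟦ proj₁ α̃ ⟧ p) (W.≈ᴹ-trans (push ρ (x₀ :- x₁) (b ∷ ⟦ proj₁ α̃ ⟧ p ∷ []))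
                (W.≈⇒-≈0 (W.≈ᴹ-sym (W.≈ᴹ-trans (proj₂ α̃ p) πp≈ρb)))) in
        (p , c) , B.≈ᴹ-trans (B.+ᴹ-congˡ jc≈)
          (B.solve (⟦ proj₁ α̃ ⟧ p ∷ b ∷ []) (x₀ :+ (x₁ :- x₀)) x₁ ≡.refl)
      ρr : ∀ p c → ⟦ ρ ⟧ (⟦ r ⟧ (p , c)) W.≈ᴹ ⟦ π ⟧ p
      ρr p c = W.≈ᴹ-trans (Hom.+ᴹ-homo ρ _ _)
        (W.≈ᴹ-trans (W.+ᴹ-cong (proj₂ α̃ p) (t.null c)) (W.+ᴹ-identityʳ _))
      vanish : ∀ g → g ∘ʰ i ≋ f ∘ʰ proj₁ αᴷ → ∀ x → ⟦ r ⟧ x B.≈ᴹ B.0ᴹ → ⟦ [ g , f ]ʰ ⟧ x ≈ᴹ 0ᴹ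
      vanish g gi≋fα (p , c) αp+jc≈0 =
        let k , ik≈p = s.fill p (W.≈ᴹ-trans (W.≈ᴹ-sym (ρr p c)) (W.≈ᴹ-trans (Hom.⟦⟧-cong ρ αp+jc≈0) (Hom.0ᴹ-homo ρ)))
            αk+c≈0 : (⟦ proj₁ αᴷ ⟧ k C.+ᴹ c) C.≈ᴹ C.0ᴹ
            αk+c≈0 = injective⇒kernel j t.injective (B.≈ᴹ-trans (Hom.+ᴹ-homo j _ _)
              (B.≈ᴹ-trans (B.+ᴹ-congʳ (B.≈ᴹ-trans (proj₂ αᴷ k) (Hom.⟦⟧-cong (proj₁ α̃) ik≈p))) αp+jc≈0))
        in begin
          ⟦ g ⟧ p +ᴹ ⟦ f ⟧ c                     ≈⟨ +ᴹ-congʳ (Hom.⟦⟧-cong g ik≈p) ⟨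
          ⟦ g ⟧ (⟦ i ⟧ k) +ᴹ ⟦ f ⟧ c             ≈⟨ +ᴹ-congʳ (gi≋fα k) ⟩
          ⟦ f ⟧ (⟦ proj₁ αᴷ ⟧ k) +ᴹ ⟦ f ⟧ c      ≈⟨ Hom.+ᴹ-homo f _ _ ⟨
          ⟦ f ⟧ (⟦ proj₁ αᴷ ⟧ k C.+ᴹ c)          ≈⟨ Hom.⟦⟧-cong f αk+c≈0 ⟩
          ⟦ f ⟧ C.0ᴹ                             ≈⟨ Hom.0ᴹ-homo f ⟩
          0ᴹ                                     ∎

  Ext0-stableRetract : ∀ n → StableRetract W′ W → Ext0 n W → Ext0 n W′
  Ext0-stableRetract {W′} {W} zero sr ext =
    extends⇒Ext0 (Free-projective _) (coverSES W′) λ f →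
      let g , gi≋fα = ext (coverSES W) (f ∘ʰ α) in
      -- The map `u` produced by `Syzygy` is the inclusion into the cover of `W′`, so `f ∘ʰ v` is
      -- already an extension of the summand `f v u`.
      g ∘ʰ extension +ʰ f ∘ʰ v , λ k → ≈ᴹ-sym (begin
        ⟦ f ⟧ k                                         ≈⟨ Hom.⟦⟧-cong f (split k) ⟩
        ⟦ f ⟧ (⟦ α ⟧ (⟦ β ⟧ k) K.+ᴹ ⟦ v ⟧ (⟦ u ⟧ k))     ≈⟨ Hom.+ᴹ-homo f _ _ ⟩
        ⟦ f ⟧ (⟦ α ⟧ (⟦ β ⟧ k)) +ᴹ ⟦ f ⟧ (⟦ v ⟧ (⟦ u ⟧ k))
          ≈⟨ +ᴹ-congʳ (gi≋fα (⟦ β ⟧ k)) ⟨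
        ⟦ g ⟧ (proj₁ (⟦ β ⟧ k)) +ᴹ ⟦ f ⟧ (⟦ v ⟧ (⟦ u ⟧ k))
          ≈⟨ +ᴹ-congʳ (Hom.⟦⟧-cong g (β-extension k)) ⟩
        _ ∎)
    where
    open Syzygy (coverSES W′) (Free-projective _) (coverSES W) (Free-projective _) sr
    open StableRetract stableRetract
    module K = LeftModule (toModule (kernel (cover W′)))
    open At (regular R)
    open ≈-Reasoning
  Ext0-stableRetract {W = W} (suc n) sr ext P′-proj s′ = Ext0-stableRetract n
    (Syzygy.stableRetract s′ P′-proj (coverSES W) (Free-projective _) sr)
    (ext (Free-projective _) (coverSES W))

  Ext0-suc : ∀ n {i : Hom K P} {π : Hom P W} → IsProjective P → SES i π → Ext0 n K → Ext0 (suc n) W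
  Ext0-suc {W = W} n P-proj s ext P′-proj s′ = Ext0-stableRetract n
    (Syzygy.stableRetract s′ P′-proj s P-proj (retract⇒stable idʰ idʰ (λ _ → LeftModule.≈ᴹ-refl W))) ext

  -- The horseshoe lemma. A lift of `c` along `p`, together with `i ∘ʰ a`, covers `B`, and by the
  -- snake lemma the three kernels again form a short exact sequence.
  module Horseshoe
    {i : Hom A B} {p : Hom B C} (s : SES i p)
    {k : Hom K P} {a : Hom P A} (sᴬ : SES k a)
    {l : Hom K′ P′} {c : Hom P′ C} (sᶜ : SES l c) (P′-proj : IsProjective P′)
    where
    private
      module s = SES s
      module sᴬ = SES sᴬ
      module sᶜ = SES sᶜ
      module A = At A
      module B = At B
      module C = At C
      module P = At P
      module P′ = At P′
      c̃ = liftProjective P′-proj p s.onto c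

    b : Hom (P ⊗ P′) B
    b = [ i ∘ʰ a , proj₁ c̃ ]ʰ

    private
      pb : ∀ x y → ⟦ p ⟧ (⟦ b ⟧ (x , y)) C.≈ᴹ ⟦ c ⟧ y
      pb x y = C.≈ᴹ-trans (Hom.+ᴹ-homo p _ _)
        (C.≈ᴹ-trans (C.+ᴹ-cong (s.null _) (proj₂ c̃ y)) (C.+ᴹ-identityˡ _))

      b-inl : ∀ x → ⟦ b ⟧ (x , P′.0ᴹ) B.≈ᴹ ⟦ i ⟧ (⟦ a ⟧ x)
      b-inl x = B.≈ᴹ-trans (B.+ᴹ-congˡ (Hom.0ᴹ-homo (proj₁ c̃))) (B.+ᴹ-identityʳ _)

    b-onTo : OnTo b
    b-onTo y =
      let q , cq≈py = sᶜ.onto (⟦ p ⟧ y)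
          x , ix≈ = s.fill (y B.-ᴹ ⟦ proj₁ c̃ ⟧ q) (C.≈ᴹ-trans (push p (x₀ :- x₁) (y ∷ ⟦ proj₁ c̃ ⟧ q ∷ []))
            (C.≈⇒-≈0 (C.≈ᴹ-sym (C.≈ᴹ-trans (proj₂ c̃ q) cq≈py))))
          r , ar≈x = sᴬ.onto x in
      (r , q) , B.≈ᴹ-trans (B.+ᴹ-congʳ (B.≈ᴹ-trans (Hom.⟦⟧-cong i ar≈x) ix≈))
        (B.solve (y ∷ ⟦ proj₁ c̃ ⟧ q ∷ []) ((x₀ :- x₁) :+ x₁) x₀ ≡.refl)

    L : Mod R
    L = toModule (kernel b)

    L-SES : SES (inclusion (kernel b)) b
    L-SES = kernelSES b b-onTo

    private
      k̄ = liftKernel L-SES (inlʰ ∘ʰ k) (λ x → B.≈ᴹ-trans (b-inl _)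
        (B.≈ᴹ-trans (Hom.⟦⟧-cong i (sᴬ.null x)) (Hom.0ᴹ-homo i)))
      l̄ = liftKernel {X = L} sᶜ (sndʰ ∘ʰ inclusion (kernel b)) (λ ((x , y) , b≈0) →
        C.≈ᴹ-trans (C.≈ᴹ-sym (pb x y)) (C.≈ᴹ-trans (Hom.⟦⟧-cong p b≈0) (Hom.0ᴹ-homo p)))

    K→L : Hom K L
    K→L = proj₁ k̄

    K→L-inl : inclusion (kernel b) ∘ʰ K→L ≋ inlʰ ∘ʰ k
    K→L-inl = proj₂ k̄

    kernels : SES K→L (proj₁ l̄)
    kernels = record
      { injective = λ eq → sᴬ.injective (proj₁ eq)
      ; isExact   = (λ x → injective⇒kernel l sᶜ.injective (proj₂ l̄ (⟦ K→L ⟧ x)))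
                  , λ ((x , y) , b≈0) l̄≈0 →
          let y≈0 = P′.≈ᴹ-trans (P′.≈ᴹ-sym (proj₂ l̄ ((x , y) , b≈0)))
                      (P′.≈ᴹ-trans (Hom.⟦⟧-cong l l̄≈0) (Hom.0ᴹ-homo l))
              z , kz≈x = sᴬ.fill x (injective⇒kernel i s.injective (B.≈ᴹ-trans (B.≈ᴹ-sym (b-inl x))
                (B.≈ᴹ-trans (Hom.⟦⟧-cong b (P.≈ᴹ-refl , P′.≈ᴹ-sym y≈0)) b≈0)))
          in z , (kz≈x , P′.≈ᴹ-sym y≈0)
      ; onto      = λ z →
          let x , ix≈ = s.fill (⟦ proj₁ c̃ ⟧ (⟦ l ⟧ z)) (C.≈ᴹ-trans (proj₂ c̃ _) (sᶜ.null z))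
              r , ar≈-x = sᴬ.onto (A.-ᴹ x)
              bz≈0 = B.≈ᴹ-trans (B.+ᴹ-cong (B.≈ᴹ-trans (Hom.⟦⟧-cong i ar≈-x) (Hom.-ᴹ-homo i x))
                       (B.≈ᴹ-sym ix≈)) (B.-ᴹ‿inverseˡ _)
          in ((r , ⟦ l ⟧ z) , bz≈0) , sᶜ.injective (proj₂ l̄ ((r , ⟦ l ⟧ z) , bz≈0))
      }

  -- In the lowest degree the functional is extended in two steps, first to the preimage of `A` and
  -- then to the whole module. Higher degrees reduce to it through the kernels of the horseshoe.
  Ext0-extension : ∀ n {i : Hom A B} {p : Hom B C} → SES i p → Ext0 n A → Ext0 n C → Ext0 n B
  Ext0-extension zero s extᴬ extᶜ t f =
      let g , gj′≋f = extᴬ kernels f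
          h , hι≋g = extᶜ composite g in
      h , λ x → ≈ᴹ-trans (hι≋g (⟦ D→K ⟧ x)) (gj′≋f x)
    where
    open LeftModule (regular R)
    open CompositeKernel s t
  Ext0-extension {A} {B} {C} (suc n) s extᴬ extᶜ =
    Ext0-suc n (⊗-projective (Free-projective _) (Free-projective _)) L-SES
      (Ext0-extension n kernels (extᴬ (Free-projective _) (coverSES A)) (extᶜ (Free-projective _) (coverSES C)))
    where open Horseshoe s (coverSES A) (coverSES C) (Free-projective _)

  -- In the long exact sequence Ext of `A` lies between Ext of `B` in the same degree and Ext of `C`
  -- one degree higher. In the lowest degree a functional on the syzygy of `A` extends to that of
  -- `B`, because Ext¹ of the syzygy of `C` vanishes, then to the cover of `B`, and is restricted to
  -- the summand covering `A`.
  Ext0-kernel : ∀ n {i : Hom A B} {p : Hom B C} → SES i p → Ext0 n B → Ext0 (suc n) C → Ext0 n A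
  Ext0-kernel {A} {B} {C} zero s extᴮ extᶜ =
    extends⇒Ext0 (Free-projective _) (coverSES A) λ f →
      let g , gK≋f = extᶜ (Free-projective _) (coverSES C) kernels f
          h , hι≋g = extᴮ L-SES g in
      h ∘ʰ inlʰ , λ k → ≈ᴹ-trans (Hom.⟦⟧-cong h (LeftModule.≈ᴹ-sym (Free _ ⊗ Free _) (K→L-inl k)))
        (≈ᴹ-trans (hι≋g _) (gK≋f k))
    where
    open LeftModule (regular R)
    open Horseshoe s (coverSES A) (coverSES C) (Free-projective _)
  Ext0-kernel {A} {B} {C} (suc n) s extᴮ extᶜ =
    Ext0-suc n (Free-projective _) (coverSES A)
      (Ext0-kernel n kernels (extᴮ (⊗-projective (Free-projective _) (Free-projective _)) L-SES)
        (extᶜ (Free-projective _) (coverSES C)))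
    where open Horseshoe s (coverSES A) (coverSES C) (Free-projective _)

-- Comparison of `Ext0` with `E`

module _ {ℓ : Level} {R : Ring ℓ ℓ} where

  private
    variable
      A B C K M N P W : Mod R

  syzygyInclusion : (M : Mod R) (n : ℕ) → Hom (syzygy M (suc n)) (Free ∣ syzygy M n ∣)
  syzygyInclusion M n = inclusion (kernel (cover (syzygy M n)))

  Ext0-syzygy : ∀ n k j → Ext0 (n + j) (syzygy M k) → Ext0 j (syzygy M (n + k))
  Ext0-syzygy zero k j ext = ext
  Ext0-syzygy {M} (suc n) k j ext = ≡.subst (λ m → Ext0 j (syzygy M m)) (+-suc n k)
    (Ext0-syzygy n (suc k) j (ext (Free-projective _) (coverSES (syzygy M k))))

  syzygy-Ext0 : ∀ n k j → Ext0 j (syzygy M (n + k)) → Ext0 (n + j) (syzygy M k)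
  syzygy-Ext0 zero k j ext = ext
  syzygy-Ext0 {M} (suc n) k j ext = Ext0-suc (n + j) (Free-projective _) (coverSES (syzygy M k))
    (syzygy-Ext0 n (suc k) j (≡.subst (λ m → Ext0 j (syzygy M m)) (≡.sym (+-suc n k)) ext))

  module _ (M : Mod R) (n : ℕ) where
    open At (regular R)

    -- A cocycle in degree `suc n` is a functional on the syzygy of that index, composed with the
    -- cover; it is a coboundary exactly when the functional extends to the free module around the
    -- syzygy.
    E-zero⇒extends : IsZero (E (suc n) M) → Extends (syzygyInclusion M n)
    E-zero⇒extends vanish f =
      let g , g≈ = vanish (c , λ a → ≈ᴹ-trans (Hom.⟦⟧-cong f (proj₂ (⟦ cover _ ⟧ a))) (Hom.0ᴹ-homo f)) in
      g , λ k → ≈ᴹ-trans (≈ᴹ-sym (Hom.⟦⟧-cong g (proj₂ (onto-c k))))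
        (≈ᴹ-trans (g≈ (proj₁ (onto-c k)))
          (≈ᴹ-trans (solve (⟦ c ⟧ (proj₁ (onto-c k)) ∷ []) (x₀ :- :0) x₀ ≡.refl)
            (Hom.⟦⟧-cong f (proj₂ (onto-c k)))))
      where
      onto-c = cover-onTo (syzygy M (suc n))
      c : Hom (Free ∣ syzygy M (suc n) ∣) (regular R)
      c = f ∘ʰ cover (syzygy M (suc n))

    extends⇒E-zero : Extends (syzygyInclusion M n) → IsZero (E (suc n) M)
    extends⇒E-zero ext (c , c∈) =
      let f , f∘≋c = factorCokernel (coverSES (syzygy M (suc n))) c λ k →
            let a , a≈k = cover-onTo (syzygy M (suc (suc n))) k in
            ≈ᴹ-trans (≈ᴹ-sym (Hom.⟦⟧-cong c a≈k)) (c∈ a)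
          g , gι≋f = ext f in
      g , λ a → ≈ᴹ-trans (gι≋f (⟦ cover _ ⟧ a)) (≈ᴹ-trans (f∘≋c a)
        (solve (⟦ c ⟧ a ∷ []) x₀ (x₀ :- :0) ≡.refl))

    E-zero⇒Ext0 : IsZero (E (suc n) M) → Ext0 n M
    E-zero⇒Ext0 vanish = ≡.subst (λ m → Ext0 m M) (+-identityʳ n) (syzygy-Ext0 {M = M} n 0 0
      (≡.subst (λ m → Ext0 0 (syzygy M m)) (≡.sym (+-identityʳ n))
        (extends⇒Ext0 (Free-projective _) (coverSES (syzygy M n)) (E-zero⇒extends vanish))))

    Ext0⇒E-zero : Ext0 n M → IsZero (E (suc n) M)
    Ext0⇒E-zero ext = extends⇒E-zero (≡.subst (λ m → Ext0 0 (syzygy M m)) (+-identityʳ n)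
      (Ext0-syzygy {M = M} n 0 0 (≡.subst (λ m → Ext0 m M) (≡.sym (+-identityʳ n)) ext))
      (coverSES (syzygy M n)))

  -- `Ext0 (suc n)` concerns degree `n + 2`, so the family over `n` covers exactly the degrees above
  -- 1.
  pd⋆≤1⇒Ext0 : pd⋆ M ≤ 1ℤ → ∀ n → Ext0 (suc n) M
  pd⋆≤1⇒Ext0 {M} pd n = E-zero⇒Ext0 M (suc n) (pd (suc (suc n)) (ℤ.+<+ (s≤s (s≤s z≤n))))

  Ext0⇒pd⋆≤1 : (∀ n → Ext0 (suc n) M) → pd⋆ M ≤ 1ℤ
  Ext0⇒pd⋆≤1 {M} ext (suc (suc n)) (ℤ.+<+ (s≤s (s≤s z≤n))) = Ext0⇒E-zero M (suc n) (ext n)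

  identitySES : SES (0ʰ {M = 𝟘} {N = M}) idʰ
  identitySES {M} = record
    { injective = λ _ → tt
    ; isExact   = (λ _ → ≈ᴹ-refl) , (λ _ y≈0 → tt , ≈ᴹ-sym y≈0)
    ; onto      = λ y → y , ≈ᴹ-refl
    }
    where open LeftModule M

  Ext0-𝟘 : ∀ n → Ext0 n (𝟘 {R = R})
  Ext0-𝟘 zero {K} {i = i} s f = proj₁ g , λ k → Hom.⟦⟧-cong f (injective (proj₂ r (⟦ i ⟧ k)))
    where
    open SES s
    r = liftKernel s idʰ (λ _ → tt)
    g : Σ[ g ∈ Hom _ (regular R) ] g ≋ f ∘ʰ proj₁ r
    g = f ∘ʰ proj₁ r , λ _ → Ring.refl R
  Ext0-𝟘 (suc n) = Ext0-suc n 𝟘-projective identitySES (Ext0-𝟘 n)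

  Ext0-projective : IsProjective K → ∀ n → Ext0 n K
  Ext0-projective {K} K-proj zero {B = B} {i} {p} s f =
      f ∘ʰ proj₁ r , λ k → Hom.⟦⟧-cong f (injective (begin
        ⟦ i ⟧ (⟦ proj₁ r ⟧ (⟦ i ⟧ k))               ≈⟨ proj₂ r (⟦ i ⟧ k) ⟩
        ⟦ i ⟧ k -ᴹ ⟦ proj₁ σ ⟧ (⟦ p ⟧ (⟦ i ⟧ k))    ≈⟨ +ᴹ-congˡ (-ᴹ‿cong (≈ᴹ-trans
                                                       (Hom.⟦⟧-cong (proj₁ σ) (null k)) (Hom.0ᴹ-homo (proj₁ σ)))) ⟩
        ⟦ i ⟧ k -ᴹ 0ᴹ                               ≈⟨ solve (⟦ i ⟧ k ∷ []) (x₀ :- :0) x₀ ≡.refl ⟩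
        ⟦ i ⟧ k                                     ∎))
    where
    open SES s
    open At B
    open ≈-Reasoning
    σ = liftProjective K-proj p onto idʰ
    module K = At K
    r = liftKernel s (idʰ -ʰ proj₁ σ ∘ʰ p) λ x →
      K.≈ᴹ-trans (push p (x₀ :- x₁) (x ∷ ⟦ proj₁ σ ⟧ (⟦ p ⟧ x) ∷ [])) (K.≈⇒-≈0 (K.≈ᴹ-sym (proj₂ σ _)))
  Ext0-projective K-proj (suc n) = Ext0-suc n K-proj identitySES (Ext0-𝟘 n)

  extension-projective : {i : Hom A B} {p : Hom B C} → SES i p →
                         IsProjective A → IsProjective C → IsProjective B
  extension-projective {A} {B} {C} {i} {p} s A-proj C-proj =
      retract-projective (⊗-projective A-proj C-proj) ⟨ proj₁ r , p ⟩ʰ [ i , proj₁ σ ]ʰ λ x →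
        ≈ᴹ-trans (+ᴹ-congʳ (proj₂ r x)) (solve (x ∷ ⟦ proj₁ σ ⟧ (⟦ p ⟧ x) ∷ []) ((x₀ :- x₁) :+ x₁) x₀ ≡.refl)
    where
    open SES s
    open At B
    module C = At C
    σ = liftProjective C-proj p onto idʰ
    r = liftKernel s (idʰ -ʰ proj₁ σ ∘ʰ p) λ x →
      C.≈ᴹ-trans (push p (x₀ :- x₁) (x ∷ ⟦ proj₁ σ ⟧ (⟦ p ⟧ x) ∷ [])) (C.≈⇒-≈0 (C.≈ᴹ-sym (proj₂ σ _)))

  -- Projective dimension at most one

  record ShortResolution (W : Mod R) : Set (lsuc ℓ) where
    constructor shortResolution
    field
      {P₁ P₀}     : Mod R
      {d}         : Hom P₁ P₀
      {ε}         : Hom P₀ W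
      projective₁ : IsProjective P₁
      projective₀ : IsProjective P₀
      ses         : SES d ε

  pd≤1⇒short : pd W ≤ 1 → ShortResolution W
  pd≤1⇒short (𝐏 , zero>1) = shortResolution {d = 𝐏.d 0} {𝐏.ε} (𝐏.projective 1) (𝐏.projective 0) (record
    { injective = injective-from-kernel (𝐏.d 0) λ x dx≈0 →
        let y , dy≈x = proj₂ (𝐏.exact 0) x dx≈0 in
        P₁.≈ᴹ-trans (P₁.≈ᴹ-sym dy≈x) (P₁.≈ᴹ-trans
          (Hom.⟦⟧-cong (𝐏.d 1) (zero>1 2 (s≤s (s≤s z≤n)) y)) (Hom.0ᴹ-homo (𝐏.d 1)))
    ; isExact   = 𝐏.exact₀
    ; onto      = onTo 𝐏.ε 𝐏.surjective })
    where
    module 𝐏 = ProjectiveResolution 𝐏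
    module P₁ = LeftModule (𝐏.P 1)

  short⇒pd≤1 : ShortResolution W → pd W ≤ 1
  short⇒pd≤1 {W} (shortResolution {P₁} {P₀} {d} {ε} p₁ p₀ s) = record
      { P = F ; projective = proj ; d = δ ; ε = ε ; surjective = surjective ε onto
      ; exact₀ = isExact ; exact = exact }
    , λ { (suc (suc i)) (s≤s (s≤s z≤n)) _ → tt }
    where
    open SES s
    F : ℕ → Mod R
    F zero          = P₀
    F (suc zero)    = P₁
    F (suc (suc _)) = 𝟘
    proj : ∀ i → IsProjective (F i)
    proj zero          = p₀
    proj (suc zero)    = p₁
    proj (suc (suc _)) = 𝟘-projective
    δ : ∀ i → Hom (F (suc i)) (F i)
    δ zero    = d
    δ (suc i) = 0ʰ
    exact : ∀ i → IsExact (δ (suc i)) (δ i)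
    exact zero          = (λ _ → Hom.0ᴹ-homo d)
                        , λ y dy≈0 → tt , LeftModule.≈ᴹ-sym P₁ (injective⇒kernel d injective dy≈0)
    exact (suc n)       = (λ _ → LeftModule.≈ᴹ-refl (F (suc n))) , λ _ _ → tt , tt

  short⇒kernel-projective : ShortResolution W → {i : Hom K P} {π : Hom P W} →
                            IsProjective P → SES i π → IsProjective K
  short⇒kernel-projective {W} (shortResolution p₁ p₀ s) P-proj t = stableRetract-projective
    (Syzygy.stableRetract t P-proj s p₀ (retract⇒stable idʰ idʰ (λ _ → LeftModule.≈ᴹ-refl W))) p₁

  short⇒Ext0 : ShortResolution W → ∀ n → Ext0 (suc n) W
  short⇒Ext0 (shortResolution p₁ p₀ s) n = Ext0-suc n p₀ s (Ext0-projective p₁ n)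

  projective⇒short : IsProjective P → ShortResolution P
  projective⇒short P-proj = shortResolution 𝟘-projective P-proj identitySES

  short-extension : {i : Hom A B} {p : Hom B C} → SES i p →
                    ShortResolution A → ShortResolution C → ShortResolution B
  short-extension s (shortResolution a₁ a₀ sᴬ) (shortResolution c₁ c₀ sᶜ) =
    shortResolution (extension-projective kernels a₁ c₁) (⊗-projective a₀ c₀) L-SES
    where open Horseshoe s sᴬ sᶜ c₀

  -- The kernel of the composite of a cover of B with B → C covers A.
  short-kernel : {i : Hom A B} {p : Hom B C} → SES i p →
                 ShortResolution B → ShortResolution C → ShortResolution A
  short-kernel s (shortResolution b₁ b₀ t) c =
    shortResolution b₁ (short⇒kernel-projective c b₀ composite) kernels
    where open CompositeKernel s t

-- Finitely generated free modules and their duals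

-- Binary trees instead of ranks make `Fr (s ⊞ t)` a direct sum by definition, so inductions over
-- free modules need no reindexing.
data Shape : Set where
  none one : Shape
  _⊞_      : Shape → Shape → Shape

module _ {ℓ : Level} {R : Ring ℓ ℓ} where

  private
    module R = Ring R
    variable
      A B C K M N P : Mod R

  Fr : Shape → Mod R
  Fr none    = 𝟘
  Fr one     = regular R
  Fr (s ⊞ t) = Fr s ⊗ Fr t

  scalars : ∣ M ∣ → Hom (regular R) M
  scalars {M} x = mkHom (regular R) M (_*ₗ x) *ₗ-congʳ (*ₗ-distribʳ x) (λ r s → *ₗ-assoc r s x)
    where open LeftModule M

  functional-scalars : (f : Hom (regular R) M) → f ≋ scalars (⟦ f ⟧ R.1#)
  functional-scalars {M} f r = ≈ᴹ-trans (Hom.⟦⟧-cong f (R.sym (R.*-identityʳ r))) (Hom.*ₗ-homo f r R.1#)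
    where open LeftModule M

  Fr-projective : ∀ s → IsProjective (Fr s)
  Fr-projective none    = 𝟘-projective
  Fr-projective (s ⊞ t) = ⊗-projective (Fr-projective s) (Fr-projective t)
  Fr-projective one B C g g-surj f =
    let b , gb≈f1 = onTo g g-surj (⟦ f ⟧ R.1#) in
    scalars b , λ r → ≈ᴹ-trans (Hom.*ₗ-homo g r b) (≈ᴹ-trans (*ₗ-congˡ gb≈f1) (≈ᴹ-sym (functional-scalars f r)))
    where open LeftModule C

  extends-Fr : (i : Hom K P) → Extends i → ∀ s (f : Hom K (Fr s)) → Σ[ g ∈ Hom P (Fr s) ] g ∘ʰ i ≋ f
  extends-Fr i ext none    f = 0ʰ , λ _ → tt
  extends-Fr i ext one     f = ext f
  extends-Fr i ext (s ⊞ t) f =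
    let g , g≋ = extends-Fr i ext s (fstʰ ∘ʰ f)
        h , h≋ = extends-Fr i ext t (sndʰ ∘ʰ f) in
    ⟨ g , h ⟩ʰ , λ x → g≋ x , h≋ x

  record Generated (M : Mod R) : Set ℓ where
    constructor generated
    field
      shape      : Shape
      generators : Hom (Fr shape) M
      generators-onTo : OnTo generators

  Fr-generated : ∀ s → Generated (Fr s)
  Fr-generated s = generated s idʰ (λ x → x , LeftModule.≈ᴹ-refl (Fr s))

  generated-image : (e : Hom M N) → OnTo e → Generated M → Generated N
  generated-image e e-onto (generated s g g-onto) = generated s (e ∘ʰ g) (∘-onTo g e g-onto e-onto)

  generated-extension : {i : Hom A B} {p : Hom B C} → SES i p → Generated A → Generated C → Generated B
  generated-extension s (generated t a a-onto) (generated u c c-onto) = generated (t ⊞ u) b b-onTo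
    where open Horseshoe s (kernelSES a a-onto) (kernelSES c c-onto) (Fr-projective u)

  module _ (M : Mod R) where
    open LeftModule M
    open RawMonoidDefs +ᴹ-rawMonoid using (sum)

    combination : ∀ {n} (g : Vector Carrierᴹ n) →
      Σ[ s ∈ Shape ] Σ[ e ∈ Hom (Fr s) M ] ∀ (c : Vector R.Carrier n) → ∃[ x ] ⟦ e ⟧ x ≈ᴹ sum (λ i → c i *ₗ g i)
    combination {zero}  g = none , 0ʰ , λ _ → tt , ≈ᴹ-refl
    combination {suc n} g =
      let s , e , e-sum = combination (g ∘ suc) in
      one ⊞ s , [ scalars (g zero) , e ]ʰ , λ c →
        let x , ex≈ = e-sum (c ∘ suc) in (c zero , x) , +ᴹ-congˡ ex≈

    finitelyGenerated⇒generated : FinitelyGenerated M → Generated M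
    finitelyGenerated⇒generated (n , g , comb) =
      let s , e , e-sum = combination g in
      generated s e λ x → let c , x≈ = comb x ; y , ey≈ = e-sum c in y , ≈ᴹ-trans ey≈ (≈ᴹ-sym x≈)

  finitelyGenerated-image : (e : Hom M N) → OnTo e → FinitelyGenerated M → FinitelyGenerated N
  finitelyGenerated-image {M} {N} e onto (n , g , comb) = n , ⟦ e ⟧ ∘ g , λ y →
      let x , ex≈y = onto y ; c , x≈ = comb x in
      c , N.≈ᴹ-trans (N.≈ᴹ-sym ex≈y) (N.≈ᴹ-trans (Hom.⟦⟧-cong e x≈) (image-sum c g))
    where
    module M = LeftModule M
    module N = LeftModule N
    open RawMonoidDefs M.+ᴹ-rawMonoid using () renaming (sum to sumᴹ)
    open RawMonoidDefs N.+ᴹ-rawMonoid using () renaming (sum to sumᴺ)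
    image-sum : ∀ {n} (c : Vector R.Carrier n) (g : Vector M.Carrierᴹ n) →
      ⟦ e ⟧ (sumᴹ (λ i → c i M.*ₗ g i)) N.≈ᴹ sumᴺ (λ i → c i N.*ₗ ⟦ e ⟧ (g i))
    image-sum {zero}  c g = Hom.0ᴹ-homo e
    image-sum {suc n} c g = N.≈ᴹ-trans (Hom.+ᴹ-homo e _ _)
      (N.+ᴹ-cong (Hom.*ₗ-homo e _ _) (image-sum (c ∘ suc) (g ∘ suc)))

  finitelyGenerated-regular⊗ : (M : Mod R) → FinitelyGenerated M → FinitelyGenerated (regular R ⊗ M)
  finitelyGenerated-regular⊗ M (n , g , comb) = suc n , g′ , λ (r , x) →
      let c , x≈ = comb x in c′ r c , (
        (R.sym (R.trans (R.+-cong (R.*-identityʳ r) (proj₁ (inr-sum c g))) (R.+-identityʳ r))) ,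
        ≈ᴹ-trans x≈ (≈ᴹ-sym (≈ᴹ-trans (+ᴹ-cong (*ₗ-zeroʳ r) (proj₂ (inr-sum c g))) (+ᴹ-identityˡ _))))
    where
    open LeftModule M
    open RawMonoidDefs +ᴹ-rawMonoid using (sum)
    open RawMonoidDefs (LeftModule.+ᴹ-rawMonoid (regular R ⊗ M)) using () renaming (sum to sum′)
    g′ : Vector (R.Carrier × Carrierᴹ) (suc n)
    g′ zero    = R.1# , 0ᴹ
    g′ (suc i) = R.0# , g i
    c′ : R.Carrier → Vector R.Carrier n → Vector R.Carrier (suc n)
    c′ r c zero    = r
    c′ r c (suc i) = c i
    inr-sum : ∀ {n} (c : Vector R.Carrier n) (g : Vector Carrierᴹ n) →
      LeftModule._≈ᴹ_ (regular R ⊗ M) (sum′ (λ i → c i R.* R.0# , c i *ₗ g i)) (R.0# , sum (λ i → c i *ₗ g i))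
    inr-sum {zero}  c g = R.refl , ≈ᴹ-refl
    inr-sum {suc n} c g =
      let p , q = inr-sum (c ∘ suc) (g ∘ suc) in
      R.trans (R.+-cong (R.zeroʳ _) p) (R.+-identityʳ _) , +ᴹ-congˡ q

  finitelyGenerated-Fr⊗ : ∀ s (M : Mod R) → FinitelyGenerated M → FinitelyGenerated (Fr s ⊗ M)
  finitelyGenerated-Fr⊗ none M fg =
    finitelyGenerated-image {M = M} {N = 𝟘 ⊗ M} inrʰ (λ (_ , x) → x , (tt , LeftModule.≈ᴹ-refl M)) fg
  finitelyGenerated-Fr⊗ one M fg = finitelyGenerated-regular⊗ M fg
  finitelyGenerated-Fr⊗ (s ⊞ t) M fg = finitelyGenerated-image {M = Fr s ⊗ Fr t ⊗ M}
    ⟨ ⟨ fstʰ , fstʰ ∘ʰ sndʰ {M = Fr s} {N = Fr t ⊗ M} ⟩ʰ , sndʰ ∘ʰ sndʰ {M = Fr s} {N = Fr t ⊗ M} ⟩ʰ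
    (λ ((x , y) , z) → (x , y , z) , LeftModule.≈ᴹ-refl ((Fr s ⊗ Fr t) ⊗ M))
    (finitelyGenerated-Fr⊗ s (Fr t ⊗ M) (finitelyGenerated-Fr⊗ t M fg))

  generated⇒finitelyGenerated : Generated M → FinitelyGenerated M
  generated⇒finitelyGenerated {M} (generated s e e-onto) = finitelyGenerated-image {N = M} e e-onto
    (finitelyGenerated-image (fstʰ {M = Fr s} {N = 𝟘}) (λ x → (x , tt) , LeftModule.≈ᴹ-refl (Fr s))
      (finitelyGenerated-Fr⊗ s 𝟘 (0 , (λ ()) , λ _ → (λ ()) , tt)))

  NoetherianModule : Mod R → Set (lsuc ℓ)
  NoetherianModule M = (U : Submodule M) → Generated (toModule U)

  noetherian-mono : NoetherianModule M → (i : Hom K M) → IsInjective i → Generated K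
  noetherian-mono {M} {K} noeth i inj =
    let g , ig≋ = liftMono i inj (inclusion (image i)) proj₂ in
    generated-image g (λ k → (⟦ i ⟧ k , k , LeftModule.≈ᴹ-refl M) ,
      inj (ig≋ (⟦ i ⟧ k , k , LeftModule.≈ᴹ-refl M))) (noeth (image i))

  noetherian-image : (e : Hom M N) → OnTo e → NoetherianModule M → NoetherianModule N
  noetherian-image {N = N} e onto noeth U = generated-image (preimageMap e U)
    (λ (y , y∈U) → let x , ex≈y = onto y in (x , Submodule.resp U (LeftModule.≈ᴹ-sym N ex≈y) y∈U) , ex≈y)
    (noeth (preimage e U))

  -- `U` is an extension of its projection to `N` by its intersection with `M`.
  noetherian-⊗ : NoetherianModule M → NoetherianModule N → NoetherianModule (M ⊗ N)
  noetherian-⊗ {M} {N} noethM noethN U = generated-extension s (noethM U₁) (noethN U₂)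
    where
    module M = LeftModule M
    module N = LeftModule N
    U₁ : Submodule M
    U₁ = preimage inlʰ U
    p : Hom (toModule U) N
    p = sndʰ ∘ʰ inclusion U
    U₂ : Submodule N
    U₂ = image p
    s : SES (preimageMap inlʰ U) (corestrict p)
    s = record
      { injective = proj₁
      ; isExact   = (λ _ → N.≈ᴹ-refl)
                  , λ ((x , y) , xy∈) y≈0 →
                      (x , Submodule.resp U (M.≈ᴹ-refl , y≈0) xy∈) , (M.≈ᴹ-refl , N.≈ᴹ-sym y≈0)
      ; onto      = corestrict-onTo p
      }

  noetherian-Fr : LeftNoetherian R → ∀ s → NoetherianModule (Fr s)
  noetherian-Fr noeth none    U = generated none 0ʰ (λ _ → tt , tt)
  noetherian-Fr noeth one     U = finitelyGenerated⇒generated (toModule U) (noeth U)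
  noetherian-Fr noeth (s ⊞ t) = noetherian-⊗ (noetherian-Fr noeth s) (noetherian-Fr noeth t)

  generated⇒noetherian : LeftNoetherian R → Generated M → NoetherianModule M
  generated⇒noetherian noeth (generated s e e-onto) = noetherian-image e e-onto (noetherian-Fr noeth s)

  Fr-separated : ∀ s (x y : ∣ Fr s ∣) → (∀ (φ : Hom (Fr s) (regular R)) → ⟦ φ ⟧ x R.≈ ⟦ φ ⟧ y) →
                 LeftModule._≈ᴹ_ (Fr s) x y
  Fr-separated none    x y eq = tt
  Fr-separated one     x y eq = eq idʰ
  Fr-separated (s ⊞ t) x y eq =
      Fr-separated s (proj₁ x) (proj₁ y) (λ φ → eq (φ ∘ʰ fstʰ))
    , Fr-separated t (proj₂ x) (proj₂ y) (λ φ → eq (φ ∘ʰ sndʰ))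

module _ {ℓ : Level} {R : Ring ℓ ℓ} where
  private
    module R = Ring R

  ⊗-functional : {M N : Mod R} (φ : Hom (M ⊗ N) (regular R)) → ∀ x y →
    (⟦ φ ∘ʰ inlʰ ⟧ x R.+ ⟦ φ ∘ʰ inrʰ ⟧ y) R.≈ ⟦ φ ⟧ (x , y)
  ⊗-functional {M} {N} φ x y = R.trans (R.sym (Hom.+ᴹ-homo φ _ _))
    (Hom.⟦⟧-cong φ (LeftModule.+ᴹ-identityʳ M x , LeftModule.+ᴹ-identityˡ N y))

  rightMul : Ring.Carrier R → Hom (regular R) (regular R)
  rightMul r = scalars r

  toDual : ∀ s → Hom (Fr {R = R ᵒᵖ} s) (Dual (Fr {R = R} s))
  toDual none    = 0ʰ
  toDual one     = scalars idʰ
  toDual (s ⊞ t) = [ dualMap fstʰ ∘ʰ toDual s , dualMap sndʰ ∘ʰ toDual t ]ʰ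

  fromDual : ∀ s → Hom (Dual (Fr {R = R} s)) (Fr {R = R ᵒᵖ} s)
  fromDual none    = 0ʰ
  fromDual one     = mkHom (Dual (regular R)) (regular (R ᵒᵖ)) (λ φ → ⟦ φ ⟧ R.1#)
                       (λ eq → eq R.1#) (λ _ _ → R.refl) (λ _ _ → R.refl)
  fromDual (s ⊞ t) = ⟨ fromDual s ∘ʰ dualMap inlʰ , fromDual t ∘ʰ dualMap inrʰ ⟩ʰ

  -- This composite makes the dual of a free module a retract of a free module, hence projective,
  -- and shows that `toDual` is onto, hence that the dual is generated.
  toDual-fromDual : ∀ s → toDual s ∘ʰ fromDual s ≋ idʰ
  toDual-fromDual none    φ x = R.sym (Hom.0ᴹ-homo φ)
  toDual-fromDual one     φ x = R.sym (functional-scalars φ x)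
  toDual-fromDual (s ⊞ t) φ (x , y) = R.trans
    (R.+-cong (toDual-fromDual s (φ ∘ʰ inlʰ) x) (toDual-fromDual t (φ ∘ʰ inrʰ) y)) (⊗-functional φ x y)

  Dual-Fr-projective : ∀ s → IsProjective (Dual (Fr {R = R} s))
  Dual-Fr-projective s = retract-projective (Fr-projective s) (fromDual s) (toDual s) (toDual-fromDual s)

  Dual-Fr-generated : ∀ s → Generated (Dual (Fr {R = R} s))
  Dual-Fr-generated s = generated s (toDual s) (λ φ → ⟦ fromDual s ⟧ φ , toDual-fromDual s φ)

  -- Surjectivity of the biduality map; it turns an extended functional on a dual back into an
  -- element.
  Fr-reflexive : ∀ s (ψ : Hom (Dual (Fr {R = R} s)) (regular (R ᵒᵖ))) →
                 Σ[ y ∈ ∣ Fr {R = R} s ∣ ] ∀ φ → ⟦ ψ ⟧ φ R.≈ ⟦ φ ⟧ y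
  Fr-reflexive none ψ = tt , λ φ → R.trans (Hom.⟦⟧-cong ψ {φ} {0ʰ} (λ _ → Hom.0ᴹ-homo φ))
    (R.trans (Hom.0ᴹ-homo ψ) (R.sym (Hom.0ᴹ-homo φ)))
  Fr-reflexive one ψ = ⟦ ψ ⟧ idʰ , λ φ → R.trans
    (Hom.⟦⟧-cong ψ {φ} {LeftModule._*ₗ_ (Dual (regular R)) (⟦ φ ⟧ R.1#) idʰ} (functional-scalars φ))
    (R.trans (Hom.*ₗ-homo ψ (⟦ φ ⟧ R.1#) idʰ) (R.sym (functional-scalars φ (⟦ ψ ⟧ idʰ))))
  Fr-reflexive (s ⊞ t) ψ =
    let x , x≈ = Fr-reflexive s (ψ ∘ʰ dualMap fstʰ)
        y , y≈ = Fr-reflexive t (ψ ∘ʰ dualMap sndʰ) in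
    (x , y) , λ φ → R.trans
      (Hom.⟦⟧-cong ψ {φ} {LeftModule._+ᴹ_ (Dual (Fr s ⊗ Fr t)) ((φ ∘ʰ inlʰ) ∘ʰ fstʰ) ((φ ∘ʰ inrʰ) ∘ʰ sndʰ)} (λ (a , b) → R.sym (⊗-functional φ a b)))
      (R.trans (Hom.+ᴹ-homo ψ ((φ ∘ʰ inlʰ) ∘ʰ fstʰ) ((φ ∘ʰ inrʰ) ∘ʰ sndʰ))
        (R.trans (R.+-cong (x≈ (φ ∘ʰ inlʰ)) (y≈ (φ ∘ʰ inrʰ))) (⊗-functional φ x y)))

-- Complexes of free modules with exact dual

module _ {ℓ : Level} {R : Ring ℓ ℓ} where
  private
    module R = Ring R
    variable
      M : Mod R

  evaluate : ∣ M ∣ → Hom (Dual M) (regular (R ᵒᵖ))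
  evaluate {M} x = mkHom (Dual M) (regular (R ᵒᵖ)) (λ φ → ⟦ φ ⟧ x)
    (λ eq → eq x) (λ _ _ → R.refl) (λ _ _ → R.refl)

  infixl 7 _·_
  _·_ : Hom M (regular R) → R.Carrier → Hom M (regular R)
  φ · r = rightMul r ∘ʰ φ

-- The dual is exact in degrees at least 2. In degree 1 torsion cohomology enters only through its
-- consequence `vanish`: a cocycle kills the cycles of the original complex. Together with `bound`
-- for the right modules in the dual, this yields exactness of the original complex in positive
-- degrees.
module DualExactComplex {ℓ : Level} {R : Ring ℓ ℓ}
  (C : ℕ → Shape) (d : ∀ i → Hom (Fr {R = R} (C (suc i))) (Fr (C i)))
  (dd≋0 : ∀ i → d i ∘ʰ d (suc i) ≋ 0ʰ)
  (dualExact : ∀ i (φ : Hom (Fr (C (suc (suc i)))) (regular R)) → φ ∘ʰ d (suc (suc i)) ≋ 0ʰ →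
               Σ[ ψ ∈ Hom (Fr (C (suc i))) (regular R) ] ψ ∘ʰ d (suc i) ≋ φ)
  (vanish : ∀ (φ : Hom (Fr (C 1)) (regular R)) → φ ∘ʰ d 1 ≋ 0ʰ → ∀ x →
            LeftModule._≈ᴹ_ (Fr (C 0)) (⟦ d 0 ⟧ x) (LeftModule.0ᴹ (Fr {R = R} (C 0))) →
            Ring._≈_ R (⟦ φ ⟧ x) (Ring.0# R))
  (D : ℕ) (bound : ∀ {M : Mod (R ᵒᵖ)} → Generated M → ∀ m → Ext0 (D + m) M)
  where
  private
    module R = Ring R

    F : ℕ → Mod R
    F i = Fr (C i)

    B : ℕ → Mod (R ᵒᵖ)
    B i = toModule (image (dualMap (d (suc i))))

    inc : ∀ i → Hom (B i) (Dual (F (suc (suc i))))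
    inc i = inclusion (image (dualMap (d (suc i))))

    q : ∀ i → Hom (Dual (F (suc i))) (B i)
    q i = corestrict (dualMap (d (suc i)))

    B-SES : ∀ i → SES (inc i) (q (suc i))
    B-SES i = record
      { injective = λ eq → eq
      ; isExact   = (λ (φ , ψ , ψd≋φ) x → R.trans (R.sym (ψd≋φ _))
                      (R.trans (Hom.⟦⟧-cong ψ (dd≋0 (suc i) x)) (Hom.0ᴹ-homo ψ)))
                  , λ φ φd≋0 → let ψ , ψd≋φ = dualExact i φ φd≋0 in (φ , ψ , ψd≋φ) , λ _ → R.refl
      ; onto      = corestrict-onTo (dualMap (d (suc (suc i))))
      }

    -- By `B-SES`, `B i` is a `j`-th syzygy of `B (i + j)`, so vanishing beyond the bound descends
    -- to all positive degrees.
    B-Ext0-from : ∀ j m → (∀ i → Ext0 (j + m) (B i)) → ∀ i → Ext0 m (B i)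
    B-Ext0-from zero    m ext i = ext i
    B-Ext0-from (suc j) m ext i = B-Ext0-from j m
      (λ k → ext (suc k) (Dual-Fr-projective (C (suc (suc k)))) (B-SES k)) i

    B-Ext0 : ∀ i m → Ext0 m (B i)
    B-Ext0 i m = B-Ext0-from D m (λ k → bound (generated-image (q k)
      (corestrict-onTo (dualMap (d (suc k)))) (Dual-Fr-generated (C (suc k)))) m) i

    -- Ensures that evaluation at a cycle descends to the image of the dual differential. Above
    -- degree 1 every cocycle is a coboundary and kills cycles for that reason.
    vanishing : ∀ i (φ : Hom (F (suc i)) (regular R)) → φ ∘ʰ d (suc i) ≋ 0ʰ → ∀ x →
                LeftModule._≈ᴹ_ (F i) (⟦ d i ⟧ x) (LeftModule.0ᴹ (F i)) → ⟦ φ ⟧ x R.≈ R.0#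
    vanishing zero    φ φd≋0 x dx≈0 = vanish φ φd≋0 x dx≈0
    vanishing (suc i) φ φd≋0 x dx≈0 =
      let ψ , ψd≋φ = dualExact i φ φd≋0 in
      R.trans (R.sym (ψd≋φ x)) (R.trans (Hom.⟦⟧-cong ψ dx≈0) (Hom.0ᴹ-homo ψ))

  -- The functional φ ↦ φ x on the image of the dual differential extends by
  -- Ext-vanishing, and by reflexivity the extension is evaluation at a point y.
  exact : ∀ i x → LeftModule._≈ᴹ_ (F i) (⟦ d i ⟧ x) (LeftModule.0ᴹ (F i)) →
          ∃[ y ] LeftModule._≈ᴹ_ (F (suc i)) (⟦ d (suc i) ⟧ y) x
  exact i x dx≈0 =
    let λ′ , λ′q≋ev = factorEpi (q i) (corestrict-onTo (dualMap (d (suc i)))) (evaluate x)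
                        (λ φ φd≋0 → vanishing i φ φd≋0 x dx≈0)
        ψ , ψinc≋λ′ = B-Ext0 (suc i) 0 (B-SES i) λ′
        y , y≈ = Fr-reflexive (C (suc (suc i))) ψ in
    y , Fr-separated (C (suc i)) _ _ λ φ →
      R.trans (R.sym (y≈ (φ ∘ʰ d (suc i)))) (R.trans (ψinc≋λ′ (⟦ q i ⟧ φ)) (λ′q≋ev φ))

  private
    L : ℕ → Mod R
    L i = toModule (image (d i))

    L-SES : ∀ i → SES (inclusion (image (d (suc i)))) (corestrict (d i))
    L-SES i = record
      { injective = λ eq → eq
      ; isExact   = (λ (x , y , dy≈x) → LeftModule.≈ᴹ-trans (F i)
                      (Hom.⟦⟧-cong (d i) (LeftModule.≈ᴹ-sym (F (suc i)) dy≈x)) (dd≋0 i y))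
                  , λ x dx≈0 → let y , dy≈x = exact i x dx≈0 in
                      (x , y , dy≈x) , LeftModule.≈ᴹ-refl (F (suc i))
      ; onto      = corestrict-onTo (d i)
      }

    -- A functional on `L (suc i)` is a cocycle of the dual complex, and exactness there extends it
    -- to `F (suc i)`; higher degrees follow by dimension shifting.
    L-Ext0 : ∀ n i → Ext0 n (L i)
    L-Ext0 zero i = extends⇒Ext0 (Fr-projective (C (suc i))) (L-SES i) λ f →
      let ψ , ψd≋ = dualExact i (f ∘ʰ corestrict (d (suc i))) (λ x → R.trans
                      (Hom.⟦⟧-cong f (dd≋0 (suc i) x)) (Hom.0ᴹ-homo f)) in
      ψ , λ (x , y , dy≈x) → R.trans (Hom.⟦⟧-cong ψ (LeftModule.≈ᴹ-sym (F (suc i)) dy≈x))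
        (R.trans (ψd≋ y) (Hom.⟦⟧-cong f dy≈x))
    L-Ext0 (suc n) i = Ext0-suc n (Fr-projective (C (suc i))) (L-SES i) (L-Ext0 n (suc i))

  cokernel-Ext0 : {N : Mod R} {p : Hom (F 0) N} → OnTo p → IsExact (d 0) p → ∀ n → Ext0 (suc n) N
  cokernel-Ext0 {N} {p} p-onto (pd≈0 , ex) n = Ext0-suc n {inclusion (image (d 0))} {p} (Fr-projective (C 0)) (record
    { injective = λ eq → eq
    ; isExact   = (λ (x , y , dy≈x) → LeftModule.≈ᴹ-trans N (Hom.⟦⟧-cong p (LeftModule.≈ᴹ-sym (F 0) dy≈x)) (pd≈0 y))
                , λ x px≈0 → (x , ex x px≈0) , LeftModule.≈ᴹ-refl (F 0)
    ; onto      = p-onto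
    }) (L-Ext0 n 0)

-- The field `dualExact i` expresses the vanishing of Ext of `M` in degree `i + 2`.
record DualExactResolution {ℓ : Level} {R : Ring ℓ ℓ} (M : Mod R) : Set ℓ where
  field
    shape     : ℕ → Shape
    d         : ∀ i → Hom (Fr {R = R} (shape (suc i))) (Fr (shape i))
    ε         : Hom (Fr {R = R} (shape 0)) M
    ε-onTo    : OnTo ε
    exact₀    : IsExact (d 0) ε
    exact     : ∀ i → IsExact (d (suc i)) (d i)
    dualExact : ∀ i (φ : Hom (Fr (shape (suc (suc i)))) (regular R)) → φ ∘ʰ d (suc (suc i)) ≋ 0ʰ →
                Σ[ ψ ∈ Hom (Fr (shape (suc i))) (regular R) ] ψ ∘ʰ d (suc i) ≋ φ

  factor₀ : {X : Mod R} (φ : Hom (Fr (shape 0)) X) → φ ∘ʰ d 0 ≋ 0ʰ → Σ[ f ∈ Hom M X ] f ∘ʰ ε ≋ φ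
  factor₀ {X} φ φd≋0 = factorEpi ε ε-onTo φ λ x εx≈0 →
    let y , dy≈x = proj₂ exact₀ x εx≈0 in
    LeftModule.≈ᴹ-trans X (Hom.⟦⟧-cong φ (LeftModule.≈ᴹ-sym (Fr (shape 0)) dy≈x)) (φd≋0 y)

  e₁ : Hom (Fr (shape 1)) (toModule (kernel ε))
  e₁ = proj₁ (liftKernel (kernelSES ε ε-onTo) (d 0) (proj₁ exact₀))

  factor₁ : {X : Mod R} (φ : Hom (Fr (shape 1)) X) → φ ∘ʰ d 1 ≋ 0ʰ →
            Σ[ f ∈ Hom (toModule (kernel ε)) X ] f ∘ʰ e₁ ≋ φ
  factor₁ {X} φ φd≋0 = factorEpi e₁ (λ (x , εx≈0) → proj₂ exact₀ x εx≈0) φ λ x e₁x≈0 →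
    let y , dy≈x = proj₂ (exact 0) x e₁x≈0 in
    LeftModule.≈ᴹ-trans X (Hom.⟦⟧-cong φ (LeftModule.≈ᴹ-sym (Fr (shape 1)) dy≈x)) (φd≋0 y)

module _ {ℓ : Level} {R : Ring ℓ ℓ} (noeth : LeftNoetherian R)
  {M : Mod R} (M-gen : Generated M) (ext : ∀ n → Ext0 (suc n) M) where
  open Generated

  private
    stage : ℕ → Σ (Mod R) Generated
    stage zero    = M , M-gen
    stage (suc i) =
      let g = proj₂ (stage i) in
      toModule (kernel (generators g)) , noetherian-Fr noeth (shape g) (kernel (generators g))

    F K : ℕ → Mod R
    F i = Fr (shape (proj₂ (stage i)))
    K i = proj₁ (stage i)

    e : ∀ i → Hom (F i) (K i)
    e i = generators (proj₂ (stage i))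

    K-SES : ∀ i → SES (inclusion (kernel (e i))) (e i)
    K-SES i = kernelSES (e i) (generators-onTo (proj₂ (stage i)))

    δ : ∀ i → Hom (F (suc i)) (F i)
    δ i = inclusion (kernel (e i)) ∘ʰ e (suc i)

    K-Ext0 : ∀ i n → Ext0 n (K (suc i))
    K-Ext0 zero    n = ext n (Fr-projective (shape M-gen)) (K-SES 0)
    K-Ext0 (suc i) n = K-Ext0 i (suc n) (Fr-projective (shape (proj₂ (stage (suc i))))) (K-SES (suc i))

  dualExactResolution : DualExactResolution M
  dualExactResolution = record
    { shape     = λ i → shape (proj₂ (stage i))
    ; d         = δ
    ; ε         = e 0
    ; ε-onTo    = generators-onTo M-gen
    ; exact₀    = (λ x → proj₂ (⟦ e 1 ⟧ x)) , λ x ex≈0 → generators-onTo (proj₂ (stage 1)) (x , ex≈0)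
    ; exact     = λ i → (λ x → proj₂ (⟦ e (suc (suc i)) ⟧ x))
                      , λ x ex≈0 → generators-onTo (proj₂ (stage (suc (suc i)))) (x , ex≈0)
    ; dualExact = λ i φ φd≋0 →
        let f , fe≋φ = factorEpi (e (suc (suc i))) (generators-onTo (proj₂ (stage (suc (suc i))))) φ λ x ex≈0 →
              let y , e≈ = generators-onTo (proj₂ (stage (suc (suc (suc i))))) (x , ex≈0) in
              Ring.trans R (Hom.⟦⟧-cong φ (LeftModule.≈ᴹ-sym (F (suc (suc i))) e≈)) (φd≋0 y)
            ψ , ψι≋f = K-Ext0 i 0 (K-SES (suc i)) f in
        ψ , λ x → Ring.trans R (ψι≋f (⟦ e (suc (suc i)) ⟧ x)) (fe≋φ x)
    }

-- Ore sets and torsion modules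

module _ {ℓ : Level} {R : Ring ℓ ℓ} (S : OreSet R) where
  open OreSet S
  private
    module R = Ring R
    module RP = RingProperties R
    variable
      A B K M N : Mod R

  commonMultiple : ∀ {s t} → s ∈S → t ∈S →
    ∃[ u ] (u ∈S) × (∃[ a ] u R.≈ a R.* s) × (∃[ b ] u R.≈ b R.* t)
  commonMultiple {s} {t} s∈ t∈ =
    let r , s′ , s′∈ , rs≈s′t = oreˡ s∈ t in
    s′ R.* t , *∈S s′∈ t∈ , (r , R.sym rs≈s′t) , (s′ , R.refl)

  cancelˡ : ∀ {s} → s ∈S → ∀ {x y} → s R.* x R.≈ s R.* y → x R.≈ y
  cancelˡ {s} s∈ {x} {y} sx≈sy = RP.x∙y⁻¹≈ε⇒x≈y x y (nonZeroDivˡ s∈ _ (R.trans (R.distribˡ s x (R.- y))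
    (R.trans (R.+-cong sx≈sy (R.sym (RP.-‿distribʳ-* s y))) (R.-‿inverseʳ _))))

  -- `R` has no `S`-torsion, so functionals may be compared after multiplication by an element of
  -- `S` that depends on the point.
  agree-densely : (f g : Hom M (regular R)) →
    (∀ x → ∃[ t ] (t ∈S) × (⟦ f ⟧ (LeftModule._*ₗ_ M t x) R.≈ ⟦ g ⟧ (LeftModule._*ₗ_ M t x))) → f ≋ g
  agree-densely f g agree x =
    let t , t∈ , ftx≈gtx = agree x in
    cancelˡ t∈ (R.trans (R.sym (Hom.*ₗ-homo f t x)) (R.trans ftx≈gtx (Hom.*ₗ-homo g t x)))

  torsion-functional : Torsion S M → (f : Hom M (regular R)) → f ≋ 0ʰ
  torsion-functional tors f = agree-densely f 0ʰ λ x →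
    let t , t∈ , tx≈0 = tors x in t , t∈ , R.trans (Hom.⟦⟧-cong f tx≈0) (Hom.0ᴹ-homo f)

  -- Equivalently, `M / K` is `S`-torsion.
  Dense : Submodule M → Set ℓ
  Dense {M} K = ∀ x → ∃[ t ] (t ∈S) × Submodule.Member K (LeftModule._*ₗ_ M t x)

  dense-preimage : (f : Hom M N) (K : Submodule N) → Dense K → Dense (preimage f K)
  dense-preimage {N = N} f K dense x =
    let t , t∈ , tfx∈ = dense (⟦ f ⟧ x) in
    t , t∈ , Submodule.resp K (LeftModule.≈ᴹ-sym N (Hom.*ₗ-homo f t x)) tfx∈

  torsion⇒dense-kernel : (f : Hom M N) → Torsion S N → Dense (kernel f)
  torsion⇒dense-kernel {N = N} f tors x =
    let t , t∈ , tfx≈0 = tors (⟦ f ⟧ x) in t , t∈ , LeftModule.≈ᴹ-trans N (Hom.*ₗ-homo f t x) tfx≈0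

  dense-multiple : (K : Submodule M) → ∀ {r t u} {x : ∣ M ∣} → u R.≈ r R.* t →
    Submodule.Member K (LeftModule._*ₗ_ M t x) → Submodule.Member K (LeftModule._*ₗ_ M u x)
  dense-multiple {M} K {r} {t} {u} {x} u≈rt tx∈ = Submodule.resp K
    (≈ᴹ-trans (≈ᴹ-sym (*ₗ-assoc r t x)) (*ₗ-congʳ (R.sym u≈rt))) (Submodule.*ₗ∈ K r tx∈)
    where open LeftModule M

  -- t is a common denominator of the extension of z to a map Fr s → S⁻¹R.
  extendDense : ∀ s (K : Submodule (Fr s)) → Dense K → (z : Hom (toModule K) (regular R)) →
    ∃[ t ] (t ∈S) × Σ[ y ∈ Hom (Fr s) (regular R) ] y ∘ʰ inclusion K ≋ z · t
  extendDense none K dense z = R.1# , 1∈S , 0ʰ , λ k →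
    R.sym (R.trans (R.*-congʳ (R.trans (Hom.⟦⟧-cong z tt) (Hom.0ᴹ-homo z))) (R.zeroˡ R.1#))
  extendDense one K dense z =
    let t , t∈ , t1∈K = dense R.1#
        k₀ = (t R.* R.1# , t1∈K)
        -- In the localisation the extension sends 1 to `t⁻¹ z(t)`. The Ore condition rewrites this
        -- as `r s⁻¹`, and `s` is the denominator.
        r , s , s∈ , tr≈zs = oreʳ t∈ (⟦ z ⟧ k₀) in
    s , s∈ , scalars r , agree-densely (scalars r ∘ʰ inclusion K) (z · s) λ (k , k∈K) →
      -- The two maps are known to agree only on multiples of `k₀`; the left Ore condition moves `k`
      -- among them.
      let r′ , u , u∈ , r′t≈uk = oreˡ t∈ k in
      u , u∈ , (begin
        (u R.* k) R.* r           ≈⟨ R.*-congʳ r′t≈uk ⟨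
        (r′ R.* t) R.* r          ≈⟨ R.*-assoc r′ t r ⟩
        r′ R.* (t R.* r)          ≈⟨ R.*-congˡ tr≈zs ⟩
        r′ R.* (⟦ z ⟧ k₀ R.* s)   ≈⟨ R.*-assoc r′ _ s ⟨
        (r′ R.* ⟦ z ⟧ k₀) R.* s   ≈⟨ R.*-congʳ (Hom.*ₗ-homo z r′ k₀) ⟨
        ⟦ z ⟧ (LeftModule._*ₗ_ (toModule K) r′ k₀) R.* s
          ≈⟨ R.*-congʳ (Hom.⟦⟧-cong z (R.trans (R.*-congˡ (R.*-identityʳ t)) r′t≈uk)) ⟩
        ⟦ z ⟧ (LeftModule._*ₗ_ (toModule K) u (k , k∈K)) R.* s ∎)
    where open SetoidReasoning R.setoid
  extendDense (s ⊞ t) K dense z =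
    let s₁ , s₁∈ , y₁ , y₁≋ = extendDense s K₁ dense₁ (z ∘ʰ preimageMap inlʰ K)
        s₂ , s₂∈ , y₂ , y₂≋ = extendDense t K₂ dense₂ (z ∘ʰ preimageMap inrʰ K)
        -- A common right multiple of the two denominators, written as `s₂ s′` because that form
        -- visibly lies in `S`.
        r , s′ , s′∈ , s₁r≈s₂s′ = oreʳ s₁∈ s₂
        y = [ y₁ · r , y₂ · s′ ]ʰ in
    s₂ R.* s′ , *∈S s₂∈ s′∈ , y , agree-densely (y ∘ʰ inclusion K) (z · (s₂ R.* s′))
      λ ((a , b) , k∈K) →
      let t₁ , t₁∈ , t₁a∈ = dense₁ a
          t₂ , t₂∈ , t₂b∈ = dense₂ b
          w , w∈ , (p , w≈pt₁) , (q , w≈qt₂) = commonMultiple t₁∈ t₂∈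
          a′ : ∣ toModule K₁ ∣
          a′ = w A.*ₗ a , dense-multiple K₁ w≈pt₁ t₁a∈
          b′ : ∣ toModule K₂ ∣
          b′ = w B.*ₗ b , dense-multiple K₂ w≈qt₂ t₂b∈
          za = ⟦ z ⟧ (⟦ preimageMap inlʰ K ⟧ a′)
          zb = ⟦ z ⟧ (⟦ preimageMap inrʰ K ⟧ b′)
      in w , w∈ , (begin
        (⟦ y₁ ⟧ (w A.*ₗ a) R.* r) R.+ (⟦ y₂ ⟧ (w B.*ₗ b) R.* s′)
          ≈⟨ R.+-cong (R.*-congʳ (y₁≋ a′)) (R.*-congʳ (y₂≋ b′)) ⟩
        ((za R.* s₁) R.* r) R.+ ((zb R.* s₂) R.* s′)
          ≈⟨ R.+-cong (R.trans (R.*-assoc _ _ _) (R.*-congˡ s₁r≈s₂s′)) (R.*-assoc _ _ _) ⟩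
        (za R.* (s₂ R.* s′)) R.+ (zb R.* (s₂ R.* s′))
          ≈⟨ R.distribʳ _ _ _ ⟨
        (za R.+ zb) R.* (s₂ R.* s′)
          ≈⟨ R.*-congʳ (Hom.+ᴹ-homo z (⟦ preimageMap inlʰ K ⟧ a′) (⟦ preimageMap inrʰ K ⟧ b′)) ⟨
        ⟦ z ⟧ (LeftModule._+ᴹ_ (toModule K) (⟦ preimageMap inlʰ K ⟧ a′) (⟦ preimageMap inrʰ K ⟧ b′)) R.* (s₂ R.* s′)
          ≈⟨ R.*-congʳ (Hom.⟦⟧-cong z (A.+ᴹ-identityʳ _ , B.+ᴹ-identityˡ _)) ⟩
        ⟦ z ⟧ (LeftModule._*ₗ_ (toModule K) w ((a , b) , k∈K)) R.* (s₂ R.* s′) ∎)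
    where
    open SetoidReasoning R.setoid
    module A = LeftModule (Fr {R = R} s)
    module B = LeftModule (Fr {R = R} t)
    K₁ : Submodule (Fr s)
    K₁ = preimage inlʰ K
    K₂ : Submodule (Fr t)
    K₂ = preimage inrʰ K
    dense₁ = dense-preimage inlʰ K dense
    dense₂ = dense-preimage inrʰ K dense

  -- What is used of right multiplication by a diagonal matrix over `S`: it is injective with
  -- torsion cokernel.
  record DenseMono (M : Mod R) : Set ℓ where
    field
      σ         : Hom M M
      injective : IsInjective σ
      dense     : Dense (image σ)

  -- The Ore condition with a diagonal matrix in place of one element of `S`: the functional `z σ⁻¹`
  -- on the dense image of `σ` is extended up to a denominator.
  extendDenseMono : ∀ s (m : DenseMono (Fr s)) (z : Hom (Fr s) (regular R)) →
    ∃[ t ] (t ∈S) × Σ[ y ∈ Hom (Fr s) (regular R) ] y ∘ʰ DenseMono.σ m ≋ z · t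
  extendDenseMono s m z =
    let g , σg≋ = liftMono σ injective (inclusion (image σ)) proj₂
        t , t∈ , y , y≋ = extendDense s (image σ) dense (z ∘ʰ g) in
    t , t∈ , y , λ x → R.trans (y≋ (⟦ corestrict σ ⟧ x))
      (R.*-congʳ (Hom.⟦⟧-cong z (injective (σg≋ (⟦ corestrict σ ⟧ x)))))
    where open DenseMono m

  denseMono-none : DenseMono 𝟘
  denseMono-none = record
    { σ = idʰ ; injective = λ eq → eq ; dense = λ _ → R.1# , 1∈S , tt , tt }

  denseMono-one : ∀ {t} → t ∈S → DenseMono (regular R)
  denseMono-one {t} t∈ = record
    { σ         = rightMul t
    ; injective = injective-from-kernel (rightMul {R = R} t) (nonZeroDivʳ t∈)
    ; dense     = λ x → let r , u , u∈ , rt≈ux = oreˡ t∈ x in u , u∈ , r , rt≈ux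
    }

  denseMono-⊗ : DenseMono M → DenseMono N → DenseMono (M ⊗ N)
  denseMono-⊗ {M} {N} m n = record
    { σ         = ⟨ m.σ ∘ʰ fstʰ , n.σ ∘ʰ sndʰ ⟩ʰ
    ; injective = λ (p , q) → m.injective p , n.injective q
    ; dense     = λ (x , y) →
        let t , t∈ , tx∈ = m.dense x
            u , u∈ , uy∈ = n.dense y
            w , w∈ , (_ , w≈at) , (_ , w≈bu) = commonMultiple t∈ u∈
            x′ , σx′≈ = dense-multiple (image m.σ) w≈at tx∈
            y′ , σy′≈ = dense-multiple (image n.σ) w≈bu uy∈
        in w , w∈ , (x′ , y′) , (σx′≈ , σy′≈)
    }
    where
    module m = DenseMono m
    module n = DenseMono n

  -- Each basis vector is scaled by an element of `S` that kills its image.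
  annihilate : Torsion S M → ∀ s (e : Hom (Fr s) M) →
    Σ[ m ∈ DenseMono (Fr s) ] e ∘ʰ DenseMono.σ m ≋ 0ʰ
  annihilate {M} tors none e = denseMono-none , λ _ → Hom.0ᴹ-homo e
  annihilate {M} tors one e =
    let t , t∈ , te1≈0 = tors (⟦ e ⟧ R.1#) in
    denseMono-one t∈ , λ r → begin
      ⟦ e ⟧ (r R.* t)            ≈⟨ functional-scalars e (r R.* t) ⟩
      (r R.* t) *ₗ ⟦ e ⟧ R.1#    ≈⟨ *ₗ-assoc r t _ ⟩
      r *ₗ (t *ₗ ⟦ e ⟧ R.1#)     ≈⟨ *ₗ-congˡ te1≈0 ⟩
      r *ₗ 0ᴹ                    ≈⟨ *ₗ-zeroʳ r ⟩
      0ᴹ                         ∎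
    where
    open LeftModule M
    open SetoidReasoning ≈ᴹ-setoid
  annihilate {M} tors (s ⊞ t) e =
    let m , em≋0 = annihilate tors s (e ∘ʰ inlʰ)
        n , en≋0 = annihilate tors t (e ∘ʰ inrʰ) in
    denseMono-⊗ m n , λ (x , y) → ≈ᴹ-trans
      (Hom.⟦⟧-cong e (LeftModule.≈ᴹ-sym (Fr s) (LeftModule.+ᴹ-identityʳ (Fr s) _) ,
                      LeftModule.≈ᴹ-sym (Fr t) (LeftModule.+ᴹ-identityˡ (Fr t) _)))
      (≈ᴹ-trans (Hom.+ᴹ-homo e _ _) (≈ᴹ-trans (+ᴹ-cong (em≋0 x) (en≋0 y)) (+ᴹ-identityˡ 0ᴹ)))
    where open LeftModule M

  -- Applied to the cocycles in F₁*: σ is a diagonal matrix of denominators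
  -- expressing that the cocycles are torsion modulo the image of F₀*.
  record Denominators {F₁ F₀ : Mod R} (d : Hom F₁ F₀) {V : Mod (R ᵒᵖ)} (e : Hom V (Dual F₁)) : Set ℓ where
    field
      G         : Shape
      mono      : DenseMono (Fr G)
      z         : Hom F₁ (Fr G)
      y         : Hom F₀ (Fr G)
      σz≋yd     : DenseMono.σ mono ∘ʰ z ≋ y ∘ʰ d
      generates : ∀ v → Σ[ a ∈ Hom (Fr G) (regular R) ] a ∘ʰ z ≋ ⟦ e ⟧ v

  denominators : {F₁ F₀ : Mod R} (d : Hom F₁ F₀) → ∀ s (e : Hom (Fr s) (Dual F₁)) →
    (∀ v → ∃[ t ] (t ∈S) × Σ[ y ∈ Hom F₀ (regular R) ] y ∘ʰ d ≋ ⟦ e ⟧ v · t) → Denominators d e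
  denominators d none e tors = record
    { G = none ; mono = denseMono-none ; z = 0ʰ ; y = 0ʰ ; σz≋yd = λ _ → tt
    ; generates = λ v → 0ʰ , λ x → R.sym (Hom.0ᴹ-homo e x) }
  denominators d one e tors =
    let t , t∈ , y , yd≋zt = tors R.1# in record
    { G = one ; mono = denseMono-one t∈ ; z = ⟦ e ⟧ R.1# ; y = y ; σz≋yd = λ x → R.sym (yd≋zt x)
    ; generates = λ v → rightMul v , λ x → R.sym (functional-scalars e v x) }
  denominators {F₁} {F₀} d (s ⊞ t) e tors = record
    { G = D₁.G ⊞ D₂.G ; mono = denseMono-⊗ D₁.mono D₂.mono
    ; z = ⟨ D₁.z , D₂.z ⟩ʰ ; y = ⟨ D₁.y , D₂.y ⟩ʰ ; σz≋yd = λ x → D₁.σz≋yd x , D₂.σz≋yd x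
    ; generates = λ (v , w) →
        let a , az≋ = D₁.generates v ; b , bz≋ = D₂.generates w in
        [ a , b ]ʰ , λ x → R.trans (R.+-cong (az≋ x) (bz≋ x)) (R.trans (R.sym (Hom.+ᴹ-homo e _ _ x))
          (Hom.⟦⟧-cong e {y = v , w} (LeftModule.+ᴹ-identityʳ (Fr {R = R ᵒᵖ} s) v , LeftModule.+ᴹ-identityˡ (Fr {R = R ᵒᵖ} t) w) x))
    }
    where
    module D₁ = Denominators (denominators d s (e ∘ʰ inlʰ) (λ v → tors _))
    module D₂ = Denominators (denominators d t (e ∘ʰ inrʰ) (λ v → tors _))

-- Covers and embeddings of torsion modules

module _ {ℓ : Level} {R : Ring ℓ ℓ} (S : OreSet R) where
  open OreSet S using (_∈S)
  private
    variable
      A B C M N : Mod R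

  torsion-image : (e : Hom M N) → OnTo e → Torsion S M → Torsion S N
  torsion-image {N = N} e onto tors y =
    let x , ex≈y = onto y ; t , t∈ , tx≈0 = tors x in
    t , t∈ , ≈ᴹ-trans (*ₗ-congˡ (≈ᴹ-sym ex≈y))
      (≈ᴹ-trans (≈ᴹ-sym (Hom.*ₗ-homo e t x)) (≈ᴹ-trans (Hom.⟦⟧-cong e tx≈0) (Hom.0ᴹ-homo e)))
    where open LeftModule N

  torsion-mono : (i : Hom M N) → IsInjective i → Torsion S N → Torsion S M
  torsion-mono {N = N} i inj tors x =
    let t , t∈ , tix≈0 = tors (⟦ i ⟧ x) in
    t , t∈ , injective⇒kernel i inj (≈ᴹ-trans (Hom.*ₗ-homo i t x) tix≈0)
    where open LeftModule N

  torsion-extension : {i : Hom A B} {p : Hom B C} → SES i p → Torsion S A → Torsion S C → Torsion S B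
  torsion-extension {A} {B} {C} {i} {p} s torsA torsC x =
    let t , t∈ , tpx≈0 = torsC (⟦ p ⟧ x)
        a , ia≈tx = SES.fill s (t *ₗ x) (LeftModule.≈ᴹ-trans C (Hom.*ₗ-homo p t x) tpx≈0)
        u , u∈ , ua≈0 = torsA a in
    Ring._*_ R u t , OreSet.*∈S S u∈ t∈ , ≈ᴹ-trans (*ₗ-assoc u t x) (≈ᴹ-trans (*ₗ-congˡ (≈ᴹ-sym ia≈tx))
      (≈ᴹ-trans (≈ᴹ-sym (Hom.*ₗ-homo i u a)) (≈ᴹ-trans (Hom.⟦⟧-cong i ua≈0) (Hom.0ᴹ-homo i))))
    where open LeftModule B

  denseCokernel : (s : Shape) (m : DenseMono S (Fr s)) → Σ[ P₀ ∈ Mod R ] Σ[ q ∈ Hom (Fr s) P₀ ]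
    SES (DenseMono.σ m) q × Torsion S P₀
  denseCokernel s m = Fr s / image σ , quotientMap (image σ) , cokernelSES σ injective ,
    λ x → let t , t∈ , tx∈ = dense x in t , t∈ , quotient-null (image σ) tx∈
    where open DenseMono m

  torsionCover : Generated M → Torsion S M → Σ[ P₀ ∈ Mod R ] Generated P₀ × Torsion S P₀ × ShortResolution P₀ ×
    Σ[ e ∈ Hom P₀ M ] OnTo e
  torsionCover {M} (generated s g g-onTo) M-tors =
    let m , gσ≋0 = annihilate S M-tors s g
        P₀ , q , ses , P₀-tors = denseCokernel s m
        e , eq≋g = factorCokernel ses g gσ≋0 in
    P₀ , generated s q (SES.onto ses) , P₀-tors ,
    shortResolution (Fr-projective s) (Fr-projective s) ses , e ,
    λ y → let x , gx≈y = g-onTo y in ⟦ q ⟧ x , LeftModule.≈ᴹ-trans M (eq≋g x) gx≈y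

  -- The cocycle is a functional on the kernel of `ε`, which is dense in `F₀` because `M` is
  -- torsion; `t` is a denominator of its extension.
  cocycle-torsion : Torsion S M → (resolution : DualExactResolution M) → let open DualExactResolution resolution in
    (z : Hom (Fr (shape 1)) (regular R)) → z ∘ʰ d 1 ≋ 0ʰ →
    ∃[ t ] (t ∈S) × Σ[ y ∈ Hom (Fr (shape 0)) (regular R) ] y ∘ʰ d 0 ≋ z · t
  cocycle-torsion M-tors resolution z zd≋0 =
    let f , fe≋z = factor₁ z zd≋0
        t , t∈ , y , y≋ft = extendDense S (shape 0) (kernel ε) (torsion⇒dense-kernel S ε M-tors) f in
    t , t∈ , y , λ x → R.trans (y≋ft (⟦ e₁ ⟧ x)) (R.*-congʳ (fe≋z x))
    where
    open DualExactResolution resolution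
    module R = Ring R

  -- The complex built here is the mapping cone of the chain map `(z , y)` from the resolution to
  -- the two-term complex `σ`. Its homology in degrees 1 and 0 is the kernel and the cokernel of the
  -- induced map from `M` to `P₀`.
  module Embedding
    (D : ℕ) (bound : ∀ {M : Mod (R ᵒᵖ)} → Generated M → ∀ m → Ext0 (D + m) M)
    {M : Mod R} (M-tors : Torsion S M) (resolution : DualExactResolution M)
    (s : Shape) {cocycle : Hom (Fr s) (toModule (kernel (dualMap (DualExactResolution.d resolution 1))))}
    (cocycle-onTo : OnTo cocycle)
    (den : Denominators S (DualExactResolution.d resolution 0)
             (inclusion (kernel (dualMap (DualExactResolution.d resolution 1))) ∘ʰ cocycle))
    {P₀ : Mod R} {q : Hom (Fr (Denominators.G den)) P₀} (ses : SES (DenseMono.σ (Denominators.mono den)) q)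
    where
    private
      module R = Ring R
      module F = DualExactResolution resolution

      F₀ F₁ : Mod R
      F₀ = Fr (F.shape 0)
      F₁ = Fr (F.shape 1)
      module F₀ = At F₀
      module M = At M

      open Denominators den
      open DenseMono mono
      module P₀ = At P₀
      module G = At (Fr {R = R} G)

      dd≋0 : ∀ i → F.d i ∘ʰ F.d (suc i) ≋ 0ʰ
      dd≋0 i x = proj₁ (F.exact i) x

      κ : ℕ → Shape
      κ zero          = G
      κ (suc zero)    = G ⊞ F.shape 0
      κ (suc (suc i)) = F.shape (suc i)

      δ₀ : Hom (Fr G ⊗ F₀) (Fr G)
      δ₀ = [ σ , -ʰ y ]ʰ

      δ : ∀ i → Hom (Fr {R = R} (κ (suc i))) (Fr (κ i))
      δ zero          = δ₀
      δ (suc zero)    = ⟨ z , F.d 0 ⟩ʰ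
      δ (suc (suc i)) = F.d (suc i)

      δδ≋0 : ∀ i → δ i ∘ʰ δ (suc i) ≋ 0ʰ
      δδ≋0 zero          x = G.≈⇒-≈0 (σz≋yd x)
      δδ≋0 (suc zero)    x =
        injective⇒kernel σ injective (G.≈ᴹ-trans (σz≋yd _) (G.≈ᴹ-trans
          (Hom.⟦⟧-cong y (dd≋0 0 x)) (Hom.0ᴹ-homo y))) ,
        dd≋0 0 x
      δδ≋0 (suc (suc i)) x = dd≋0 (suc i) x

      δ-dualExact : ∀ i (φ : Hom (Fr (κ (suc (suc i)))) (regular R)) → φ ∘ʰ δ (suc (suc i)) ≋ 0ʰ →
                  Σ[ ψ ∈ Hom (Fr (κ (suc i))) (regular R) ] ψ ∘ʰ δ (suc i) ≋ φ
      δ-dualExact zero    φ φd≋0 =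
        -- The coordinates of `z` generate the cocycles, so a functional on `G`, extended by zero to
        -- `F₀`, restricts to `φ`.
        let v , v≋φ = cocycle-onTo (φ , φd≋0)
            a , az≋ = generates v in
        a ∘ʰ fstʰ , λ x → R.trans (az≋ x) (v≋φ x)
      δ-dualExact (suc i) φ φd≋0 = F.dualExact i φ φd≋0

      -- With `b σ = a t`, the relation `σ r = y x` turns `φ (r , x) t` into `h x`. The cocycle
      -- condition makes `h` vanish on the image of `F₁`, so `h` descends to the torsion module `M`,
      -- where every functional is zero.
      δ-vanish : ∀ (φ : Hom (Fr G ⊗ F₀) (regular R)) → φ ∘ʰ ⟨ z , F.d 0 ⟩ʰ ≋ 0ʰ → ∀ x →
                 ⟦ δ₀ ⟧ x G.≈ᴹ G.0ᴹ → ⟦ φ ⟧ x R.≈ R.0#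
      δ-vanish φ φδ≋0 (r , x) δ₀≈0 =
        let t , t∈ , b , bσ≋at = extendDenseMono S G mono a
            h = u · t +ʰ b ∘ʰ y
            hd≋0 : h ∘ʰ F.d 0 ≋ 0ʰ
            hd≋0 w = begin
              (⟦ u ⟧ (⟦ F.d 0 ⟧ w) R.* t) R.+ ⟦ b ⟧ (⟦ y ⟧ (⟦ F.d 0 ⟧ w))
                ≈⟨ R.+-congˡ (R.trans (Hom.⟦⟧-cong b (G.≈ᴹ-sym (σz≋yd w))) (bσ≋at (⟦ z ⟧ w))) ⟩
              (⟦ u ⟧ (⟦ F.d 0 ⟧ w) R.* t) R.+ (⟦ a ⟧ (⟦ z ⟧ w) R.* t)
                ≈⟨ sum≈ t (⟦ z ⟧ w) (⟦ F.d 0 ⟧ w) ⟩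
              ⟦ φ ⟧ (⟦ z ⟧ w , ⟦ F.d 0 ⟧ w) R.* t
                ≈⟨ R.*-congʳ (φδ≋0 w) ⟩
              R.0# R.* t ≈⟨ R.zeroˡ t ⟩
              R.0# ∎
            f , fe≋h = F.factor₀ h hd≋0
        in OreSet.nonZeroDivʳ S t∈ _ (begin
          ⟦ φ ⟧ (r , x) R.* t
            ≈⟨ sum≈ t r x ⟨
          (⟦ u ⟧ x R.* t) R.+ (⟦ a ⟧ r R.* t)
            ≈⟨ R.+-congˡ (R.trans (R.sym (bσ≋at r)) (Hom.⟦⟧-cong b (G.-≈0⇒≈ _ _ δ₀≈0))) ⟩
          ⟦ h ⟧ x                  ≈⟨ fe≋h x ⟨
          ⟦ f ⟧ (⟦ F.ε ⟧ x)      ≈⟨ torsion-functional S M-tors f _ ⟩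
          R.0#                     ∎)
        where
        open SetoidReasoning R.setoid
        a : Hom (Fr G) (regular R)
        a = φ ∘ʰ inlʰ
        u : Hom F₀ (regular R)
        u = φ ∘ʰ inrʰ
        sum≈ : ∀ t r x → ((⟦ u ⟧ x R.* t) R.+ (⟦ a ⟧ r R.* t)) R.≈ (⟦ φ ⟧ (r , x) R.* t)
        sum≈ t r x = R.trans (R.sym (R.distribʳ t _ _))
          (R.*-congʳ (R.trans (R.+-comm _ _) (⊗-functional φ r x)))

      module Cone = DualExactComplex κ δ δδ≋0 δ-dualExact δ-vanish D bound

      m = F.factor₀ (q ∘ʰ y) λ w → P₀.≈ᴹ-trans
            (Hom.⟦⟧-cong q (G.≈ᴹ-sym (σz≋yd w))) (SES.null ses (⟦ z ⟧ w))

    embedding : Hom M P₀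
    embedding = proj₁ m

    embedding-injective : IsInjective embedding
    embedding-injective = injective-from-kernel embedding λ μ mμ≈0 →
      let x , ex≈μ = F.ε-onTo μ
          r , σr≈yx = SES.fill ses (⟦ y ⟧ x) (P₀.≈ᴹ-trans (P₀.≈ᴹ-sym (proj₂ m x))
                        (P₀.≈ᴹ-trans (Hom.⟦⟧-cong embedding ex≈μ) mμ≈0))
          w , zw≈r , dw≈x = Cone.exact 0 (r , x) (G.≈⇒-≈0 σr≈yx)
      in M.≈ᴹ-trans (M.≈ᴹ-sym ex≈μ) (M.≈ᴹ-trans (Hom.⟦⟧-cong (F.ε) (F₀.≈ᴹ-sym dw≈x)) (proj₁ F.exact₀ w))

    cokernel-Ext0 : {n : Hom P₀ N} → SES embedding n → ∀ k → Ext0 (suc k) N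
    cokernel-Ext0 {N} {n} N-SES = Cone.cokernel-Ext0 {p = n ∘ʰ q} (∘-onTo q n (SES.onto ses) (SES.onto N-SES))
      ( (λ (r , x) → N₀.≈ᴹ-trans (Hom.⟦⟧-cong n (qδ₀ r x))
          (N₀.≈ᴹ-trans (Hom.⟦⟧-cong n (P₀.≈ᴹ-sym (Hom.-ᴹ-homo embedding (⟦ F.ε ⟧ x)))) (SES.null N-SES _)))
      , λ g nqg≈0 →
          let μ , mμ≈qg = SES.fill N-SES (⟦ q ⟧ g) nqg≈0
              x , ex≈μ = F.ε-onTo μ
              r , σr≈ = SES.fill ses (g G.-ᴹ ⟦ y ⟧ x) (P₀.≈ᴹ-trans (push q (x₀ :- x₁) (g ∷ ⟦ y ⟧ x ∷ []))
                (P₀.≈⇒-≈0 (P₀.≈ᴹ-trans (P₀.≈ᴹ-sym mμ≈qg) (P₀.≈ᴹ-trans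
                  (Hom.⟦⟧-cong embedding (M.≈ᴹ-sym ex≈μ)) (proj₂ m x)))))
          in (r , F₀.-ᴹ x) , G.≈ᴹ-trans (G.+ᴹ-cong σr≈ (G.-ᴹ‿cong (Hom.-ᴹ-homo y x)))
               (G.solve (g ∷ ⟦ y ⟧ x ∷ []) ((x₀ :- x₁) :+ :- (:- x₁)) x₀ ≡.refl))
      where
      module N₀ = At N
      qδ₀ : ∀ r x → ⟦ q ⟧ (⟦ δ₀ ⟧ (r , x)) P₀.≈ᴹ (P₀.-ᴹ ⟦ embedding ⟧ (⟦ F.ε ⟧ x))
      qδ₀ r x = P₀.≈ᴹ-trans (Hom.+ᴹ-homo q _ _) (P₀.≈ᴹ-trans
        (P₀.+ᴹ-cong (SES.null ses r) (P₀.≈ᴹ-trans (Hom.-ᴹ-homo q (⟦ y ⟧ x)) (P₀.-ᴹ‿cong (P₀.≈ᴹ-sym (proj₂ m x)))))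
        (P₀.+ᴹ-identityˡ _))

  module _ (D : ℕ) (bound : ∀ {M : Mod (R ᵒᵖ)} → Generated M → ∀ m → Ext0 (D + m) M)
    {M : Mod R} (M-tors : Torsion S M) where

    Cogenerated : Set (lsuc ℓ)
    Cogenerated = Σ[ P₀ ∈ Mod R ] Σ[ N ∈ Mod R ]
      Generated P₀ × Torsion S P₀ × ShortResolution P₀ × (∀ n → Ext0 (suc n) N) ×
      Σ[ m ∈ Hom M P₀ ] Σ[ n ∈ Hom P₀ N ] SES m n

    resolution⇒cogenerated : (resolution : DualExactResolution M) →
      Generated (toModule (kernel (dualMap (DualExactResolution.d resolution 1)))) → Cogenerated
    resolution⇒cogenerated resolution (generated s e e-onTo) =
      let P₀ , q , ses , P₀-tors = denseCokernel (G den) (mono den)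
          open Embedding D bound M-tors resolution s {cocycle = e} e-onTo den {q = q} ses
          N-SES = cokernelSES embedding embedding-injective in
      P₀ , P₀ / image embedding , generated (G den) q (SES.onto ses) , P₀-tors ,
      shortResolution (Fr-projective (G den)) (Fr-projective (G den)) ses ,
      cokernel-Ext0 N-SES , embedding , quotientMap (image embedding) , N-SES
      where
      open DualExactResolution resolution using (shape; d)
      open Denominators
      den : Denominators S (d 0) (inclusion (kernel (dualMap (d 1))) ∘ʰ e)
      den = denominators S (d 0) s (inclusion (kernel (dualMap (d 1))) ∘ʰ e)
        λ v → cocycle-torsion M-tors resolution (proj₁ (⟦ e ⟧ v)) (proj₂ (⟦ e ⟧ v))

    torsionEmbedding : LeftNoetherian R → LeftNoetherian (R ᵒᵖ) →
                       Generated M → (∀ n → Ext0 (suc n) M) → Cogenerated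
    torsionEmbedding noeth noethᵒᵖ M-gen ext = resolution⇒cogenerated resolution
      (generated⇒noetherian noethᵒᵖ (Dual-Fr-generated (DualExactResolution.shape resolution 1))
        (kernel (dualMap (DualExactResolution.d resolution 1))))
      where
      resolution : DualExactResolution M
      resolution = dualExactResolution noeth M-gen ext

-- Pullbacks, pushouts and cokernels

module _ {ℓ : Level} {R : Ring ℓ ℓ} where
  private
    variable
      A B C D M N P X : Mod R

  swapʰ : Hom (M ⊗ N) (N ⊗ M)
  swapʰ = ⟨ sndʰ , fstʰ ⟩ʰ

  -- X is the pullback of p along −q; the sign is harmless and keeps the statement symmetric.
  pullbackSES : {i : Hom N P} {p : Hom P M} → SES i p → {q : Hom D M} {k : Hom X (P ⊗ D)} →
                SES k [ p , q ]ʰ → Σ[ j ∈ Hom N X ] SES j (sndʰ ∘ʰ k)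
  pullbackSES {N} {P} {M} {D} {X} {i} {p} s {q} {k} t = proj₁ j , record
    { injective = injective-from-kernel (proj₁ j) λ n jn≈0 → injective⇒kernel i s.injective
        (P.≈ᴹ-trans (P.≈ᴹ-sym (proj₁ (proj₂ j n))) (P.≈ᴹ-trans (proj₁ (Hom.⟦⟧-cong k jn≈0)) (proj₁ (Hom.0ᴹ-homo k))))
    ; isExact   = (λ n → proj₂ (proj₂ j n))
                , λ x kx₂≈0 →
                    let n , in≈ = s.fill (proj₁ (⟦ k ⟧ x)) (M.≈ᴹ-trans (M.≈ᴹ-sym (M.+ᴹ-identityʳ _))
                          (M.≈ᴹ-trans (M.+ᴹ-congˡ (M.≈ᴹ-sym (M.≈ᴹ-trans (Hom.⟦⟧-cong q kx₂≈0) (Hom.0ᴹ-homo q))))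
                            (t.null x)))
                    in n , t.injective (P.≈ᴹ-trans (proj₁ (proj₂ j n)) in≈ ,
                                        D.≈ᴹ-trans (proj₂ (proj₂ j n)) (D.≈ᴹ-sym kx₂≈0))
    ; onto      = λ y →
        let z , pz≈ = s.onto (M.-ᴹ ⟦ q ⟧ y)
            x , kx≈ = t.fill (z , y) (M.≈ᴹ-trans (M.+ᴹ-congʳ pz≈) (M.-ᴹ‿inverseˡ _))
        in x , proj₂ kx≈
    }
    where
    module s = SES s
    module t = SES t
    module P = LeftModule P
    module M = LeftModule M
    module D = LeftModule D
    j = liftKernel t (inlʰ ∘ʰ i) λ n → M.≈ᴹ-trans (M.+ᴹ-cong (s.null n) (Hom.0ᴹ-homo q)) (M.+ᴹ-identityˡ _)

  swapSES⃗ : {p : Hom P M} {q : Hom D M} {k : Hom X (P ⊗ D)} → SES k [ p , q ]ʰ → SES (swapʰ ∘ʰ k) [ q , p ]ʰ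
  swapSES⃗ {M = M} {p = p} {q} {k} s = record
    { injective = λ (a , b) → injective (b , a)
    ; isExact   = (λ x → M.≈ᴹ-trans (M.+ᴹ-comm _ _) (null x))
                , λ (a , b) eq → let x , (e , f) = fill (b , a) (M.≈ᴹ-trans (M.+ᴹ-comm _ _) eq) in x , (f , e)
    ; onto      = λ m → let (a , b) , eq = onto m in (b , a) , M.≈ᴹ-trans (M.+ᴹ-comm _ _) eq
    }
    where
    open SES s
    module M = LeftModule M

  -- X is the pushout of i along −f.
  pushoutSES : {i : Hom M P} {p : Hom P N} → SES i p → {f : Hom M D} {q : Hom (P ⊗ D) X} →
               SES ⟨ i , f ⟩ʰ q → Σ[ r ∈ Hom X N ] SES (q ∘ʰ inrʰ) r
  pushoutSES {M} {P} {N} {D} {X} {i} {p} s {f} {q} t = proj₁ r , record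
    { injective = injective-from-kernel (q ∘ʰ inrʰ) λ y qy≈0 →
        let m , im≈0 , fm≈y = t.fill (P.0ᴹ , y) qy≈0 in
        D.≈ᴹ-trans (D.≈ᴹ-sym fm≈y) (D.≈ᴹ-trans
          (Hom.⟦⟧-cong f (injective⇒kernel i s.injective im≈0)) (Hom.0ᴹ-homo f))
    ; isExact   = (λ y → N.≈ᴹ-trans (proj₂ r (P.0ᴹ , y)) (Hom.0ᴹ-homo p))
                , λ x rx≈0 →
                    let (a , b) , qab≈x = t.onto x
                        m , im≈a = s.fill a (N.≈ᴹ-trans (N.≈ᴹ-sym (proj₂ r (a , b)))
                                     (N.≈ᴹ-trans (Hom.⟦⟧-cong (proj₁ r) qab≈x) rx≈0))
                    in b D.-ᴹ ⟦ f ⟧ m , (begin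
                      ⟦ q ⟧ (P.0ᴹ , b D.-ᴹ ⟦ f ⟧ m)
                        ≈⟨ Hom.⟦⟧-cong q (P.≈ᴹ-sym (P.≈ᴹ-trans (P.+ᴹ-congˡ (P.-ᴹ‿cong im≈a)) (P.-ᴹ‿inverseʳ a)) , D.≈ᴹ-refl) ⟩
                      ⟦ q ⟧ (a P.-ᴹ ⟦ i ⟧ m , b D.-ᴹ ⟦ f ⟧ m)
                        ≈⟨ push q (x₀ :- x₁) ((a , b) ∷ (⟦ i ⟧ m , ⟦ f ⟧ m) ∷ []) ⟩
                      ⟦ q ⟧ (a , b) X.-ᴹ ⟦ q ⟧ (⟦ i ⟧ m , ⟦ f ⟧ m)
                        ≈⟨ X.+ᴹ-cong qab≈x (X.-ᴹ‿cong (t.null m)) ⟩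
                      x X.-ᴹ X.0ᴹ
                        ≈⟨ X.solve (x ∷ []) (x₀ :- :0) x₀ ≡.refl ⟩
                      x ∎)
    ; onto      = λ n → let a , pa≈n = s.onto n in
        ⟦ q ⟧ (a , D.0ᴹ) , N.≈ᴹ-trans (proj₂ r (a , D.0ᴹ)) pa≈n
    }
    where
    module s = SES s
    module t = SES t
    module P = At P
    module D = At D
    module X = At X
    module N = LeftModule N
    open X.≈-Reasoning
    r = factorCokernel t (p ∘ʰ fstʰ) s.null

  swapSES⃖ : {i : Hom M P} {f : Hom M D} {q : Hom (P ⊗ D) X} → SES ⟨ i , f ⟩ʰ q → SES ⟨ f , i ⟩ʰ (q ∘ʰ swapʰ)
  swapSES⃖ s = record
    { injective = λ (a , b) → injective (b , a)
    ; isExact   = null , λ (a , b) eq → let m , (e , f) = fill (b , a) eq in m , (f , e)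
    ; onto      = λ x → let (a , b) , eq = onto x in (b , a) , eq
    }
    where open SES s

  -- Dual to `CompositeKernel`: `C`, `M` and `D` play the roles of `B/A`, `X/A` and `X/B`.
  compositeCokernelSES : {i : Hom A B} {p : Hom B C} → SES i p → {j : Hom B X} {q : Hom X D} → SES j q →
    {κ : Hom X M} → SES (j ∘ʰ i) κ → Σ[ f ∈ Hom C M ] Σ[ g ∈ Hom M D ] SES f g
  compositeCokernelSES {A} {B} {C} {X} {D} {M} {i} {p} s {j} {q} t {κ} u = proj₁ f , proj₁ g , record
    { injective = injective-from-kernel (proj₁ f) λ c fc≈0 →
        let b , pb≈c = s.onto c
            a , jia≈jb = u.fill (⟦ j ⟧ b) (M.≈ᴹ-trans (M.≈ᴹ-sym (proj₂ f b))
                           (M.≈ᴹ-trans (Hom.⟦⟧-cong (proj₁ f) pb≈c) fc≈0))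
        in C.≈ᴹ-trans (C.≈ᴹ-sym pb≈c) (C.≈ᴹ-trans (Hom.⟦⟧-cong p (B.≈ᴹ-sym (t.injective jia≈jb))) (s.null a))
    ; isExact   = (λ c → let b , pb≈c = s.onto c in
                    D.≈ᴹ-trans (Hom.⟦⟧-cong (proj₁ g) (M.≈ᴹ-trans (Hom.⟦⟧-cong (proj₁ f) (C.≈ᴹ-sym pb≈c)) (proj₂ f b)))
                      (D.≈ᴹ-trans (proj₂ g (⟦ j ⟧ b)) (t.null b)))
                , λ y gy≈0 →
                    let x , κx≈y = u.onto y
                        b , jb≈x = t.fill x (D.≈ᴹ-trans (D.≈ᴹ-sym (proj₂ g x))
                                     (D.≈ᴹ-trans (Hom.⟦⟧-cong (proj₁ g) κx≈y) gy≈0)) in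
                    ⟦ p ⟧ b , M.≈ᴹ-trans (proj₂ f b) (M.≈ᴹ-trans (Hom.⟦⟧-cong κ jb≈x) κx≈y)
    ; onto      = λ y → let x , qx≈y = t.onto y in ⟦ κ ⟧ x , D.≈ᴹ-trans (proj₂ g x) qx≈y
    }
    where
    module s = SES s
    module t = SES t
    module u = SES u
    module B = LeftModule B
    module C = LeftModule C
    module D = LeftModule D
    module M = LeftModule M
    f = factorCokernel s (κ ∘ʰ j) u.null
    g = factorCokernel u q (λ x → t.null (⟦ i ⟧ x))

  -- Since Ext²(C, R) = 0, the second syzygy of C, which is projective and
  -- finitely generated, splits off.
  short-cokernel : LeftNoetherian R → {i : Hom A B} {p : Hom B C} → SES i p →
    ShortResolution A → ShortResolution B → Generated B → Ext0 1 C → ShortResolution C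
  short-cokernel noeth {p = p} s a b (generated u g g-onTo) ext =
    shortResolution (retract-projective (Fr-projective v) (proj₁ σ) e eσ≋id) (Fr-projective u) composite
    where
    open CompositeKernel s (kernelSES g g-onTo)
    -- `K` is the first syzygy of `C` and an extension of `A` by the kernel of `g`, which is
    -- projective because `B` has a short resolution. Hence the next syzygy `K₂` is projective.
    K-short : ShortResolution K
    K-short = short-extension kernels
      (projective⇒short (short⇒kernel-projective b (Fr-projective u) (kernelSES g g-onTo))) a
    open Generated (noetherian-Fr noeth u (kernel (p ∘ʰ g)))
      renaming (shape to v; generators to e; generators-onTo to e-onTo)
    e-SES : SES (inclusion (kernel e)) e
    e-SES = kernelSES e e-onTo
    K₂ : Mod R
    K₂ = toModule (kernel e)
    open Generated (noetherian-Fr noeth v (kernel e))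
      renaming (shape to w; generators to h; generators-onTo to h-onTo)
    -- Vanishing of Ext²(C, R) extends maps into free modules only, so `K₂` is first embedded as a
    -- summand of `Fr w`; the section is extended to `Fr v` coordinatewise and `h` leads back.
    section = liftProjective {P = K₂} (short⇒kernel-projective K-short (Fr-projective v) e-SES) h h-onTo idʰ
    extended = extends-Fr (inclusion (kernel e)) (ext (Fr-projective u) composite e-SES) w (proj₁ section)
    module V = At (Fr {R = R} v)
    module K = At K
    ρ : Hom (Fr v) K₂
    ρ = h ∘ʰ proj₁ extended
    ρ-retract : ρ ∘ʰ inclusion (kernel e) ≋ idʰ
    ρ-retract k = V.≈ᴹ-trans (Hom.⟦⟧-cong h (proj₂ extended k)) (proj₂ section k)
    σ = factorCokernel e-SES (idʰ -ʰ inclusion (kernel e) ∘ʰ ρ)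
          λ k → V.≈⇒-≈0 (V.≈ᴹ-sym (ρ-retract k))
    eσ≋id : e ∘ʰ proj₁ σ ≋ idʰ
    eσ≋id k =
      let x , ex≈k = e-onTo k
          y = ⟦ inclusion (kernel e) ⟧ (⟦ ρ ⟧ x) in begin
      ⟦ e ⟧ (⟦ proj₁ σ ⟧ k)           ≈⟨ Hom.⟦⟧-cong e (Hom.⟦⟧-cong (proj₁ σ) {⟦ e ⟧ x} {k} ex≈k) ⟨
      ⟦ e ⟧ (⟦ proj₁ σ ⟧ (⟦ e ⟧ x))   ≈⟨ Hom.⟦⟧-cong e (proj₂ σ x) ⟩
      ⟦ e ⟧ (x V.-ᴹ y)                ≈⟨ push e (x₀ :- x₁) (x ∷ y ∷ []) ⟩
      ⟦ e ⟧ x K.-ᴹ ⟦ e ⟧ y            ≈⟨ K.+ᴹ-congˡ {⟦ e ⟧ x} {K.-ᴹ ⟦ e ⟧ y} {K.-ᴹ K.0ᴹ} (K.-ᴹ‿cong {⟦ e ⟧ y} {K.0ᴹ} (proj₂ (⟦ ρ ⟧ x))) ⟩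
      ⟦ e ⟧ x K.-ᴹ K.0ᴹ               ≈⟨ K.solve (⟦ e ⟧ x ∷ []) (x₀ :- :0) x₀ ≡.refl ⟩
      ⟦ e ⟧ x                         ≈⟨ ex≈k ⟩
      k                               ∎
      where open K.≈-Reasoning

-- Quasi-Fitting invariants

-- The part of the exact structure of 𝒞 used by the shift by 1; the shift
-- by −1 is the same construction in the opposite structure.
record ExactStructure {o p s : Level} (Obj : Set o) (𝒫 : Obj → Set p) (Seq : Obj → Obj → Obj → Set s) :
                      Set (o ⊔ p ⊔ s) where
  field
    𝒫-cover     : ∀ M → Σ[ N ∈ Obj ] Σ[ P ∈ Obj ] 𝒫 P × Seq N P M
    pullback    : ∀ {N P N′ P′ M} → Seq N P M → Seq N′ P′ M → Σ[ X ∈ Obj ] Seq N X P′ × Seq N′ X P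
    composite   : ∀ {N E M M′ P} → Seq N E M → Seq M′ M P → Σ[ K ∈ Obj ] Seq N K M′ × Seq K E P
    𝒫-extension : ∀ {A B C} → Seq A B C → 𝒫 A → 𝒫 C → 𝒫 B
    𝒫-kernel    : ∀ {A B C} → Seq A B C → 𝒫 B → 𝒫 C → 𝒫 A
    O           : Obj
    O∈𝒫         : 𝒫 O
    identitySeq : ∀ M → Seq O M M

module _ {a b : Level} (Ω : CommutativeMonoid a b) where
  open CommutativeMonoid Ω

  record QuasiFitting {o p s : Level} {Obj : Set o} (𝒫 : Obj → Set p) (Seq : Obj → Obj → Obj → Set s)
                      (𝓕 : Obj → Carrier) : Set (a ⊔ b ⊔ o ⊔ p ⊔ s) where
    field
      unit     : ∀ {P} → 𝒫 P → Invertible _≈_ ε _∙_ (𝓕 P)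
      quotient : ∀ {M′ M P} → 𝒫 P → Seq M′ M P → 𝓕 M ≈ 𝓕 P ∙ 𝓕 M′
      sub      : ∀ {P M M′} → 𝒫 P → Seq P M M′ → 𝓕 M ≈ 𝓕 P ∙ 𝓕 M′

    reverse : QuasiFitting 𝒫 (λ A B C → Seq C B A) 𝓕
    reverse = record { unit = unit ; quotient = sub ; sub = quotient }

  invertible-cancelˡ : ∀ {u x y} → Invertible _≈_ ε _∙_ u → u ∙ x ≈ u ∙ y → x ≈ y
  invertible-cancelˡ {u} {x} {y} (v , vu≈ε , _) ux≈uy = begin
    x             ≈⟨ identityˡ x ⟨
    ε ∙ x         ≈⟨ ∙-congʳ vu≈ε ⟨
    (v ∙ u) ∙ x   ≈⟨ assoc v u x ⟩
    v ∙ (u ∙ x)   ≈⟨ ∙-congˡ ux≈uy ⟩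
    v ∙ (u ∙ y)   ≈⟨ assoc v u y ⟨
    (v ∙ u) ∙ y   ≈⟨ ∙-congʳ vu≈ε ⟩
    ε ∙ y         ≈⟨ identityˡ y ⟩
    y             ∎
    where open SetoidReasoning setoid

  module ShiftOne {o p s : Level} {Obj : Set o} {𝒫 : Obj → Set p} {Seq : Obj → Obj → Obj → Set s}
    (𝓔 : ExactStructure Obj 𝒫 Seq) {𝓕 : Obj → Carrier} (qf : QuasiFitting 𝒫 Seq 𝓕) where
    open ExactStructure 𝓔
    open QuasiFitting qf
    open CommutativeSemigroupProperties commutativeSemigroup using (interchange; x∙yz≈y∙xz)
    open SetoidReasoning setoid

    -- The identity sequence of `O` makes `𝓕 O` an idempotent unit.
    𝓕O≈ε : 𝓕 O ≈ ε
    𝓕O≈ε = invertible-cancelˡ (unit O∈𝒫) (trans (sym (quotient O∈𝒫 (identitySeq O))) (sym (identityʳ (𝓕 O))))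

    shift : Obj → Carrier
    shift M = let N , P , P∈𝒫 , _ = 𝒫-cover M in proj₁ (unit P∈𝒫) ∙ 𝓕 N

    -- The pullback `X` of two covers is an extension in two ways, so `𝓕 P ∙ 𝓕 N₀` and `𝓕 P₀ ∙ 𝓕 N`
    -- both equal `𝓕 X`. Multiplied out, the equation characterises `shift M` without naming an
    -- inverse.
    shift-char : ∀ {N P M} → 𝒫 P → Seq N P M → 𝓕 P ∙ shift M ≈ 𝓕 N
    shift-char {N} {P} {M} P∈𝒫 t =
      let N₀ , P₀ , P₀∈𝒫 , t₀ = 𝒫-cover M
          X , u , v = pullback t t₀
      in invertible-cancelˡ (unit P₀∈𝒫) (begin
        𝓕 P₀ ∙ (𝓕 P ∙ shift M)                           ≈⟨ x∙yz≈y∙xz _ _ _ ⟩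
        𝓕 P ∙ (𝓕 P₀ ∙ (proj₁ (unit P₀∈𝒫) ∙ 𝓕 N₀))        ≈⟨ ∙-congˡ (assoc _ _ _) ⟨
        𝓕 P ∙ ((𝓕 P₀ ∙ proj₁ (unit P₀∈𝒫)) ∙ 𝓕 N₀)
          ≈⟨ ∙-congˡ (trans (∙-congʳ (proj₂ (proj₂ (unit P₀∈𝒫)))) (identityˡ _)) ⟩
        𝓕 P ∙ 𝓕 N₀                                        ≈⟨ quotient P∈𝒫 v ⟨
        𝓕 X                                               ≈⟨ quotient P₀∈𝒫 u ⟩
        𝓕 P₀ ∙ 𝓕 N                                        ∎)

    shift-𝒫 : ∀ {P} → 𝒫 P → 𝓕 P ∙ shift P ≈ ε
    shift-𝒫 {P} P∈𝒫 = trans (shift-char P∈𝒫 (identitySeq P)) 𝓕O≈ε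

    shift-quasiFitting : QuasiFitting 𝒫 Seq shift
    shift-quasiFitting = record
      { unit     = λ {P} P∈𝒫 → 𝓕 P , shift-𝒫 P∈𝒫 , trans (comm _ _) (shift-𝒫 P∈𝒫)
      ; quotient = λ {M′} {M} {P} P∈𝒫 t →
          let N , E , E∈𝒫 , c = 𝒫-cover M
              K , u , v = composite c t
              -- `K` covers `M′` with the same kernel `N` with which `E` covers `M`.
              K∈𝒫 = 𝒫-kernel v E∈𝒫 P∈𝒫
          in invertible-cancelˡ (unit E∈𝒫) (begin
            𝓕 E ∙ shift M                          ≈⟨ shift-char E∈𝒫 c ⟩
            𝓕 N                                    ≈⟨ identityˡ _ ⟨
            ε ∙ 𝓕 N                                ≈⟨ ∙-cong (shift-𝒫 P∈𝒫) (shift-char K∈𝒫 u) ⟨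
            (𝓕 P ∙ shift P) ∙ (𝓕 K ∙ shift M′)     ≈⟨ interchange _ _ _ _ ⟩
            (𝓕 P ∙ 𝓕 K) ∙ (shift P ∙ shift M′)     ≈⟨ ∙-congʳ (quotient P∈𝒫 v) ⟨
            𝓕 E ∙ (shift P ∙ shift M′)             ∎)
      ; sub      = λ {P} {M} {M′} P∈𝒫 t →
          let N , E , E∈𝒫 , c = 𝒫-cover M′
              X , u , v = pullback t c
              -- The pullback `X` covers `M` with the same kernel `N` with which `E` covers `M′`.
              X∈𝒫 = 𝒫-extension u P∈𝒫 E∈𝒫
          in invertible-cancelˡ (unit X∈𝒫) (begin
            𝓕 X ∙ shift M                          ≈⟨ shift-char X∈𝒫 v ⟩
            𝓕 N                                    ≈⟨ identityˡ _ ⟨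
            ε ∙ 𝓕 N                                ≈⟨ ∙-cong (shift-𝒫 P∈𝒫) (shift-char E∈𝒫 c) ⟨
            (𝓕 P ∙ shift P) ∙ (𝓕 E ∙ shift M′)     ≈⟨ interchange _ _ _ _ ⟩
            (𝓕 P ∙ 𝓕 E) ∙ (shift P ∙ shift M′)     ≈⟨ ∙-congʳ (sub P∈𝒫 u) ⟨
            𝓕 X ∙ (shift P ∙ shift M′)             ∎)
      }

-- The exact structure of `𝒞` and its opposite

module _ {ℓ : Level} {R : Ring ℓ ℓ} (S : OreSet R) where
  private
    variable
      A B C : 𝒞 S

  toSES : ∀ A B C (t : ShortExactSequence S A B C) → SES (proj₁ (proj₁ t)) (proj₂ (proj₁ t))
  toSES _ _ _ ((f , g) , inj , ex , surj) = record { injective = inj ; isExact = ex ; onto = onTo g surj }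

  fromSES : ∀ A B C {i : Hom (proj₁ A) (proj₁ B)} {p : Hom (proj₁ B) (proj₁ C)} → SES i p → ShortExactSequence S A B C
  fromSES _ _ _ {i} {p} s = (i , p) , injective , isExact , surjective p onto
    where open SES s

module _ {ℓ : Level} {R : Ring ℓ ℓ} (noeth : LeftNoetherian R) (S : OreSet R) where
  private
    variable
      A B C M N : Mod R

  generated𝒞 : Is𝒞 S M → Generated M
  generated𝒞 {M} c = finitelyGenerated⇒generated M (Is𝒞.finitelyGenerated c)

  Ext0-𝒞 : Is𝒞 S M → ∀ n → Ext0 (suc n) M
  Ext0-𝒞 c = pd⋆≤1⇒Ext0 (Is𝒞.pd⋆≤1 c)

  is𝒞 : Generated M → Torsion S M → (∀ n → Ext0 (suc n) M) → Is𝒞 S M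
  is𝒞 M-gen tors ext = record
    { finitelyGenerated = generated⇒finitelyGenerated M-gen ; torsion = tors ; pd⋆≤1 = Ext0⇒pd⋆≤1 ext }

  -- Ext of `A` in degree `n + 2` lies between Ext of `B` in degree `n + 2` and Ext of `C` in degree
  -- `n + 3`.
  𝒞-kernel : {i : Hom A B} {p : Hom B C} → SES i p → Is𝒞 S B → Is𝒞 S C → Is𝒞 S A
  𝒞-kernel {i = i} s b c = is𝒞
    (noetherian-mono (generated⇒noetherian noeth (generated𝒞 b)) i (SES.injective s))
    (torsion-mono S i (SES.injective s) (Is𝒞.torsion b))
    (λ n → Ext0-kernel (suc n) s (Ext0-𝒞 b n) (Ext0-𝒞 c (suc n)))

  𝒞-extension : {i : Hom A B} {p : Hom B C} → SES i p → Is𝒞 S A → Is𝒞 S C → Is𝒞 S B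
  𝒞-extension s a c = is𝒞
    (generated-extension s (generated𝒞 a) (generated𝒞 c))
    (torsion-extension S s (Is𝒞.torsion a) (Is𝒞.torsion c))
    (λ n → Ext0-extension (suc n) s (Ext0-𝒞 a n) (Ext0-𝒞 c n))

  zero𝒞 : 𝒞 S
  zero𝒞 = 𝟘 , is𝒞 (Fr-generated none) (λ _ → Ring.1# R , OreSet.1∈S S , tt) (λ n → Ext0-𝟘 (suc n))

  iso𝒞 : (f : Hom M N) → IsInjective f → OnTo f → Is𝒞 S M → Is𝒞 S N
  iso𝒞 {M} {N} f inj onto c = is𝒞 (generated-image f onto (generated𝒞 c)) (torsion-image S f onto (Is𝒞.torsion c))
    (λ n → Ext0-extension (suc n) s (Ext0-𝒞 c n) (Ext0-𝟘 (suc n)))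
    where
    s : SES f (0ʰ {N = 𝟘})
    s = record { injective = inj ; isExact = (λ _ → tt) , (λ y _ → onto y) ; onto = λ _ → LeftModule.0ᴹ N , tt }

  exactStructure : ExactStructure (𝒞 S) (Is𝒫 S) (ShortExactSequence S)
  exactStructure = record
    { 𝒫-cover     = λ (M , c) →
        let P , P-gen , tors , short , e , e-onTo = torsionCover S (generated𝒞 c) (Is𝒞.torsion c)
            P∈𝒞 = is𝒞 P-gen tors (short⇒Ext0 short)
            s = kernelSES e e-onTo
            N = toModule (kernel e) , 𝒞-kernel s P∈𝒞 c
        in N , (P , P∈𝒞) , short⇒pd≤1 short , fromSES S N (P , P∈𝒞) (M , c) s
    ; pullback    = λ {N} {P} {N′} {P′} {M} t t′ →
        let s = toSES S N P M t ; s′ = toSES S N′ P′ M t′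
            p = proj₂ (proj₁ t) ; p′ = proj₂ (proj₁ t′)
            u = kernelSES [ p , p′ ]ʰ λ m → let x , px≈m = SES.onto s m in
                  (x , LeftModule.0ᴹ (proj₁ P′)) , LeftModule.≈ᴹ-trans (proj₁ M)
                    (LeftModule.+ᴹ-congˡ (proj₁ M) (Hom.0ᴹ-homo p′))
                    (LeftModule.≈ᴹ-trans (proj₁ M) (LeftModule.+ᴹ-identityʳ (proj₁ M) _) px≈m)
            j , v = pullbackSES s {p′} u
            j′ , v′ = pullbackSES s′ {p} (swapSES⃗ {p = p} {p′} u)
            X = toModule (kernel [ p , p′ ]ʰ) , 𝒞-extension v (proj₂ N) (proj₂ P′)
        in X , fromSES S N X P′ v , fromSES S N′ X P v′
    ; composite   = λ {N} {E} {M} {M′} {P} t t′ →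
        let module T = CompositeKernel (toSES S M′ M P t′) (toSES S N E M t)
            K′ = T.K , 𝒞-extension T.kernels (proj₂ N) (proj₂ M′)
        in K′ , fromSES S N K′ M′ T.kernels , fromSES S K′ E P T.composite
    ; 𝒫-extension = λ {A} {B} {C} t a c → short⇒pd≤1 (short-extension (toSES S A B C t) (pd≤1⇒short a) (pd≤1⇒short c))
    ; 𝒫-kernel    = λ {A} {B} {C} t b c → short⇒pd≤1 (short-kernel (toSES S A B C t) (pd≤1⇒short b) (pd≤1⇒short c))
    ; O           = zero𝒞
    ; O∈𝒫         = short⇒pd≤1 (projective⇒short 𝟘-projective)
    ; identitySeq = λ M → fromSES S zero𝒞 M M identitySES
    }

  module _ (noethᵒᵖ : LeftNoetherian (R ᵒᵖ))
    (D : ℕ) (bound : ∀ {M : Mod (R ᵒᵖ)} → Generated M → ∀ m → Ext0 (D + m) M) where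

    oppositeExactStructure : ExactStructure (𝒞 S) (Is𝒫 S) (λ A B C → ShortExactSequence S C B A)
    oppositeExactStructure = record
      { 𝒫-cover     = λ (M , c) →
          let P , N , P-gen , tors , short , ext , m , n , s =
                torsionEmbedding S D bound (Is𝒞.torsion c) noeth noethᵒᵖ (generated𝒞 c) (Ext0-𝒞 c)
              P∈𝒞 = is𝒞 P-gen tors (short⇒Ext0 short)
              N∈𝒞 = is𝒞 (generated-image n (SES.onto s) P-gen) (torsion-image S n (SES.onto s) tors) ext
          in (N , N∈𝒞) , (P , P∈𝒞) , short⇒pd≤1 short , fromSES S (M , c) (P , P∈𝒞) (N , N∈𝒞) s
      ; pullback    = λ {N} {P} {N′} {P′} {M} t t′ →
          let s = toSES S M P N t ; s′ = toSES S M P′ N′ t′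
              i = proj₁ (proj₁ t) ; i′ = proj₁ (proj₁ t′)
              u = cokernelSES ⟨ i , i′ ⟩ʰ (λ eq → SES.injective s (proj₁ eq))
              r , v = pushoutSES s {i′} u
              r′ , v′ = pushoutSES s′ {i} (swapSES⃖ {i = i} {i′} u)
              X = (proj₁ P ⊗ proj₁ P′) / image ⟨ i , i′ ⟩ʰ , 𝒞-extension v (proj₂ P′) (proj₂ N)
          in X , fromSES S P′ X N v , fromSES S P X N′ v′
      ; composite   = λ {N} {E} {M} {M′} {P} t t′ →
          let s = toSES S P M M′ t′ ; s′ = toSES S M E N t
              i = proj₁ (proj₁ t) ∘ʰ proj₁ (proj₁ t′)
              u = cokernelSES i (λ eq → SES.injective s (SES.injective s′ eq))
              f , g , v = compositeCokernelSES s s′ u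
              K = proj₁ E / image i , 𝒞-extension v (proj₂ M′) (proj₂ N)
          in K , fromSES S M′ K N v , fromSES S P E K u
      ; 𝒫-extension = λ {A} {B} {C} t a c → short⇒pd≤1 (short-extension (toSES S C B A t) (pd≤1⇒short c) (pd≤1⇒short a))
      ; 𝒫-kernel    = λ {A} {B} {C} t b c → short⇒pd≤1 (short-cokernel noeth (toSES S C B A t)
          (pd≤1⇒short c) (pd≤1⇒short b) (generated𝒞 (proj₂ B)) (Ext0-𝒞 (proj₂ A) 0))
      ; O           = zero𝒞
      ; O∈𝒫         = short⇒pd≤1 (projective⇒short 𝟘-projective)
      ; identitySeq = λ M → fromSES S M M zero𝒞 {idʰ} {0ʰ} (record
          { injective = λ eq → eq
          ; isExact   = (λ _ → tt) , (λ y _ → y , LeftModule.≈ᴹ-refl (proj₁ M))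
          ; onto      = λ _ → LeftModule.0ᴹ (proj₁ M) , tt
          })
      }

-- Cutting and splicing exact sequences

module _ {ℓ : Level} {R : Ring ℓ ℓ} (noeth : LeftNoetherian R) (S : OreSet R) where

  -- Exactness sees the incoming map only through its image, so cutting and splicing may replace a
  -- map by the inclusion of its image, or precompose it with a surjection.
  exactFrom-cong : ∀ n {W W′ A : 𝒞 S} {X : Vector (𝒞 S) n} {B : 𝒞 S}
    (w : Hom (proj₁ W) (proj₁ A)) (w′ : Hom (proj₁ W′) (proj₁ A)) →
    (∀ {N : Mod R} (k : Hom (proj₁ A) N) → IsExact w k → IsExact w′ k) → (fs : Maps S n A X B) →
    ExactFrom S {n} {W} {A} {X} {B} w fs → ExactFrom S {n} {W′} {A} {X} {B} w′ fs
  exactFrom-cong zero    w w′ change f        (ex , surj)       = change f ex , surj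
  exactFrom-cong (suc n) w w′ change (f , fs) (ex , im , exact) = change f ex , im , exact

  identitySequence : ∀ (A : 𝒞 S) (X : Vector (𝒞 S) 0) → ExactSequence S 0 A X A
  identitySequence (A , _) X = idʰ , (λ eq → eq) , surjective (idʰ {M = A}) (λ y → y , LeftModule.≈ᴹ-refl A)

  peel : ∀ n (A : 𝒞 S) (X : Vector (𝒞 S) (suc n)) (B : 𝒞 S) → ExactSequence S (suc n) A X B →
         Σ[ I ∈ 𝒞 S ] ShortExactSequence S A (X zero) I × ExactSequence S n I (X ∘ suc) B
  peel zero    A X B t = B , t , identitySequence B (X ∘ suc)
  peel (suc n) A X B ((f , g , gs) , inj , (gf≈0 , ex) , im , exact) =
      I , fromSES S A (X zero) I {f} {corestrict g} (record
        { injective = inj ; isExact = gf≈0 , ex ; onto = corestrict-onTo g })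
    , (inclusion (image g) , gs) , (λ eq → eq) ,
      exactFrom-cong n {X zero} {I} {X (suc zero)} {λ i → X (suc (suc i))} {B} g (inclusion (image g)) (λ {N} k (kg≈0 , ex) →
        (λ (x , y , gy≈x) → LeftModule.≈ᴹ-trans N
          (Hom.⟦⟧-cong k (LeftModule.≈ᴹ-sym (proj₁ (X (suc zero))) gy≈x)) (kg≈0 y)) ,
        λ x kx≈0 → (x , ex x kx≈0) , LeftModule.≈ᴹ-refl (proj₁ (X (suc zero)))) gs exact
    where
    I : 𝒞 S
    I = toModule (image g) , im

  splice : ∀ n (A E I : 𝒞 S) (X : Vector (𝒞 S) n) (B : 𝒞 S) →
           ShortExactSequence S A E I → ExactSequence S n I X B → ExactSequence S (suc n) A (E Vector.∷ X) B
  splice zero A E I X B t (h , h-inj , h-surj) =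
      (i , h ∘ʰ p) , injective , precompose , surjective (h ∘ʰ p) (∘-onTo p h onto (onTo h h-surj))
    where
    open SES (toSES S A E I t)
    i = proj₁ (proj₁ t)
    p = proj₂ (proj₁ t)
    precompose : IsExact i (h ∘ʰ p)
    precompose = (λ x → LeftModule.≈ᴹ-trans (proj₁ B) (Hom.⟦⟧-cong h (null x)) (Hom.0ᴹ-homo h))
               , λ y hpy≈0 → fill y (injective⇒kernel h h-inj hpy≈0)
  splice (suc n) A E I X B t ((h , hs) , h-inj , exact) =
      (i , h ∘ʰ p , hs) , injective , precompose ,
      -- Splicing creates one new intermediate image, that of `h ∘ʰ p`; it is isomorphic to `I`
      -- through `h`.
      iso𝒞 noeth S (proj₁ h̄) (λ eq → h-inj (X₀.≈ᴹ-trans (X₀.≈ᴹ-sym (proj₂ h̄ _)) (X₀.≈ᴹ-trans eq (proj₂ h̄ _))))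
        (λ (x , e , hpe≈x) → ⟦ p ⟧ e , X₀.≈ᴹ-trans (proj₂ h̄ (⟦ p ⟧ e)) hpe≈x) (proj₂ I) ,
      exactFrom-cong n {I} {E} {X zero} {X ∘ suc} {B} h (h ∘ʰ p) (λ k (kh≈0 , ex) →
        (λ x → kh≈0 (⟦ p ⟧ x)) ,
        λ y ky≈0 → let x , hx≈y = ex y ky≈0 ; e , pe≈x = onto x in
          e , X₀.≈ᴹ-trans (Hom.⟦⟧-cong h pe≈x) hx≈y) hs exact
    where
    open SES (toSES S A E I t)
    module X₀ = LeftModule (proj₁ (X zero))
    i = proj₁ (proj₁ t)
    p = proj₂ (proj₁ t)
    precompose : IsExact i (h ∘ʰ p)
    precompose = (λ x → X₀.≈ᴹ-trans (Hom.⟦⟧-cong h (null x)) (Hom.0ᴹ-homo h))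
               , λ y hpy≈0 → fill y (injective⇒kernel h h-inj hpy≈0)
    h̄ = liftMono (inclusion (image (h ∘ʰ p))) (λ eq → eq) h λ x →
      let e , pe≈x = onto x in (⟦ h ⟧ x , e , Hom.⟦⟧-cong h pe≈x) , X₀.≈ᴹ-refl

  -- Vectors are functions, and pointwise equality does not identify them; the sequence is therefore
  -- taken apart and reassembled term by term.
  exactSequence-cong : ∀ n (A : 𝒞 S) {X Y : Vector (𝒞 S) n} (B : 𝒞 S) → (∀ i → X i ≡ Y i) →
                       ExactSequence S n A X B → ExactSequence S n A Y B
  exactSequence-cong zero    A B X≡Y t = t
  exactSequence-cong (suc n) A {X} {Y} B X≡Y t =
    let I , u , v = peel n A X B t in
    splice n A (Y zero) I (Y ∘ suc) B (≡.subst (λ E → ShortExactSequence S A E I) (X≡Y zero) u)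
      (exactSequence-cong n I B (X≡Y ∘ suc) v)

  -- Iterated shifts

  module _ (𝓔 : ExactStructure (𝒞 S) (Is𝒫 S) (ShortExactSequence S))
    {a b : Level} (Ω : CommutativeMonoid a b) where
    open CommutativeMonoid Ω
    open SetoidReasoning setoid

    private
      infixr 8 _^_
      _^_ : Ω× S Ω → ℤ → Carrier
      _^_ = _^ᶻ_ S Ω

    open RawMonoidDefs rawMonoid using () renaming (sum to ∏)

    alternating-sign : ∀ k → (-1ℤ ℤ.^ k ≡ 1ℤ × -1ℤ ℤ.^ suc k ≡ -1ℤ) ⊎ (-1ℤ ℤ.^ k ≡ -1ℤ × -1ℤ ℤ.^ suc k ≡ 1ℤ)
    alternating-sign zero    = inj₁ (≡.refl , ≡.refl)
    alternating-sign (suc k) with alternating-sign k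
    ... | inj₁ (_ , q) = inj₂ (q , ≡.cong (-1ℤ ℤ.*_) q)
    ... | inj₂ (_ , q) = inj₁ (q , ≡.cong (-1ℤ ℤ.*_) q)

    inverse-unique : ∀ {x y z} → y ∙ x ≈ ε → x ∙ z ≈ ε → y ≈ z
    inverse-unique {x} {y} {z} yx≈ε xz≈ε = begin
      y             ≈⟨ identityʳ y ⟨
      y ∙ ε         ≈⟨ ∙-congˡ xz≈ε ⟨
      y ∙ (x ∙ z)   ≈⟨ assoc y x z ⟨
      (y ∙ x) ∙ z   ≈⟨ ∙-congʳ yx≈ε ⟩
      ε ∙ z         ≈⟨ identityˡ z ⟩
      z             ∎

    -- Accounts for reindexing after one shift: the new value on `𝒫` is inverse to the old one, and
    -- the position in the remaining sequence is one lower.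
    power-inverse : (u v : Ω× S Ω) → proj₁ u ∙ proj₁ v ≈ ε → ∀ k → u ^ (-1ℤ ℤ.^ suc k) ≈ v ^ (-1ℤ ℤ.^ k)
    power-inverse u@(x , x⁻¹ , x⁻¹x≈ε , xx⁻¹≈ε) v@(y , y⁻¹ , y⁻¹y≈ε , yy⁻¹≈ε) xy≈ε k
      with alternating-sign k
    ... | inj₁ (p , q) rewrite p | q = ∙-congʳ (inverse-unique x⁻¹x≈ε xy≈ε)
    ... | inj₂ (p , q) rewrite p | q = ∙-congʳ (inverse-unique xy≈ε yy⁻¹≈ε)

    power-alternate : (u : Ω× S Ω) → ∀ k → u ^ (-1ℤ ℤ.^ suc k) ∙ u ^ (-1ℤ ℤ.^ k) ≈ ε
    power-alternate u@(x , x⁻¹ , x⁻¹x≈ε , xx⁻¹≈ε) k with alternating-sign k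
    ... | inj₁ (p , q) rewrite p | q = trans (∙-cong (identityʳ _) (identityʳ _)) x⁻¹x≈ε
    ... | inj₂ (p , q) rewrite p | q = trans (∙-cong (identityʳ _) (identityʳ _)) xx⁻¹≈ε

    toAbstract : ∀ {𝓕} → IsQuasiFitting S Ω 𝓕 → QuasiFitting Ω (Is𝒫 S) (ShortExactSequence S) 𝓕
    toAbstract qf = record { unit = unit _ ; quotient = λ P∈ t → quotient _ _ _ P∈ t ; sub = λ P∈ t → sub _ _ _ P∈ t }
      where open IsQuasiFitting qf

    fromAbstract : ∀ {𝓕} → QuasiFitting Ω (Is𝒫 S) (ShortExactSequence S) 𝓕 → IsQuasiFitting S Ω 𝓕
    fromAbstract qf = record
      { unit = λ P → unit {P} ; quotient = λ M′ M P → quotient {M′} {M} {P} ; sub = λ P M M′ → sub {P} {M} {M′} }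
      where open QuasiFitting qf

    -- An isomorphism becomes a short exact sequence starting at the zero module, which lies in `𝒫`
    -- and has value `ε`.
    iso-invariant : ∀ {𝓕} → IsQuasiFitting S Ω 𝓕 → ∀ A B (X : Vector (𝒞 S) 0) → ExactSequence S 0 A X B → 𝓕 A ≈ 𝓕 B
    iso-invariant {𝓕} qf A B X t = begin
      𝓕 A              ≈⟨ sub O A B O∈𝒫 (splice 0 O A A X B (identitySeq A) t) ⟩
      𝓕 O ∙ 𝓕 B        ≈⟨ ∙-congʳ (ShiftOne.𝓕O≈ε Ω 𝓔 (toAbstract qf)) ⟩
      ε ∙ 𝓕 B          ≈⟨ identityˡ _ ⟩
      𝓕 B              ∎
      where
      open IsQuasiFitting qf
      open ExactStructure 𝓔 using (O; O∈𝒫; identitySeq)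

    -- A single `𝓖` equal to all values gives independence and the quasi-Fitting property together.
    -- As `P_1` is adjacent to `N`, cutting there expresses the shift by `n + 1` as the shift by `n`
    -- of the once shifted invariant.
    shiftUp : ∀ n {𝓕} (qf : IsQuasiFitting S Ω 𝓕) → Σ[ 𝓖 ∈ (𝒞 S → Carrier) ] IsQuasiFitting S Ω 𝓖 ×
              (∀ M (s : Shift S (ℤ.+ n) M) → shiftValue S Ω qf s ≈ 𝓖 M)
    shiftUp zero {𝓕} qf = 𝓕 , qf , λ M s →
      let open Shift s in trans (identityˡ (𝓕 N)) (iso-invariant qf N M P sequence)
    shiftUp (suc n) {𝓕} qf =
      let 𝓖 , qf′ , value = shiftUp n shift-qf in
      𝓖 , qf′ , λ M s → let open Shift s ; I , t , u = peel n N P M sequence in begin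
        (u₀ (P zero) (P∈𝒫 zero) ∙ ∏ (λ i → factor (P (suc i)) (P∈𝒫 (suc i)) (suc (suc (toℕ i))))) ∙ 𝓕 N
          ≈⟨ ∙-congʳ (comm _ _) ⟩
        (∏ (λ i → factor (P (suc i)) (P∈𝒫 (suc i)) (suc (suc (toℕ i)))) ∙ u₀ (P zero) (P∈𝒫 zero)) ∙ 𝓕 N
          ≈⟨ assoc _ _ _ ⟩
        ∏ (λ i → factor (P (suc i)) (P∈𝒫 (suc i)) (suc (suc (toℕ i)))) ∙ (u₀ (P zero) (P∈𝒫 zero) ∙ 𝓕 N)
          ≈⟨ ∙-cong (Sum.sum-cong-≋ Ω λ i → power-inverse _ (shift (P (suc i)) , IsQuasiFitting.unit shift-qf _ (P∈𝒫 (suc i)))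
                       (shift-𝒫 {P (suc i)} (P∈𝒫 (suc i))) (suc (toℕ i)))
                    (first N (P zero) I (P∈𝒫 zero) t) ⟩
        ∏ (λ i → (shift (P (suc i)) , IsQuasiFitting.unit shift-qf _ (P∈𝒫 (suc i))) ^ (-1ℤ ℤ.^ suc (toℕ i))) ∙ shift I
          ≈⟨ value M (record { N = I ; P = P ∘ suc ; P∈𝒫 = P∈𝒫 ∘ suc ; sequence = u }) ⟩
        𝓖 M ∎
      where
      open ShiftOne Ω 𝓔 (toAbstract qf) using (shift; shift-char; shift-𝒫; shift-quasiFitting)
      shift-qf : IsQuasiFitting S Ω shift
      shift-qf = fromAbstract shift-quasiFitting
      factor : ∀ P → Is𝒫 S P → ℕ → Carrier
      factor P P∈𝒫 k = (𝓕 P , IsQuasiFitting.unit qf P P∈𝒫) ^ (-1ℤ ℤ.^ k)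
      u₀ : ∀ P → Is𝒫 S P → Carrier
      u₀ P P∈𝒫 = factor P P∈𝒫 1
      first : ∀ N P I (P∈𝒫 : Is𝒫 S P) → ShortExactSequence S N P I → u₀ P P∈𝒫 ∙ 𝓕 N ≈ shift I
      first N P I P∈𝒫 t = begin
        (v ∙ ε) ∙ 𝓕 N            ≈⟨ ∙-cong (identityʳ v) (sym (shift-char {N} {P} {I} P∈𝒫 t)) ⟩
        v ∙ (𝓕 P ∙ shift I)      ≈⟨ assoc _ _ _ ⟨
        (v ∙ 𝓕 P) ∙ shift I      ≈⟨ ∙-congʳ (proj₁ (proj₂ (IsQuasiFitting.unit qf P P∈𝒫))) ⟩
        ε ∙ shift I              ≈⟨ identityˡ _ ⟩
        shift I                  ∎
        where v = proj₁ (IsQuasiFitting.unit qf P P∈𝒫)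

    module _ (𝓔ᵒᵖ : ExactStructure (𝒞 S) (Is𝒫 S) (λ A B C → ShortExactSequence S C B A))
      {𝓕 : 𝒞 S → Carrier} (qf : IsQuasiFitting S Ω 𝓕) where

      private
        factor : ∀ P → Is𝒫 S P → ℕ → Carrier
        factor P P∈𝒫 k = (𝓕 P , IsQuasiFitting.unit qf P P∈𝒫) ^ (-1ℤ ℤ.^ k)

      -- Here the term adjacent to `M` has the highest index, so the last shift is split off instead
      -- of the first. The induction must therefore also carry the values of `𝓖` on `𝒫`.
      shiftDown : ∀ n → Σ[ 𝓖 ∈ (𝒞 S → Carrier) ] IsQuasiFitting S Ω 𝓖 ×
        (∀ P (P∈𝒫 : Is𝒫 S P) → 𝓖 P ≈ factor P P∈𝒫 n) ×
        (∀ M N (P : Vector (𝒞 S) n) (P∈𝒫 : ∀ i → Is𝒫 S (P i)) → ExactSequence S n M (P ∘ opposite) N →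
          ∏ (λ i → factor (P i) (P∈𝒫 i) (suc (toℕ i))) ∙ 𝓕 N ≈ 𝓖 M)
      shiftDown zero = 𝓕 , qf , (λ P P∈𝒫 → sym (identityʳ (𝓕 P))) , λ M N P P∈𝒫 t →
        trans (identityˡ (𝓕 N)) (sym (iso-invariant qf M N (P ∘ opposite) t))
      shiftDown (suc n) =
        shift , fromAbstract (QuasiFitting.reverse shift-quasiFitting) , on-𝒫 , λ M N P P∈𝒫 t →
          let I , u , v = peel n M (P ∘ opposite) N t
              -- `opposite zero` computes to `fromℕ n` and `opposite (suc i)` to
              -- `inject₁ (opposite i)`, so `u` has middle term `L` and `v` is the reversed sequence
              -- of `P ∘ inject₁`.
              L = P (fromℕ n) ; L∈𝒫 = P∈𝒫 (fromℕ n)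
              f = λ (i : Fin (suc n)) → factor (P i) (P∈𝒫 i) (suc (toℕ i))
              f′ = λ (i : Fin n) → factor (P (inject₁ i)) (P∈𝒫 (inject₁ i)) (suc (toℕ i))
          in begin
          ∏ f ∙ 𝓕 N
            ≈⟨ ∙-congʳ (Sum.sum-init-last Ω f) ⟩
          (∏ (f ∘ inject₁) ∙ f (fromℕ n)) ∙ 𝓕 N
            ≡⟨ ≡.cong (λ k → (∏ (f ∘ inject₁) ∙ factor L L∈𝒫 (suc k)) ∙ 𝓕 N) (toℕ-fromℕ n) ⟩
          (∏ (f ∘ inject₁) ∙ factor L L∈𝒫 (suc n)) ∙ 𝓕 N
            ≈⟨ ∙-congʳ (trans (comm _ _) (∙-congˡ (Sum.sum-cong-≋ Ω λ i → reflexive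
                 (≡.cong (λ k → factor (P (inject₁ i)) (P∈𝒫 (inject₁ i)) (suc k)) (toℕ-inject₁ i))))) ⟩
          (factor L L∈𝒫 (suc n) ∙ ∏ f′) ∙ 𝓕 N
            ≈⟨ assoc _ _ _ ⟩
          factor L L∈𝒫 (suc n) ∙ (∏ f′ ∙ 𝓕 N)
            ≈⟨ ∙-congˡ (value I N (P ∘ inject₁) (P∈𝒫 ∘ inject₁) v) ⟩
          factor L L∈𝒫 (suc n) ∙ 𝓖 I
            ≈⟨ last M L I L∈𝒫 u ⟩
          shift M ∎
        where
        𝓖 = proj₁ (shiftDown n)
        qfᴳ = proj₁ (proj₂ (shiftDown n))
        𝓖-on-𝒫 = proj₁ (proj₂ (proj₂ (shiftDown n)))
        value = proj₂ (proj₂ (proj₂ (shiftDown n)))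
        open ShiftOne Ω 𝓔ᵒᵖ (QuasiFitting.reverse (toAbstract qfᴳ))
          using (shift; shift-char; shift-𝒫; shift-quasiFitting)
        inverse : ∀ P (P∈𝒫 : Is𝒫 S P) → factor P P∈𝒫 (suc n) ∙ 𝓖 P ≈ ε
        inverse P P∈𝒫 = trans (∙-congˡ (𝓖-on-𝒫 P P∈𝒫)) (power-alternate _ n)
        on-𝒫 : ∀ P (P∈𝒫 : Is𝒫 S P) → shift P ≈ factor P P∈𝒫 (suc n)
        on-𝒫 P P∈𝒫 = sym (inverse-unique (inverse P P∈𝒫) (shift-𝒫 {P} P∈𝒫))
        last : ∀ M P I (P∈𝒫 : Is𝒫 S P) → ShortExactSequence S M P I → factor P P∈𝒫 (suc n) ∙ 𝓖 I ≈ shift M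
        last M P I P∈𝒫 t = begin
          factor P P∈𝒫 (suc n) ∙ 𝓖 I               ≈⟨ ∙-congˡ (shift-char {I} {P} {M} P∈𝒫 t) ⟨
          factor P P∈𝒫 (suc n) ∙ (𝓖 P ∙ shift M)   ≈⟨ assoc _ _ _ ⟨
          (factor P P∈𝒫 (suc n) ∙ 𝓖 P) ∙ shift M   ≈⟨ ∙-congʳ (inverse P P∈𝒫) ⟩
          ε ∙ shift M                              ≈⟨ identityˡ _ ⟩
          shift M                                  ∎

    quasiFitting-cong : ∀ {𝓕 𝓖} → (∀ M → 𝓕 M ≈ 𝓖 M) → IsQuasiFitting S Ω 𝓖 → IsQuasiFitting S Ω 𝓕
    quasiFitting-cong {𝓕} {𝓖} eq qf = record
      { unit     = λ P P∈𝒫 → let v , l , r = unit P P∈𝒫 in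
          v , trans (∙-congˡ (eq P)) l , trans (∙-congʳ (eq P)) r
      ; quotient = λ M′ M P P∈𝒫 t → trans (eq M) (trans (quotient M′ M P P∈𝒫 t) (sym (∙-cong (eq P) (eq M′))))
      ; sub      = λ P M M′ P∈𝒫 t → trans (eq M) (trans (sub P M M′ P∈𝒫 t) (sym (∙-cong (eq P) (eq M′))))
      }
      where open IsQuasiFitting qf

  -- Existence of the sequences

  existsUp : ExactStructure (𝒞 S) (Is𝒫 S) (ShortExactSequence S) → ∀ n M → Shift S (ℤ.+ n) M
  existsUp 𝓔 zero M = record
    { N = M ; P = Vector.[] ; P∈𝒫 = λ ()
    ; sequence = identitySequence M Vector.[] }
  existsUp 𝓔 (suc n) M =
    let open Shift (existsUp 𝓔 n M)
        N′ , P₀ , P₀∈𝒫 , t = ExactStructure.𝒫-cover 𝓔 N in record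
    { N = N′ ; P = P₀ Vector.∷ P ; P∈𝒫 = λ { zero → P₀∈𝒫 ; (suc i) → P∈𝒫 i }
    ; sequence = splice n N′ P₀ N P M t sequence }

  module _ (𝓔ᵒᵖ : ExactStructure (𝒞 S) (Is𝒫 S) (λ A B C → ShortExactSequence S C B A)) where

    coresolution : ∀ n M → Σ[ N ∈ 𝒞 S ] Σ[ Q ∈ Vector (𝒞 S) n ] (∀ i → Is𝒫 S (Q i)) × ExactSequence S n M Q N
    coresolution zero M = M , Vector.[] , (λ ()) , identitySequence M Vector.[]
    coresolution (suc n) M =
      let I , P₀ , P₀∈𝒫 , t = ExactStructure.𝒫-cover 𝓔ᵒᵖ M
          N , Q , Q∈𝒫 , u = coresolution n I in
      N , P₀ Vector.∷ Q , (λ { zero → P₀∈𝒫 ; (suc i) → Q∈𝒫 i }) , splice n M P₀ I Q N t u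

    existsDown : ∀ n M → Shift S -[1+ n ] M
    existsDown n M =
      let N , Q , Q∈𝒫 , t = coresolution (suc n) M in record
      -- `Shift` numbers the terms from the `N` end while `Q` starts at `M`; the double reversal is
      -- the identity only pointwise.
      { N = N ; P = Q ∘ opposite ; P∈𝒫 = Q∈𝒫 ∘ opposite
      ; sequence = exactSequence-cong (suc n) M N (λ i → ≡.cong Q (≡.sym (opposite-involutive i))) t }

  shiftTheorem : ExactStructure (𝒞 S) (Is𝒫 S) (ShortExactSequence S) →
    ExactStructure (𝒞 S) (Is𝒫 S) (λ A B C → ShortExactSequence S C B A) →
    {a b : Level} (Ω : CommutativeMonoid a b) {𝓕 : 𝒞 S → CommutativeMonoid.Carrier Ω} (qf : IsQuasiFitting S Ω 𝓕) →
    (n : ℤ) →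
    ((M : 𝒞 S) → Shift S n M)
    × ((M : 𝒞 S) (s t : Shift S n M) → CommutativeMonoid._≈_ Ω (shiftValue S Ω qf s) (shiftValue S Ω qf t))
    × ((choose : (M : 𝒞 S) → Shift S n M) → IsQuasiFitting S Ω (λ M → shiftValue S Ω qf (choose M)))
  shiftTheorem 𝓔 𝓔ᵒᵖ Ω qf (ℤ.+ n) =
    let 𝓖 , qf′ , value = shiftUp 𝓔 Ω n qf in
      existsUp 𝓔 n
    , (λ M s t → trans (value M s) (sym (value M t)))
    , λ choose → quasiFitting-cong 𝓔 Ω (λ M → value M (choose M)) qf′
    where open CommutativeMonoid Ω
  shiftTheorem 𝓔 𝓔ᵒᵖ Ω qf -[1+ n ] =
    let 𝓖 , qf′ , _ , value = shiftDown 𝓔 Ω 𝓔ᵒᵖ qf (suc n)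
        value′ = λ M (s : Shift S -[1+ n ] M) →
          value M (Shift.N s) (Shift.P s) (Shift.P∈𝒫 s) (Shift.sequence s) in
      existsDown 𝓔ᵒᵖ n
    , (λ M s t → trans (value′ M s) (sym (value′ M t)))
    , λ choose → quasiFitting-cong 𝓔 Ω (λ M → value′ M (choose M)) qf′
    where open CommutativeMonoid Ω

-- Dimension shifting counts with a natural number, while `d` may be negative. `Ext0` at `∣ d ∣ + m`
-- concerns degree `∣ d ∣ + m + 1`, which exceeds `d` in either case.
pd⋆-bound : {ℓ : Level} {R : Ring ℓ ℓ} (d : ℤ) → ((M : Mod R) → FinitelyGenerated M → pd⋆ M ≤ d) →
            ∀ {M : Mod R} → Generated M → ∀ m → Ext0 (ℤ.∣ d ∣ + m) M
pd⋆-bound d pd⋆≤d {M} M-gen m = E-zero⇒Ext0 M (ℤ.∣ d ∣ + m)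
  (pd⋆≤d M (generated⇒finitelyGenerated M-gen) (suc (ℤ.∣ d ∣ + m))
    (ℤ.≤-<-trans (i≤∣i∣ d) (ℤ.+<+ (s≤s (m≤m+n ℤ.∣ d ∣ m)))))
  where
  i≤∣i∣ : ∀ i → i ℤ.≤ ℤ.+ ℤ.∣ i ∣
  i≤∣i∣ (ℤ.+ n)  = ℤ.≤-refl
  i≤∣i∣ -[1+ n ] = ℤ.-≤+

theorem3p19 : {ℓ a b : Level} (R : Ring ℓ ℓ) →
    LeftNoetherian R → LeftNoetherian (R ᵒᵖ) →
    (S : OreSet R) →
    (d : ℤ) →
    ((M : Mod R) → FinitelyGenerated M → pd⋆ M ≤ d) →
    ((M : Mod (R ᵒᵖ)) → FinitelyGenerated M → pd⋆ M ≤ d) →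
    (Ω : CommutativeMonoid a b) →
    (𝓕 : 𝒞 S → CommutativeMonoid.Carrier Ω) (qf : IsQuasiFitting S Ω 𝓕) →
    (n : ℤ) →
    ((M : 𝒞 S) → Shift S n M)
    × ((M : 𝒞 S) (s t : Shift S n M) → CommutativeMonoid._≈_ Ω (shiftValue S Ω qf s) (shiftValue S Ω qf t))
    × ((choose : (M : 𝒞 S) → Shift S n M) → IsQuasiFitting S Ω (λ M → shiftValue S Ω qf (choose M)))
theorem3p19 R noeth noethᵒᵖ S d _ pd⋆≤d Ω 𝓕 qf n = shiftTheorem noeth S (exactStructure noeth S)
  (oppositeExactStructure noeth S noethᵒᵖ ℤ.∣ d ∣ (pd⋆-bound d pd⋆≤d)) Ω qf n
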